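{- Let $a,b\in\mathbb{R}$ be distinct, and let $T$ be a tree. The following statements characterize when $T$ admits no proper $\{a,b\}$-edge-weighting. (i) If $ab(a+b)\neq 0$, then $T$ admits no proper $\{a,b\}$-edge-weighting if and only if $T\cong K_2$. (ii) If $a+b=0$, then $T$ admits no proper $\{a,b\}$-edge-weighting if and only if $T\in\mathcal{C}$. (iii) If $ab=0$, then $T$ admits no proper $\{a,b\}$-edge-weighting if and only if both bipartition classes of $T$ have odd order and, for every component $H$ of the odd-cut skeleton $J(T)$, the tree $H$ belongs to $\mathcal{C}$ and the adjusted load $\lambda_T$ is constant on $V(H)$.
   Context: All graphs are finite and simple; the one-vertex tree is allowed as a tree (its bipartition classes have orders $1$ and $0$). The order of a graph or vertex set is its number of vertices. For a graph $G$, $E_G(v)$ is the set of edges incident with $v$ and $d_G(v)$ is the degree of $v$. For a set $W$ of real numbers, a $W$-edge-weighting of a graph $G$ is a map $\omega:E(G)\to W$. It induces the weighted degree $s_\omega(v)=\sum_{e\in E_G(v)}\omega(e)$ at each vertex $v$. The weighting is proper if $s_\omega(u)\neq s_\omega(v)$ for every edge $uv$ of $G$. For a graph $G$, $D_3(G)$ denotes the subgraph of $G$ induced by the vertices of degree $3$ in $G$. The empty graph is considered to have a perfect matching. $\mathcal{C}$ is the family of trees $H$ such that every vertex of $H$ has degree $1$ or $3$ in $H$ and $D_3(H)$ has a perfect matching (so $K_2\in\mathcal{C}$). For a tree $T$, the odd-cut skeleton $J(T)$ is the spanning forest of $T$ (with vertex set $V(T)$) whose edges are those edges $e$ of $T$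 for which both components of $T-e$ have odd order. A vertex incident with no such edge is an isolated vertex of $J(T)$. Suppose $T$ has bipartition $X\cup Y$ with $|X|$ and $|Y|$ odd. For every edge $e$ of $T$ not in $J(T)$ (a nonskeleton edge), the two components of $T-e$ have even order, and exactly one of them contains an odd number of vertices from each of $X$ and $Y$; orient $e$ toward that component (from its endpoint in the other component to its endpoint in that component). Let $\ell_T(v)$ be the number of nonskeleton edges incident with $v$ that are directed away from $v$. The adjusted load of $v$ is $\lambda_T(v)=d_{J(T)}(v)+2\ell_T(v)$. -}

module Defs where

open import Level using (0ℓ)
open import Algebra.Bundles.Raw using (RawMonoid)
import Algebra.Definitions.RawMonoid as RawMonoidDefinitions
open import Data.Bool.Base using (if_then_else_)
open import Data.Empty using () renaming (⊥ to Empty)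
open import Data.Fin.Base using (Fin)
import Data.Fin.Properties as Fin
open import Data.Fin.Subset using (Subset; _∈_; _∉_; _⊆_; _∪_; _∩_; ∣_∣; ⊤; ⊥; Nonempty)
open import Data.Fin.Subset.Properties using (_∈?_; ∈⊤; x∈p∩q⁺)
open import Data.List.Base using (List; []; _∷_; _∷ʳ_; length; allFin)
open import Data.List.Membership.Propositional using () renaming (_∈_ to _∈ᴸ_)
open import Data.List.Membership.Propositional.Properties using (∈-allFin)
open import Data.List.Relation.Unary.Any using (here; there)
open import Data.List.Relation.Unary.Linked using (Linked)
open import Data.List.Relation.Unary.Unique.Propositional using (Unique)
open import Data.Nat.Base as ℕ using (ℕ)
open import Data.Nat.Divisibility using (_∣_; _∣?_)
import Data.Nat.Properties as ℕ
open import Data.Product.Base using (Σ; ∃-syntax; _×_; _,_; proj₁; proj₂)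
open import Data.Rational.Base as ℚ using (ℚ; 0ℚ; 1ℚ; ½)
import Data.Rational.Properties as ℚ
import Data.Rational.Solver as ℚ-Solver
open import Data.Sum.Base using (_⊎_; inj₁; inj₂)
open import Data.Vec.Base using (tabulate)
open import Data.Vec.Properties using (lookup⇒[]=; []=⇒lookup; lookup∘tabulate)
open import Function.Base using (_∘_)
open import Function.Bundles using (_↔_; _⇔_; Inverse)
open import Relation.Binary.Core using (Rel)
open import Relation.Binary.Definitions using (Decidable; Symmetric)
open import Relation.Binary.Construct.Closure.ReflexiveTransitive using (Star; _◅_; _◅◅_) renaming (ε to nil)
open import Relation.Binary.PropositionalEquality
  using (_≡_; refl; sym; trans; cong; cong₂; subst)
open import Relation.Nullary using (¬_; does; yes)
open import Relation.Nullary.Decidable using (map′; ¬?; _×-dec_; _⊎-dec_; dec-true)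
open import Relation.Unary using (Pred) renaming (Decidable to Decidable₁)

------------------------------------------------------------------------
-- Real numbers: Cauchy sequences of rationals modulo null sequences.
-- Inequality of reals is the plain negation of _≈_, not apartness.

IsCauchy : (ℕ → ℚ) → Set
IsCauchy x = ∀ ε → 0ℚ ℚ.< ε →
  ∃[ K ] ∀ i j → K ℕ.≤ i → K ℕ.≤ j → ℚ.∣ x i ℚ.- x j ∣ ℚ.< ε

record ℝ : Set where
  constructor real
  field
    seq    : ℕ → ℚ
    cauchy : IsCauchy seq

open ℝ public

infix 4 _≈_ _≉_

_≈_ : Rel ℝ 0ℓ
x ≈ y = ∀ ε → 0ℚ ℚ.< ε →
  ∃[ K ] ∀ i → K ℕ.≤ i → ℚ.∣ seq x i ℚ.- seq y i ∣ ℚ.< ε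

_≉_ : Rel ℝ 0ℓ
x ≉ y = ¬ (x ≈ y)

0ℝ : ℝ
0ℝ = real (λ _ → 0ℚ) λ ε 0<ε → 0 , λ _ _ _ _ → 0<ε

half-pos : ∀ {ε} → 0ℚ ℚ.< ε → 0ℚ ℚ.< ½ ℚ.* ε
half-pos {ε} 0<ε = subst (ℚ._< ½ ℚ.* ε) (ℚ.*-zeroʳ ½) (ℚ.*-monoʳ-<-pos ½ 0<ε)

two-halves : ∀ ε → ½ ℚ.* ε ℚ.+ ½ ℚ.* ε ≡ ε
two-halves ε = trans (sym (ℚ.*-distribʳ-+ ε ½ ½)) (ℚ.*-identityˡ ε)

open ℚ-Solver.+-*-Solver using (solve; _:+_; _:*_; _:-_; _:=_)

abstract
  +-cauchy : ∀ {x y} → IsCauchy x → IsCauchy y → IsCauchy (λ i → x i ℚ.+ y i)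
  +-cauchy {x} {y} cx cy ε 0<ε
    with cx (½ ℚ.* ε) (half-pos 0<ε) | cy (½ ℚ.* ε) (half-pos 0<ε)
  ... | K , hx | L , hy = K ℕ.⊔ L , λ i j Mi Mj → begin-strict
      ℚ.∣ (x i ℚ.+ y i) ℚ.- (x j ℚ.+ y j) ∣
        ≡⟨ cong ℚ.∣_∣ (solve 4 (λ a b c d → (a :+ b) :- (c :+ d) := (a :- c) :+ (b :- d))
             refl (x i) (y i) (x j) (y j)) ⟩
      ℚ.∣ (x i ℚ.- x j) ℚ.+ (y i ℚ.- y j) ∣
        ≤⟨ ℚ.∣p+q∣≤∣p∣+∣q∣ (x i ℚ.- x j) (y i ℚ.- y j) ⟩
      ℚ.∣ x i ℚ.- x j ∣ ℚ.+ ℚ.∣ y i ℚ.- y j ∣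
        <⟨ ℚ.+-mono-< (hx i j (ℕ.≤-trans (ℕ.m≤m⊔n K L) Mi) (ℕ.≤-trans (ℕ.m≤m⊔n K L) Mj))
                      (hy i j (ℕ.≤-trans (ℕ.m≤n⊔m K L) Mi) (ℕ.≤-trans (ℕ.m≤n⊔m K L) Mj)) ⟩
      ½ ℚ.* ε ℚ.+ ½ ℚ.* ε
        ≡⟨ two-halves ε ⟩
      ε ∎
    where open ℚ.≤-Reasoning

EventuallyBoundedBy : (ℕ → ℚ) → ℕ → ℚ → Set
EventuallyBoundedBy x K B = ∀ i → K ℕ.≤ i → ℚ.∣ x i ∣ ℚ.≤ B

bounded : ∀ {x} → IsCauchy x → ∃[ K ] ∃[ B ] 0ℚ ℚ.< B × EventuallyBoundedBy x K B
bounded {x} cx with cx 1ℚ (ℚ.positive⁻¹ 1ℚ)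
... | K , h = K , 1ℚ ℚ.+ ℚ.∣ x K ∣
            , ℚ.+-mono-<-≤ (ℚ.positive⁻¹ 1ℚ) (ℚ.0≤∣p∣ (x K))
            , λ i Ki → begin
    ℚ.∣ x i ∣
      ≡⟨ cong ℚ.∣_∣ (solve 2 (λ a b → a := (a :- b) :+ b) refl (x i) (x K)) ⟩
    ℚ.∣ (x i ℚ.- x K) ℚ.+ x K ∣
      ≤⟨ ℚ.∣p+q∣≤∣p∣+∣q∣ (x i ℚ.- x K) (x K) ⟩
    ℚ.∣ x i ℚ.- x K ∣ ℚ.+ ℚ.∣ x K ∣
      ≤⟨ ℚ.+-monoˡ-≤ ℚ.∣ x K ∣ (ℚ.<⇒≤ (h i K Ki ℕ.≤-refl)) ⟩
    1ℚ ℚ.+ ℚ.∣ x K ∣ ∎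
  where open ℚ.≤-Reasoning

-- For B > 0 there is δ > 0 with B * δ = ε / 2.
shrink : ∀ B ε → 0ℚ ℚ.< B → 0ℚ ℚ.< ε → ∃[ δ ] 0ℚ ℚ.< δ × B ℚ.* δ ≡ ½ ℚ.* ε
shrink B ε 0<B 0<ε = δ , 0<δ , eq
  where
  instance
    B-pos : ℚ.Positive B
    B-pos = ℚ.positive 0<B
    B-nz : ℚ.NonZero B
    B-nz = ℚ.pos⇒nonZero B
    1/B-pos : ℚ.Positive (ℚ.1/ B)
    1/B-pos = ℚ.1/pos⇒pos B

  δ : ℚ
  δ = ℚ.1/ B ℚ.* (½ ℚ.* ε)

  0<δ : 0ℚ ℚ.< δ
  0<δ = subst (ℚ._< δ) (ℚ.*-zeroʳ (ℚ.1/ B)) (ℚ.*-monoʳ-<-pos (ℚ.1/ B) (half-pos 0<ε))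

  eq : B ℚ.* δ ≡ ½ ℚ.* ε
  eq = trans (sym (ℚ.*-assoc B (ℚ.1/ B) (½ ℚ.* ε)))
      (trans (cong (ℚ._* (½ ℚ.* ε)) (ℚ.*-inverseʳ B)) (ℚ.*-identityˡ _))

*-small : ∀ B {δ} p q → 0ℚ ℚ.< B → ℚ.∣ p ∣ ℚ.≤ B → ℚ.∣ q ∣ ℚ.< δ → ℚ.∣ p ℚ.* q ∣ ℚ.< B ℚ.* δ
*-small B {δ} p q 0<B p≤B q<δ = begin-strict
    ℚ.∣ p ℚ.* q ∣         ≡⟨ ℚ.∣p*q∣≡∣p∣*∣q∣ p q ⟩
    ℚ.∣ p ∣ ℚ.* ℚ.∣ q ∣   ≤⟨ ℚ.*-monoʳ-≤-nonNeg ℚ.∣ q ∣ {{ℚ.∣-∣-nonNeg q}} p≤B ⟩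
    B ℚ.* ℚ.∣ q ∣         <⟨ ℚ.*-monoʳ-<-pos B {{ℚ.positive 0<B}} q<δ ⟩
    B ℚ.* δ               ∎
  where open ℚ.≤-Reasoning

*-difference : ∀ B C {δ η} p q r s → 0ℚ ℚ.< B → 0ℚ ℚ.< C →
  ℚ.∣ p ∣ ℚ.≤ B → ℚ.∣ s ∣ ℚ.≤ C → ℚ.∣ q ℚ.- s ∣ ℚ.< δ → ℚ.∣ p ℚ.- r ∣ ℚ.< η →
  ℚ.∣ p ℚ.* q ℚ.- r ℚ.* s ∣ ℚ.< B ℚ.* δ ℚ.+ C ℚ.* η
*-difference B C {δ} {η} p q r s 0<B 0<C p≤B s≤C q-s<δ p-r<η = begin-strict
    ℚ.∣ p ℚ.* q ℚ.- r ℚ.* s ∣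
      ≡⟨ cong ℚ.∣_∣ (solve 4
           (λ a b c d → a :* b :- c :* d := a :* (b :- d) :+ d :* (a :- c))
           refl p q r s) ⟩
    ℚ.∣ p ℚ.* (q ℚ.- s) ℚ.+ s ℚ.* (p ℚ.- r) ∣
      ≤⟨ ℚ.∣p+q∣≤∣p∣+∣q∣ (p ℚ.* (q ℚ.- s)) (s ℚ.* (p ℚ.- r)) ⟩
    ℚ.∣ p ℚ.* (q ℚ.- s) ∣ ℚ.+ ℚ.∣ s ℚ.* (p ℚ.- r) ∣
      <⟨ ℚ.+-mono-< (*-small B p (q ℚ.- s) 0<B p≤B q-s<δ)
                    (*-small C s (p ℚ.- r) 0<C s≤C p-r<η) ⟩
    B ℚ.* δ ℚ.+ C ℚ.* η ∎
  where open ℚ.≤-Reasoning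

abstract
  *-cauchy : ∀ {x y} → IsCauchy x → IsCauchy y → IsCauchy (λ i → x i ℚ.* y i)
  *-cauchy {x} {y} cx cy ε 0<ε =
    let K₁ , B , 0<B , hB = bounded cx
        K₂ , C , 0<C , hC = bounded cy
        δ , 0<δ , Bδ = shrink B ε 0<B 0<ε
        η , 0<η , Cη = shrink C ε 0<C 0<ε
        K₃ , hy = cy δ 0<δ
        K₄ , hx = cx η 0<η
        K₁₂ = K₁ ℕ.⊔ K₂
        K₃₄ = K₃ ℕ.⊔ K₄
        ≥₁₂ = λ i → ℕ.≤-trans {j = K₁₂ ℕ.⊔ K₃₄} {k = i} (ℕ.m≤m⊔n K₁₂ K₃₄)
        ≥₃₄ = λ i → ℕ.≤-trans {j = K₁₂ ℕ.⊔ K₃₄} {k = i} (ℕ.m≤n⊔m K₁₂ K₃₄)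
    in K₁₂ ℕ.⊔ K₃₄ , λ i j Mi Mj →
      subst (ℚ.∣ x i ℚ.* y i ℚ.- x j ℚ.* y j ∣ ℚ.<_)
        (trans (cong₂ ℚ._+_ Bδ Cη) (two-halves ε))
        (*-difference B C (x i) (y i) (x j) (y j) 0<B 0<C
          (hB i (ℕ.≤-trans (ℕ.m≤m⊔n K₁ K₂) (≥₁₂ i Mi)))
          (hC j (ℕ.≤-trans (ℕ.m≤n⊔m K₁ K₂) (≥₁₂ j Mj)))
          (hy i j (ℕ.≤-trans (ℕ.m≤m⊔n K₃ K₄) (≥₃₄ i Mi)) (ℕ.≤-trans (ℕ.m≤m⊔n K₃ K₄) (≥₃₄ j Mj)))
          (hx i j (ℕ.≤-trans (ℕ.m≤n⊔m K₃ K₄) (≥₃₄ i Mi)) (ℕ.≤-trans (ℕ.m≤n⊔m K₃ K₄) (≥₃₄ j Mj))))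

infixl 6 _+ℝ_
infixl 7 _*ℝ_

_+ℝ_ : ℝ → ℝ → ℝ
x +ℝ y = real (λ i → seq x i ℚ.+ seq y i) (+-cauchy {seq x} {seq y} (cauchy x) (cauchy y))

_*ℝ_ : ℝ → ℝ → ℝ
x *ℝ y = real (λ i → seq x i ℚ.* seq y i) (*-cauchy {seq x} {seq y} (cauchy x) (cauchy y))

+ℝ-0ℝ-rawMonoid : RawMonoid 0ℓ 0ℓ
+ℝ-0ℝ-rawMonoid = record { Carrier = ℝ ; _≈_ = _≈_ ; _∙_ = _+ℝ_ ; ε = 0ℝ }

open RawMonoidDefinitions +ℝ-0ℝ-rawMonoid public using (sum)

------------------------------------------------------------------------
-- Comprehension for finite subsets

private
  variable
    n m : ℕ

⟪_⟫ : {P : Pred (Fin n) 0ℓ} → Decidable₁ P → Subset n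
⟪ P? ⟫ = tabulate (does ∘ P?)

∈⟪⟫⁺ : {P : Pred (Fin n) 0ℓ} (P? : Decidable₁ P) {v : Fin n} → P v → v ∈ ⟪ P? ⟫
∈⟪⟫⁺ P? {v} p = lookup⇒[]= v _ (trans (lookup∘tabulate (does ∘ P?) v) (dec-true (P? v) p))

∈⟪⟫⁻ : {P : Pred (Fin n) 0ℓ} (P? : Decidable₁ P) {v : Fin n} → v ∈ ⟪ P? ⟫ → P v
∈⟪⟫⁻ P? {v} v∈ with P? v | trans (sym (lookup∘tabulate (does ∘ P?) v)) ([]=⇒lookup v∈)
... | yes p | _ = p

------------------------------------------------------------------------
-- Finite simple graphs

-- The vertex set is a subset of Fin n, so that a graph and all of its
-- subgraphs have the same type; N v is the neighbourhood of v, which is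
-- empty when v is not a vertex.
record Graph (n : ℕ) : Set where
  field
    V        : Subset n
    N        : Fin n → Subset n
    N⊆V      : ∀ {u} → N u ⊆ V
    N-sym    : ∀ {u v} → v ∈ N u → u ∈ N v
    N-irrefl : ∀ {u} → u ∉ N u

open Graph public

_⊢_~_ : Graph n → Fin n → Fin n → Set
G ⊢ u ~ v = v ∈ N G u

_⊢_~?_ : (G : Graph n) → Decidable (G ⊢_~_)
G ⊢ u ~? v = v ∈? N G u

degree : Graph n → Fin n → ℕ
degree G v = ∣ N G v ∣

Vertex : Graph n → Set
Vertex G = ∃[ v ] v ∈ V G

record _≅_ (G : Graph m) (H : Graph n) : Set where
  field
    vertices : Vertex G ↔ Vertex H
  open Inverse vertices using (to)
  field
    edges : ∀ u v → G ⊢ proj₁ u ~ proj₁ v ⇔ H ⊢ proj₁ (to u) ~ proj₁ (to v)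

K₂ : Graph 2
K₂ = record
  { V        = ⊤
  ; N        = λ u → ⟪ ≢? u ⟫
  ; N⊆V      = λ _ → ∈⊤
  ; N-sym    = λ {u} {v} v∈ → ∈⟪⟫⁺ (≢? v) λ v≡u → ∈⟪⟫⁻ (≢? u) v∈ (sym v≡u)
  ; N-irrefl = λ {u} u∈ → ∈⟪⟫⁻ (≢? u) u∈ refl
  }
  where
  ≢? : (u : Fin 2) → Decidable₁ (λ v → ¬ (u ≡ v))
  ≢? u v = ¬? (u Fin.≟ v)

induced : Graph n → Subset n → Graph n
induced {n} G S = record
  { V        = V G ∩ S
  ; N        = λ u → ⟪ Q? u ⟫
  ; N⊆V      = λ {u} v∈ → let (uv , _ , v∈S) = ∈⟪⟫⁻ (Q? u) v∈ in x∈p∩q⁺ (N⊆V G uv , v∈S)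
  ; N-sym    = λ {u} {v} v∈ → let (uv , u∈S , v∈S) = ∈⟪⟫⁻ (Q? u) v∈ in
                 ∈⟪⟫⁺ (Q? v) (N-sym G uv , v∈S , u∈S)
  ; N-irrefl = λ {u} u∈ → N-irrefl G (proj₁ (∈⟪⟫⁻ (Q? u) u∈))
  }
  where
  Q? : ∀ u → Decidable₁ (λ v → G ⊢ u ~ v × u ∈ S × v ∈ S)
  Q? u v = (G ⊢ u ~? v) ×-dec (u ∈? S) ×-dec (v ∈? S)

spanning : (G : Graph n) {R : Rel (Fin n) 0ℓ} → Decidable R → Symmetric R → Graph n
spanning {n} G {R} R? R-sym = record
  { V        = V G
  ; N        = λ u → ⟪ Q? u ⟫
  ; N⊆V      = λ {u} v∈ → N⊆V G (proj₁ (∈⟪⟫⁻ (Q? u) v∈))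
  ; N-sym    = λ {u} {v} v∈ → let (uv , r) = ∈⟪⟫⁻ (Q? u) v∈ in
                 ∈⟪⟫⁺ (Q? v) (N-sym G uv , R-sym r)
  ; N-irrefl = λ {u} u∈ → N-irrefl G (proj₁ (∈⟪⟫⁻ (Q? u) u∈))
  }
  where
  Q? : ∀ u → Decidable₁ (λ v → G ⊢ u ~ v × R u v)
  Q? u v = (G ⊢ u ~? v) ×-dec R? u v

SameEdge : Fin n → Fin n → Rel (Fin n) 0ℓ
SameEdge u v x y = (x ≡ u × y ≡ v) ⊎ (x ≡ v × y ≡ u)

sameEdge? : (u v : Fin n) → Decidable (SameEdge u v)
sameEdge? u v x y = ((x Fin.≟ u) ×-dec (y Fin.≟ v)) ⊎-dec ((x Fin.≟ v) ×-dec (y Fin.≟ u))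

SameEdge-sym : (u v : Fin n) → Symmetric (SameEdge u v)
SameEdge-sym u v (inj₁ (p , q)) = inj₂ (q , p)
SameEdge-sym u v (inj₂ (p , q)) = inj₁ (q , p)

_-[_,_] : Graph n → Fin n → Fin n → Graph n
G -[ u , v ] = spanning G (λ x y → ¬? (sameEdge? u v x y)) (_∘ SameEdge-sym u v)

------------------------------------------------------------------------
-- Walks, connected components, trees

Walk : Graph n → Rel (Fin n) 0ℓ
Walk G = Star (G ⊢_~_)

-- Walks are decided by the Floyd–Warshall recursion: Via ks u v says that
-- v can be reached from u with all intermediate vertices in ks.
private
  module Reachability (G : Graph n) where

    Via : List (Fin n) → Rel (Fin n) 0ℓ
    Via []       u v = u ≡ v ⊎ G ⊢ u ~ v
    Via (k ∷ ks) u v = Via ks u v ⊎ (Via ks u k × Via ks k v)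

    via? : ∀ ks → Decidable (Via ks)
    via? []       u v = (u Fin.≟ v) ⊎-dec (G ⊢ u ~? v)
    via? (k ∷ ks) u v = via? ks u v ⊎-dec (via? ks u k ×-dec via? ks k v)

    sound : ∀ ks {u v} → Via ks u v → Walk G u v
    sound []       (inj₁ refl)    = nil
    sound []       (inj₂ uv)      = uv ◅ nil
    sound (k ∷ ks) (inj₁ p)       = sound ks p
    sound (k ∷ ks) (inj₂ (p , q)) = sound ks p ◅◅ sound ks q

    lift : ∀ ks {u v} → Via [] u v → Via ks u v
    lift []       p = p
    lift (k ∷ ks) p = inj₁ (lift ks p)

    join : ∀ ks {u k v} → k ∈ᴸ ks → Via ks u k → Via ks k v → Via ks u v
    join (k ∷ ks) (here refl) p q = inj₂ (into p , out q)
      where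
      into : ∀ {u} → Via (k ∷ ks) u k → Via ks u k
      into (inj₁ p)       = p
      into (inj₂ (p , _)) = p
      out : ∀ {v} → Via (k ∷ ks) k v → Via ks k v
      out (inj₁ q)       = q
      out (inj₂ (_ , q)) = q
    join (_ ∷ ks) (there k∈) (inj₁ p)       (inj₁ q)       = inj₁ (join ks k∈ p q)
    join (_ ∷ ks) (there k∈) (inj₁ p)       (inj₂ (q , r)) = inj₂ (join ks k∈ p q , r)
    join (_ ∷ ks) (there k∈) (inj₂ (p , q)) (inj₁ r)       = inj₂ (p , join ks k∈ q r)
    join (_ ∷ ks) (there k∈) (inj₂ (p , _)) (inj₂ (_ , r)) = inj₂ (p , r)

    complete : ∀ {u v} → Walk G u v → Via (allFin n) u v
    complete nil       = lift (allFin n) (inj₁ refl)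
    complete (uw ◅ p) = join (allFin n) (∈-allFin _) (lift (allFin n) (inj₂ uw)) (complete p)

walk? : (G : Graph n) → Decidable (Walk G)
walk? {n} G u v = map′ (sound (allFin n)) complete (via? (allFin n) u v)
  where open Reachability G

component : Graph n → Fin n → Subset n
component G u = ⟪ walk? G u ⟫

Connected : Graph n → Set
Connected G = ∀ {u v} → u ∈ V G → v ∈ V G → Walk G u v

IsCycle : Graph n → List (Fin n) → Set
IsCycle G []       = Empty
IsCycle G (v ∷ vs) = 2 ℕ.≤ length vs × Unique (v ∷ vs) × Linked (G ⊢_~_) (v ∷ vs ∷ʳ v)

record IsTree (G : Graph n) : Set where
  field
    nonempty  : Nonempty (V G)
    connected : Connected G
    acyclic   : ∀ vs → ¬ IsCycle G vs

record IsBipartition (G : Graph n) (X Y : Subset n) : Set where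
  field
    cover    : X ∪ Y ≡ V G
    disjoint : X ∩ Y ≡ ⊥
    crossing : ∀ {u v} → G ⊢ u ~ v → (u ∈ X × v ∈ Y) ⊎ (u ∈ Y × v ∈ X)

------------------------------------------------------------------------
-- The class 𝒞

D₃ : Graph n → Graph n
D₃ G = induced G ⟪ (λ v → degree G v ℕ.≟ 3) ⟫

-- A set of edges M is given as the spanning subgraph with edge set M.
record PerfectMatching (G : Graph n) : Set where
  field
    M         : Graph n
    V-M       : V M ≡ V G
    M⊆G       : ∀ {u v} → M ⊢ u ~ v → G ⊢ u ~ v
    saturated : ∀ {v} → v ∈ V G → degree M v ≡ 1

record 𝒞 (H : Graph n) : Set where
  field
    isTree   : IsTree H
    degrees  : ∀ {v} → v ∈ V H → degree H v ≡ 1 ⊎ degree H v ≡ 3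
    matching : PerfectMatching (D₃ H)

------------------------------------------------------------------------
-- Edge weightings

-- A map on the (undirected) edges, given as a map on pairs of vertices that is
-- symmetric on adjacent pairs; its values on other pairs are irrelevant.
record EdgeWeighting (W : Pred ℝ 0ℓ) (G : Graph n) : Set where
  field
    weight     : Fin n → Fin n → ℝ
    weight-sym : ∀ {u v} → G ⊢ u ~ v → weight u v ≈ weight v u
    weight∈W   : ∀ {u v} → G ⊢ u ~ v → W (weight u v)

open EdgeWeighting public

weightedDegree : {W : Pred ℝ 0ℓ} (G : Graph n) → EdgeWeighting W G → Fin n → ℝ
weightedDegree G ω v = sum λ u → if does (G ⊢ v ~? u) then weight ω v u else 0ℝ

Proper : {W : Pred ℝ 0ℓ} (G : Graph n) → EdgeWeighting W G → Set
Proper G ω = ∀ {u v} → G ⊢ u ~ v → weightedDegree G ω u ≉ weightedDegree G ω v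

AdmitsProper : Pred ℝ 0ℓ → Graph n → Set
AdmitsProper W G = Σ (EdgeWeighting W G) (Proper G)

｛_,_｝ : ℝ → ℝ → Pred ℝ 0ℓ
｛ a , b ｝ x = x ≈ a ⊎ x ≈ b

------------------------------------------------------------------------
-- The odd-cut skeleton and the adjusted load

Odd : ℕ → Set
Odd k = ¬ (2 ∣ k)

odd? : Decidable₁ Odd
odd? k = ¬? (2 ∣? k)

-- For an edge uv of a tree T, the component of T - uv containing v.
side : Graph n → Fin n → Fin n → Subset n
side T u v = component (T -[ u , v ]) v

OddCut : Graph n → Rel (Fin n) 0ℓ
OddCut T u v = Odd ∣ side T u v ∣ × Odd ∣ side T v u ∣

J : Graph n → Graph n
J T = spanning T oddCut? λ (p , q) → q , p
  where
  oddCut? : Decidable (OddCut T)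
  oddCut? u v = odd? ∣ side T u v ∣ ×-dec odd? ∣ side T v u ∣

-- DirectedAway T X Y v w: vw is a nonskeleton edge, oriented from v to w.
DirectedAway : Graph n → Subset n → Subset n → Rel (Fin n) 0ℓ
DirectedAway T X Y v w =
  T ⊢ v ~ w × ¬ (J T ⊢ v ~ w) × Odd ∣ side T v w ∩ X ∣ × Odd ∣ side T v w ∩ Y ∣

directedAway? : (T : Graph n) (X Y : Subset n) → Decidable (DirectedAway T X Y)
directedAway? T X Y v w =
  (T ⊢ v ~? w) ×-dec ¬? (J T ⊢ v ~? w)
    ×-dec odd? ∣ side T v w ∩ X ∣ ×-dec odd? ∣ side T v w ∩ Y ∣

outLoad : Graph n → Subset n → Subset n → Fin n → ℕ
outLoad T X Y v = ∣ ⟪ directedAway? T X Y v ⟫ ∣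

adjustedLoad : Graph n → Subset n → Subset n → Fin n → ℕ
adjustedLoad T X Y v = degree (J T) v ℕ.+ 2 ℕ.* outLoad T X Y v

-- Every component of J T is the component of some vertex r of T.
skeletonComponent : Graph n → Fin n → Graph n
skeletonComponent T r = induced (J T) (component (J T) r)

record SkeletonCondition (T : Graph n) (X Y : Subset n) : Set where
  field
    inClass  : ∀ {r} → r ∈ V T → 𝒞 (skeletonComponent T r)
    constant : ∀ {r} → r ∈ V T →
               ∀ {u v} → u ∈ V (skeletonComponent T r) → v ∈ V (skeletonComponent T r) →
               adjustedLoad T X Y u ≡ adjustedLoad T X Y v

-- A weighting is a labelling of the edges by Booleans (false for a, true for b), and all cases are decided by
-- recursion over the planted subtrees, the sides of v at the edges pv: which counts of true edges at v can be
-- achieved by labellings that are proper on the side, for a given label of pv? A subtree with two achievable counts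
-- for a label never hinders p from using that label, and a pigeonhole over the kids of v shows that two counts are
-- nearly always achievable.
--
-- If ab(a + b) ≠ 0, then only leaves are hindrances, which leaves K₂. If a + b = 0, then the subtrees that hinder p for
-- both labels are exactly the planted members of 𝒞, in two kinds according to whether pv is in the matching. This
-- remains true if the values of the vertices are shifted by an offset, and then the offset must be constant.
--
-- If ab = 0, then counts of prescribed parities can be realized whenever the parities sum to an even number, which settles
-- the case of an even bipartition class. Otherwise, suppose that every nonskeleton edge at a component H of the skeleton
-- is true exactly when it is directed away from H. Then H is in the situation of the second case, with the adjusted load
-- as offset, and a proper labelling of H extends to T since each branch at H can be given either of two alternating
-- parity patterns. Conversely, every labelling has such a component H, since it treats each nonskeleton edge as
-- required at exactly one of its ends.

module Submission where

open import Axiom.UniquenessOfIdentityProofs using (module Decidable⇒UIP)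
open import Data.Bool.Base using (Bool; true; false; not; _∧_; _∨_; _xor_; if_then_else_)
import Data.Bool.Properties as Bool
open import Data.Empty using (⊥-elim) renaming (⊥ to Empty)
open import Data.Fin using (#_)
open import Data.Fin.Base using (Fin; zero; suc; toℕ; fromℕ<)
import Data.Fin.Properties as Fin
open import Data.Fin.Subset using (Subset; _∈_; _∉_; _∪_; _∩_; ∣_∣; inside; outside; ⊥)
open import Data.Fin.Subset.Properties
  using (_∈?_; x∈p∩q⁺; x∈p∩q⁻; x∈p∪q⁻; x∈p∪q⁺; ∉⊥; ⊆-antisym; Empty-unique)
open import Data.List.Base using (List; []; _∷_; _∷ʳ_)
open import Data.List.Membership.Propositional using () renaming (_∈_ to _∈ᴸ_)
open import Data.List.Relation.Unary.All using () renaming ([] to []ᴬ)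
open import Data.List.Relation.Unary.All.Properties using (¬Any⇒All¬)
open import Data.List.Relation.Unary.AllPairs using () renaming ([] to []ᵁ; _∷_ to _∷ᵁ_)
open import Data.List.Relation.Unary.Any using (here; there; any?)
open import Data.List.Relation.Unary.Linked as Linked using (Linked) renaming ([-] to [-]ᴸ; _∷_ to _∷ᴸ_)
open import Data.List.Relation.Unary.Unique.Propositional using (Unique)
open import Data.Maybe.Base using (Maybe; just; nothing; maybe′)
open import Data.Nat.Base using (ℕ; zero; suc; _+_; _*_; _∸_; _⊔_; _≤_; _<_; z≤n; s≤s)
open import Data.Nat.Divisibility using (divides)
open import Data.Nat.Induction using (Acc; acc; <-wellFounded)
import Data.Nat.Properties as ℕ
open import Data.Nat.Tactic.RingSolver using (solve-∀)
open import Data.Product.Base using (Σ; ∃-syntax; _×_; _,_; proj₁; proj₂)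
open import Data.Rational.Base as ℚ using (ℚ; 0ℚ; 1ℚ; ½)
import Data.Rational.Properties as ℚ
import Data.Rational.Solver as ℚ-Solver
open import Data.Sum.Base using (_⊎_; inj₁; inj₂; [_,_]′)
open import Data.Vec.Base using ([]; _∷_; here; there; lookup)
open import Data.Vec.Properties using (lookup⇒[]=; []=⇒lookup; lookup∘tabulate; lookup-zipWith)
open import Data.Vec.Properties.WithK using ([]=-irrelevant)
open import Function.Base using (_∘_; case_of_)
open import Function.Bundles using (_⇔_; mk⇔; Inverse; Equivalence; mk↔ₛ′)
open import Relation.Binary.Construct.Closure.ReflexiveTransitive using (_◅_; _◅◅_) renaming (ε to nil)
open import Relation.Binary.PropositionalEquality
  using (_≡_; _≢_; refl; sym; trans; cong; cong₂; subst; subst₂; module ≡-Reasoning)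
open import Relation.Nullary using (¬_; Dec; does; yes; no; contradiction)
open import Relation.Nullary.Decidable using (_×-dec_; _⊎-dec_; ¬?; dec-true; dec-false; toWitness)
open import Algebra.Properties.CommutativeMonoid.Sum ℕ.+-0-commutativeMonoid
  using (∑-distrib-+; ∑-comm; sum-cong-≗) renaming (sum to ∑)
open import Defs

open ℚ-Solver.+-*-Solver using (solve; _:+_; _:*_; _:-_; :-_; _:=_; con)

-- A number of true kid edges can fail in two ways: too many kids force true, or too many refuse it.
-- A kid with one known count conflicts with only one count at v, so each way strikes at most one of
-- several well-spaced candidates; three candidates yield one success and four yield two. For a + b
-- = 0 and two kids there are just three candidates, and a finite check exhibits the obstructing
-- subtrees. Up to the offset these pin their root to ±1, like a leaf, or to ±3, with all edges at
-- the root alike. The adjusted load is the right offset because k true edges of H and ℓ further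
-- ones at v satisfy 2(k + ℓ) = (2k - d_H(v)) + λ(v). All loads are odd; equal parity of
-- neighbouring offsets is what makes vertices of even degree harmless. Equality of reals is
-- undecidable. Equal totals are reduced to equations between counts or, if ab(a + b) ≠ 0, decided
-- for finitely many counts under double negation, which suffices since it is decidable whether two
-- leaves are adjacent.

private
  variable
    n : ℕ

-- Counting

b2n : Bool → ℕ
b2n true  = 1
b2n false = 0

count : (Fin n → Bool) → ℕ
count f = ∑ (b2n ∘ f)

∑-mono-≤ : {f g : Fin n → ℕ} → (∀ x → f x ≤ g x) → ∑ f ≤ ∑ g
∑-mono-≤ {zero}  f≤g = z≤n
∑-mono-≤ {suc n} f≤g = ℕ.+-mono-≤ (f≤g zero) (∑-mono-≤ (f≤g ∘ suc))

∑-zero : {f : Fin n → ℕ} → (∀ x → f x ≡ 0) → ∑ f ≡ 0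
∑-zero {zero}  f≡0 = refl
∑-zero {suc n} f≡0 = cong₂ _+_ (f≡0 zero) (∑-zero (f≡0 ∘ suc))

∑-*ˡ : ∀ k (f : Fin n → ℕ) → ∑ (λ x → k * f x) ≡ k * ∑ f
∑-*ˡ {zero}  k f = sym (ℕ.*-zeroʳ k)
∑-*ˡ {suc n} k f = trans (cong (k * f zero +_) (∑-*ˡ k (f ∘ suc))) (sym (ℕ.*-distribˡ-+ k (f zero) _))

∑-single : ∀ (a : Fin n) {f : Fin n → ℕ} → (∀ x → x ≢ a → f x ≡ 0) → ∑ f ≡ f a
∑-single zero    {f} h = trans (cong (f zero +_) (∑-zero λ x → h (suc x) λ ())) (ℕ.+-identityʳ _)
∑-single (suc a)     h = cong₂ _+_ (h zero λ ()) (∑-single a λ x x≢a → h (suc x) λ { refl → x≢a refl })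

≟-b2n : (x a : Fin n) → ℕ
≟-b2n x a = b2n (does (x Fin.≟ a))

≟-b2n-refl : (a : Fin n) → ≟-b2n a a ≡ 1
≟-b2n-refl a = cong b2n (dec-true (a Fin.≟ a) refl)

≟-b2n-≢ : {x a : Fin n} → x ≢ a → ≟-b2n x a ≡ 0
≟-b2n-≢ {x = x} {a} x≢a = cong b2n (dec-false (x Fin.≟ a) x≢a)

∑-split : ∀ (a : Fin n) {f g : Fin n → ℕ} → g a ≡ 0 → (∀ x → x ≢ a → f x ≡ g x) → ∑ f ≡ f a + ∑ g
∑-split {n} a {f} {g} ga f≡g = begin
  ∑ f                                       ≡⟨ sum-cong-≗ eq ⟩
  ∑ (λ x → ≟-b2n x a * f a + g x)           ≡⟨ ∑-distrib-+ (λ x → ≟-b2n x a * f a) g ⟩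
  ∑ (λ x → ≟-b2n x a * f a) + ∑ g           ≡⟨ cong (_+ ∑ g) (∑-single a {λ x → ≟-b2n x a * f a} (λ x x≢a → cong (_* f a) (≟-b2n-≢ x≢a))) ⟩
  ≟-b2n a a * f a + ∑ g                     ≡⟨ cong (λ z → z * f a + ∑ g) (≟-b2n-refl a) ⟩
  (f a + 0) + ∑ g                           ≡⟨ cong (_+ ∑ g) (ℕ.+-identityʳ (f a)) ⟩
  f a + ∑ g                                 ∎
  where
  open ≡-Reasoning
  eq : ∀ x → f x ≡ ≟-b2n x a * f a + g x
  eq x with x Fin.≟ a
  ... | yes refl = sym (trans (cong (f a + 0 +_) ga) (trans (ℕ.+-identityʳ _) (ℕ.+-identityʳ _)))
  ... | no x≢a   = f≡g x x≢a

b2n-≤1 : ∀ b → b2n b ≤ 1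
b2n-≤1 true  = s≤s z≤n
b2n-≤1 false = z≤n

b2n-injective : ∀ {b c} → b2n b ≡ b2n c → b ≡ c
b2n-injective {true}  {true}  _ = refl
b2n-injective {false} {false} _ = refl

b2n-∧ : ∀ b c → b2n (b ∧ c) ≡ b2n b * b2n c
b2n-∧ true  c = sym (ℕ.+-identityʳ _)
b2n-∧ false c = refl

∨-true⁻ : ∀ a {b} → a ∨ b ≡ true → a ≡ true ⊎ b ≡ true
∨-true⁻ true  _ = inj₁ refl
∨-true⁻ false e = inj₂ e

∧-true⁻ : ∀ a {b} → a ∧ b ≡ true → a ≡ true × b ≡ true
∧-true⁻ true e = refl , e

does-true : {P : Set} (p? : Dec P) → does p? ≡ true → P
does-true (yes p) _ = p

count-≤n : (f : Fin n → Bool) → count f ≤ n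
count-≤n {zero}  f = z≤n
count-≤n {suc n} f = ℕ.+-mono-≤ (b2n-≤1 (f zero)) (count-≤n (f ∘ suc))

count-cong : {f g : Fin n → Bool} → (∀ x → f x ≡ g x) → count f ≡ count g
count-cong f≡g = sum-cong-≗ (cong b2n ∘ f≡g)

count-mono : (f g : Fin n → Bool) → (∀ x → f x ≡ true → g x ≡ true) → count f ≤ count g
count-mono f g f≤g = ∑-mono-≤ λ x → le x
  where
  le : ∀ x → b2n (f x) ≤ b2n (g x)
  le x with f x | f≤g x
  ... | false | _ = z≤n
  ... | true  | h rewrite h refl = ℕ.≤-refl

count-false : {f : Fin n → Bool} → (∀ x → f x ≡ false) → count f ≡ 0
count-false f≡ = ∑-zero (cong b2n ∘ f≡)

∑-lookup-≤ : (f : Fin n → ℕ) (x : Fin n) → f x ≤ ∑ f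
∑-lookup-≤ f zero    = ℕ.m≤m+n (f zero) _
∑-lookup-≤ f (suc x) = ℕ.≤-trans (∑-lookup-≤ (f ∘ suc) x) (ℕ.m≤n+m _ (f zero))

count-pos : (f : Fin n → Bool) {x : Fin n} → f x ≡ true → 1 ≤ count f
count-pos f {x} fx = subst (_≤ count f) (cong b2n fx) (∑-lookup-≤ (b2n ∘ f) x)

count-witness : (f : Fin n → Bool) → 1 ≤ count f → ∃[ x ] f x ≡ true
count-witness {suc n} f 1≤ with f zero in eq
... | true  = zero , eq
... | false = let x , fx = count-witness (f ∘ suc) 1≤ in suc x , fx

count-zero : (f : Fin n → Bool) → count f ≡ 0 → ∀ x → f x ≡ false
count-zero f c≡0 x with f x in eq
... | false = refl
... | true  = contradiction (subst (1 ≤_) c≡0 (count-pos f eq)) λ ()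

_without_ : (Fin n → Bool) → Fin n → Fin n → Bool
(f without a) x = f x ∧ not (does (x Fin.≟ a))

without-self : (f : Fin n → Bool) (a : Fin n) → (f without a) a ≡ false
without-self f a rewrite dec-true (a Fin.≟ a) refl = Bool.∧-zeroʳ (f a)

without-≢ : (f : Fin n → Bool) {a x : Fin n} → x ≢ a → (f without a) x ≡ f x
without-≢ f {a} {x} x≢a rewrite dec-false (x Fin.≟ a) x≢a = Bool.∧-identityʳ (f x)

without⁻ : (f : Fin n → Bool) {a x : Fin n} → (f without a) x ≡ true → f x ≡ true × x ≢ a
without⁻ f {a} {x} h with f x | x Fin.≟ a
... | true | no x≢a = refl , x≢a

∑-without : (f : Fin n → Bool) (g : Fin n → ℕ) {a : Fin n} → f a ≡ true →
  ∑ (λ x → b2n (f x) * g x) ≡ g a + ∑ (λ x → b2n ((f without a) x) * g x)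
∑-without f g {a} fa = trans
  (∑-split a (cong (λ b → b2n b * g a) (without-self f a))
    λ x x≢a → cong (λ b → b2n b * g x) (sym (without-≢ f x≢a)))
  (cong (_+ ∑ (λ x → b2n ((f without a) x) * g x)) (trans (cong (λ b → b2n b * g a) fa) (ℕ.+-identityʳ (g a))))

count-without : (f : Fin n → Bool) {a : Fin n} → f a ≡ true → count f ≡ suc (count (f without a))
count-without f {a} fa = trans
  (∑-split a (cong b2n (without-self f a)) λ x x≢a → cong b2n (sym (without-≢ f x≢a)))
  (cong (λ b → b2n b + count (f without a)) fa)

count-1 : (f : Fin n → Bool) {a : Fin n} → f a ≡ true → count f ≡ 1 → ∀ {x} → f x ≡ true → x ≡ a
count-1 f {a} fa c≡1 {x} fx with x Fin.≟ a
... | yes x≡a = x≡a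
... | no x≢a  = contradiction
  (count-pos (f without a) (trans (without-≢ f x≢a) fx))
  (ℕ.<⇒≱ (s≤s (ℕ.≤-reflexive (ℕ.suc-injective (trans (sym (count-without f fa)) c≡1)))))

count-suc : (f : Fin n → Bool) {k : ℕ} → count f ≡ suc k →
  ∃[ a ] (f a ≡ true × count (f without a) ≡ k)
count-suc f eq =
  let a , fa = count-witness f (subst (1 ≤_) (sym eq) (s≤s z≤n))
  in a , fa , ℕ.suc-injective (trans (sym (count-without f fa)) eq)

∑-without₂ : (f : Fin n → Bool) (g : Fin n → ℕ) {a b : Fin n} → f a ≡ true → f b ≡ true → b ≢ a →
  count f ≡ 2 → ∑ (λ x → b2n (f x) * g x) ≡ g a + g b
∑-without₂ f g {a} {b} fa fb b≢a c≡2 = trans (∑-without f g fa) (cong (g a +_)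
  (trans (∑-without (f without a) g f'b)
  (trans (cong (g b +_) (∑-zero λ x → cong (λ c → b2n c * g x) (count-zero ((f without a) without b) c≡0 x)))
         (ℕ.+-identityʳ (g b)))))
  where
  f'b : (f without a) b ≡ true
  f'b = trans (without-≢ f b≢a) fb
  c≡0 : count ((f without a) without b) ≡ 0
  c≡0 = ℕ.suc-injective (trans (sym (count-without (f without a) f'b))
          (ℕ.suc-injective (trans (sym (count-without f fa)) c≡2)))

-- This supplies the set of true edges at a vertex: `A` holds the edges forced to be true, `B` those
-- that may be.
count-between : (A B : Fin n → Bool) → (∀ x → A x ≡ true → B x ≡ true) →
  ∀ i → count A ≤ i → i ≤ count B →
  ∃[ S ] ((∀ x → A x ≡ true → S x ≡ true) × (∀ x → S x ≡ true → B x ≡ true) × count S ≡ i)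
count-between {zero}  A B A⊆B zero    _ _ = A , (λ ()) , (λ ()) , refl
count-between {suc n} A B A⊆B i lo hi with A zero in eqA | B zero in eqB
... | true  | false = contradiction (trans (sym eqB) (A⊆B zero eqA)) λ ()
count-between {suc n} A B A⊆B (suc i) (s≤s lo) (s≤s hi) | true | true
  with S , A⊆S , S⊆B , c ← count-between (A ∘ suc) (B ∘ suc) (A⊆B ∘ suc) i lo hi
  = (λ { zero → true ; (suc x) → S x })
  , (λ { zero _ → refl ; (suc x) → A⊆S x }) , (λ { zero _ → eqB ; (suc x) → S⊆B x }) , cong suc c
count-between {suc n} A B A⊆B i lo hi | false | false
  with S , A⊆S , S⊆B , c ← count-between (A ∘ suc) (B ∘ suc) (A⊆B ∘ suc) i lo hi
  = (λ { zero → false ; (suc x) → S x })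
  , (λ { zero a → contradiction (trans (sym a) eqA) λ () ; (suc x) → A⊆S x }) , (λ { zero () ; (suc x) → S⊆B x }) , c
count-between {suc n} A B A⊆B i lo hi | false | true with i ℕ.≤? count (B ∘ suc)
... | yes i≤
  with S , A⊆S , S⊆B , c ← count-between (A ∘ suc) (B ∘ suc) (A⊆B ∘ suc) i lo i≤
  = (λ { zero → false ; (suc x) → S x })
  , (λ { zero a → contradiction (trans (sym a) eqA) λ () ; (suc x) → A⊆S x }) , (λ { zero () ; (suc x) → S⊆B x }) , c
-- `i` exceeds what the rest of `B` offers, so `hi` makes it exactly one more: take all of the rest
-- and `zero` as well.
... | no i≰
  with S , A⊆S , S⊆B , c ← count-between (A ∘ suc) (B ∘ suc) (A⊆B ∘ suc) (count (B ∘ suc)) (count-mono (A ∘ suc) (B ∘ suc) (A⊆B ∘ suc)) ℕ.≤-refl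
  = (λ { zero → true ; (suc x) → S x })
  , (λ { zero _ → refl ; (suc x) → A⊆S x }) , (λ { zero _ → eqB ; (suc x) → S⊆B x })
  , trans (cong suc c) (ℕ.≤-antisym (ℕ.≰⇒> i≰) hi)

private
  disjoint-le : ∀ {a b c} → (a ≡ true → c ≡ true) → (b ≡ true → c ≡ true) → (a ≡ true → b ≡ true → Empty) →
    b2n a + b2n b ≤ b2n c
  disjoint-le {false} {false} a b d = z≤n
  disjoint-le {true}  {true}  a b d = ⊥-elim (d refl refl)
  disjoint-le {true}  {false} a b d rewrite a refl = ℕ.≤-refl
  disjoint-le {false} {true}  a b d rewrite b refl = ℕ.≤-refl

count-disjoint : (A B C : Fin n → Bool) → (∀ x → A x ≡ true → C x ≡ true) → (∀ x → B x ≡ true → C x ≡ true) →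
  (∀ x → A x ≡ true → B x ≡ true → Empty) → count A + count B ≤ count C
count-disjoint A B C A⊆C B⊆C dis = subst (_≤ count C) (∑-distrib-+ (b2n ∘ A) (b2n ∘ B))
  (∑-mono-≤ λ x → disjoint-le (A⊆C x) (B⊆C x) (dis x))

-- Parity

odd : ℕ → Bool
odd zero    = false
odd (suc k) = not (odd k)

odd-+ : ∀ k l → odd (k + l) ≡ odd k xor odd l
odd-+ zero    l = refl
odd-+ (suc k) l = trans (cong not (odd-+ k l)) (Bool.not-distribˡ-xor (odd k) (odd l))

odd-double : ∀ k → odd (k + k) ≡ false
odd-double k = trans (odd-+ k k) (Bool.xor-same (odd k))

odd-2* : ∀ k → odd (2 * k) ≡ false
odd-2* k = trans (cong (λ z → odd (k + z)) (ℕ.+-identityʳ k)) (odd-double k)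

odd-b2n : ∀ b → odd (b2n b) ≡ b
odd-b2n true  = refl
odd-b2n false = refl

odd-∑-cong : {f g : Fin n → ℕ} → (∀ x → odd (f x) ≡ odd (g x)) → odd (∑ f) ≡ odd (∑ g)
odd-∑-cong {zero}  h = refl
odd-∑-cong {suc n} {f} {g} h = trans (odd-+ (f zero) _)
  (trans (cong₂ _xor_ (h zero) (odd-∑-cong (h ∘ suc))) (sym (odd-+ (g zero) _)))

halve : ∀ k → odd k ≡ false → ∃[ m ] k ≡ m + m
halve zero          _ = 0 , refl
halve (suc zero)    ()
halve (suc (suc k)) e = let m , eq = halve k (trans (sym (Bool.not-involutive (odd k))) e)
                        in suc m , cong suc (trans (cong suc eq) (sym (ℕ.+-suc m m)))

Odd⇒odd : ∀ {k} → Odd k → odd k ≡ true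
Odd⇒odd {k} o with odd k in e
... | true  = refl
... | false = let m , eq = halve k e in contradiction
  (divides m (trans eq (trans (cong (m +_) (sym (ℕ.+-identityʳ m))) (ℕ.*-comm 2 m)))) o

odd⇒Odd : ∀ {k} → odd k ≡ true → Odd k
odd⇒Odd {k} o (divides m refl) = contradiction
  (trans (sym o) (trans (cong odd (ℕ.*-comm m 2)) (odd-2* m))) λ ()

∣∣≡count : (S : Subset n) → ∣ S ∣ ≡ count (lookup S)
∣∣≡count []            = refl
∣∣≡count (inside  ∷ S) = cong suc (∣∣≡count S)
∣∣≡count (outside ∷ S) = ∣∣≡count S

∈⇒lookup : {S : Subset n} {x : Fin n} → x ∈ S → lookup S x ≡ true
∈⇒lookup = []=⇒lookup

lookup⇒∈ : {S : Subset n} {x : Fin n} → lookup S x ≡ true → x ∈ S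
lookup⇒∈ {S = S} {x} = lookup⇒[]= x S

∉⇒lookup : {S : Subset n} {x : Fin n} → x ∉ S → lookup S x ≡ false
∉⇒lookup x∉ = Bool.¬-not (x∉ ∘ lookup⇒∈)

lookup⇒∉ : {S : Subset n} {x : Fin n} → lookup S x ≡ false → x ∉ S
lookup⇒∉ e x∈ = contradiction (trans (sym (∈⇒lookup x∈)) e) λ ()

lookup-∩ : (S R : Subset n) (x : Fin n) → lookup (S ∩ R) x ≡ lookup S x ∧ lookup R x
lookup-∩ S R x = lookup-zipWith _∧_ x S R

-- Walks and simple paths

map-walk : (G H : Graph n) → (∀ {x y} → G ⊢ x ~ y → H ⊢ x ~ y) → ∀ {x y} → Walk G x y → Walk H x y
map-walk G H f nil     = nil
map-walk G H f (e ◅ w) = f e ◅ map-walk G H f w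

reverse-walk : (G : Graph n) → ∀ {x y} → Walk G x y → Walk G y x
reverse-walk G nil     = nil
reverse-walk G (e ◅ w) = reverse-walk G w ◅◅ (N-sym G e ◅ nil)

data Path (G : Graph n) : Fin n → Fin n → List (Fin n) → Set where
  end  : ∀ {x} → Path G x x (x ∷ [])
  step : ∀ {x y z l} → G ⊢ x ~ y → Path G y z l → Path G x z (x ∷ l)

suffix : {G : Graph n} → ∀ {x y z l} → x ∈ᴸ l → Path G y z l → Unique l →
  ∃[ l′ ] (Path G x z l′ × Unique l′)
suffix (here refl) end        u        = _ , end , u
suffix (here refl) (step e p) u        = _ , step e p , u
suffix (there ()) end u
suffix (there x∈)  (step e p) (_ ∷ᵁ u) = suffix x∈ p u

simple-path : {G : Graph n} → ∀ {x z} → Walk G x z → ∃[ l ] (Path G x z l × Unique l)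
simple-path nil = _ , end , ([]ᴬ ∷ᵁ []ᵁ)
simple-path {x = x} (e ◅ w) with l , p , u ← simple-path w with any? (x Fin.≟_) l
... | yes x∈ = suffix x∈ p u
... | no x∉  = _ , step e p , (¬Any⇒All¬ l x∉ ∷ᵁ u)

path-linked : (G : Graph n) → ∀ {x z y l} → Path G x z l → G ⊢ z ~ y → Linked (G ⊢_~_) (l ∷ʳ y)
path-linked G end                 e = e ∷ᴸ [-]ᴸ
path-linked G (step e end)          f = e ∷ᴸ path-linked G end f
path-linked G (step e (step e′ p))  f = e ∷ᴸ path-linked G (step e′ p) f

map-path : (G H : Graph n) → (∀ {x y} → G ⊢ x ~ y → H ⊢ x ~ y) → ∀ {x y l} → Path G x y l → Path H x y l
map-path G H f end        = end
map-path G H f (step e p) = step (f e) (map-path G H f p)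

-- Sides of an edge and branches at a vertex of a tree

module _ (T : Graph n) where

  minus⁺ : ∀ {u v x y} → T ⊢ x ~ y → ¬ SameEdge u v x y → (T -[ u , v ]) ⊢ x ~ y
  minus⁺ {u} {v} {x} e ne = ∈⟪⟫⁺ (λ y → (T ⊢ x ~? y) ×-dec ¬? (sameEdge? u v x y)) (e , ne)

  minus⁻ : ∀ {u v x y} → (T -[ u , v ]) ⊢ x ~ y → T ⊢ x ~ y × ¬ SameEdge u v x y
  minus⁻ {u} {v} {x} = ∈⟪⟫⁻ (λ y → (T ⊢ x ~? y) ×-dec ¬? (sameEdge? u v x y))

  side⁺ : ∀ {u v x} → Walk (T -[ u , v ]) v x → x ∈ side T u v
  side⁺ {u} {v} = ∈⟪⟫⁺ (walk? (T -[ u , v ]) v)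

  side⁻ : ∀ {u v x} → x ∈ side T u v → Walk (T -[ u , v ]) v x
  side⁻ {u} {v} = ∈⟪⟫⁻ (walk? (T -[ u , v ]) v)

  -- A simple path from v to u in T - uv closes up with uv to a cycle once it has three vertices.
  -- One vertex would give a loop, and two would use the removed edge.
  acyclic⇒bridge : (∀ vs → ¬ IsCycle T vs) → ∀ {u v} → T ⊢ u ~ v → u ∉ side T u v
  acyclic⇒bridge acyclic {u} {v} uv u∈ with simple-path (side⁻ u∈)
  ... | _ , end , _ = N-irrefl T uv
  ... | _ , step e end , _ = proj₂ (minus⁻ e) (inj₂ (refl , refl))
  ... | _ , p@(step _ (step _ end)) , unique = acyclic _
    (s≤s (s≤s z≤n) , unique , path-linked T (map-path (T -[ u , v ]) T (proj₁ ∘ minus⁻) p) uv)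
  ... | _ , p@(step _ (step _ (step _ _))) , unique = acyclic _
    (s≤s (s≤s z≤n) , unique , path-linked T (map-path (T -[ u , v ]) T (proj₁ ∘ minus⁻) p) uv)

module Tree (T : Graph n) (tree : IsTree T) where
  open IsTree tree

  private
    infix 4 _~_
    _~_ : Fin n → Fin n → Set
    _~_ = T ⊢_~_

  ~-sym : ∀ {x y} → x ~ y → y ~ x
  ~-sym = N-sym T

  ~-irrefl : ∀ {x} → ¬ (x ~ x)
  ~-irrefl = N-irrefl T

  ~⇒≢ : ∀ {x y} → x ~ y → x ≢ y
  ~⇒≢ e refl = ~-irrefl e

  ~⇒Vˡ : ∀ {x y} → x ~ y → x ∈ V T
  ~⇒Vˡ e = N⊆V T (~-sym e)

  ~⇒Vʳ : ∀ {x y} → x ~ y → y ∈ V T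
  ~⇒Vʳ e = N⊆V T e

  bridge : ∀ {u v} → u ~ v → u ∉ side T u v
  bridge = acyclic⇒bridge T acyclic

  side-self : ∀ {u v} → v ∈ side T u v
  side-self = side⁺ T nil

  side-extend : ∀ {u v x y} → x ∈ side T u v → x ~ y → ¬ SameEdge u v x y → y ∈ side T u v
  side-extend x∈ e ne = side⁺ T (side⁻ T x∈ ◅◅ (minus⁺ T e ne ◅ nil))

  side-closed : ∀ {u v x y} → u ~ v → x ∈ side T u v → x ~ y → y ∈ side T u v ⊎ (x ≡ v × y ≡ u)
  side-closed {u} {v} {x} {y} uv x∈ e with sameEdge? u v x y
  ... | no ne                   = inj₁ (side-extend x∈ e ne)
  ... | yes (inj₁ (refl , _))   = contradiction x∈ (bridge uv)
  ... | yes (inj₂ eqs)          = inj₂ eqs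

  side-cover : ∀ {u v} → u ~ v → ∀ {x} → x ∈ V T → x ∈ side T u v ⊎ x ∈ side T v u
  side-cover {u} {v} uv x∈ = go (connected (~⇒Vʳ uv) x∈) (inj₁ side-self)
    where
    go : ∀ {x y} → Walk T x y → x ∈ side T u v ⊎ x ∈ side T v u → y ∈ side T u v ⊎ y ∈ side T v u
    go nil     s = s
    go (e ◅ w) (inj₁ s) with side-closed uv s e
    ... | inj₁ s′         = go w (inj₁ s′)
    ... | inj₂ (_ , refl) = go w (inj₂ side-self)
    go (e ◅ w) (inj₂ s) with side-closed (~-sym uv) s e
    ... | inj₁ s′         = go w (inj₂ s′)
    ... | inj₂ (_ , refl) = go w (inj₁ side-self)

  -- A walk from u that avoids the edge starts outside the side of v, and a step into that side,
  -- read backwards, would put the preceding vertex there already.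
  side-disjoint : ∀ {u v} → u ~ v → ∀ {x} → x ∈ side T v u → x ∉ side T u v
  side-disjoint {u} {v} uv x∈ = go (side⁻ T x∈) (bridge uv)
    where
    go : ∀ {x y} → Walk (T -[ v , u ]) x y → x ∉ side T u v → y ∉ side T u v
    go nil     s = s
    go (e ◅ w) s = let e′ , ne = minus⁻ T e in
      go w λ y∈ → s (side-extend y∈ (~-sym e′)
        λ { (inj₁ (p , q)) → ne (inj₁ (q , p)) ; (inj₂ (p , q)) → ne (inj₂ (q , p)) })

  side⊆V : ∀ {u v} → u ~ v → ∀ {x} → x ∈ side T u v → x ∈ V T
  side⊆V uv x∈ = go (side⁻ T x∈) (~⇒Vʳ uv)
    where
    go : ∀ {x y} → Walk (T -[ _ , _ ]) x y → x ∈ V T → y ∈ V T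
    go nil     s = s
    go (e ◅ w) s = go w (~⇒Vʳ (proj₁ (minus⁻ T e)))

  branch : ∀ {v x} → v ∈ V T → x ∈ V T → x ≢ v → ∃[ c ] (v ~ c × x ∈ side T v c)
  branch {v} v∈ x∈ x≢v with go (connected v∈ x∈) (inj₁ refl)
    where
    go : ∀ {x y} → Walk T x y → x ≡ v ⊎ ∃[ c ] (v ~ c × x ∈ side T v c) →
      y ≡ v ⊎ ∃[ c ] (v ~ c × y ∈ side T v c)
    go nil     s = s
    go (e ◅ w) (inj₁ refl) = go w (inj₂ (_ , e , side-self))
    go (e ◅ w) (inj₂ (c , vc , s)) with side-closed vc s e
    ... | inj₁ s′         = go w (inj₂ (c , vc , s′))
    ... | inj₂ (_ , refl) = go w (inj₁ refl)
  ... | inj₁ x≡v = contradiction x≡v x≢v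
  ... | inj₂ b   = b

  branch-unique : ∀ {v c d x} → v ~ c → v ~ d → x ∈ side T v c → x ∈ side T v d → c ≡ d
  branch-unique {v} {c} {d} vc vd x∈c x∈d with c Fin.≟ d
  ... | yes c≡d = c≡d
  ... | no c≢d  = contradiction x∈c (go side-self (side⁻ T x∈d) d∉)
    where
    d∉ : d ∉ side T v c
    d∉ d∈ with side-closed vc d∈ (~-sym vd)
    ... | inj₁ v∈        = bridge vc v∈
    ... | inj₂ (d≡c , _) = c≢d (sym d≡c)
    go : ∀ {x y} → x ∈ side T v d → Walk (T -[ v , d ]) x y → x ∉ side T v c → y ∉ side T v c
    go x∈ nil     s = s
    go x∈ (e ◅ w) s = let e′ , ne = minus⁻ T e in
      go (side-extend x∈ e′ ne) w λ y∈ → case side-closed vc y∈ (~-sym e′) of λ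
        { (inj₁ x∈c) → s x∈c ; (inj₂ (_ , refl)) → bridge vd x∈ }

  kid-side⊆ : ∀ {p v c} → p ~ v → v ~ c → c ≢ p → ∀ {x} → x ∈ side T v c → x ∈ side T p v
  kid-side⊆ pv vc c≢p x∈ with side-cover pv (side⊆V vc x∈)
  ... | inj₁ x∈′ = x∈′
  ... | inj₂ x∈′ = contradiction (branch-unique vc (~-sym pv) x∈ x∈′) c≢p

  side-decompose : ∀ {p v x} → p ~ v → x ∈ side T p v → x ≡ v ⊎ ∃[ c ] (v ~ c × c ≢ p × x ∈ side T v c)
  side-decompose {p} {v} {x} pv x∈ with x Fin.≟ v
  ... | yes x≡v = inj₁ x≡v
  ... | no x≢v with branch (~⇒Vʳ pv) (side⊆V pv x∈) x≢v
  ... | c , vc , x∈c = inj₂ (c , vc , (λ { refl → side-disjoint pv x∈c x∈ }) , x∈c)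

  adj : Fin n → Fin n → Bool
  adj v u = lookup (N T v) u

  in-side : Fin n → Fin n → Fin n → Bool
  in-side u v x = lookup (side T u v) x

  weight-of-side : (Fin n → ℕ) → Fin n → Fin n → ℕ
  weight-of-side g u v = ∑ λ x → b2n (in-side u v x) * g x

  total : (Fin n → ℕ) → ℕ
  total g = ∑ λ x → b2n (lookup (V T) x) * g x

  private
    ∑-b2n-* : (K : Fin n → Bool) (g : Fin n → ℕ) (S : Fin n → Fin n → Bool) →
      ∑ (λ c → b2n (K c) * ∑ (λ x → b2n (S c x) * g x)) ≡ ∑ (λ x → ∑ (λ c → b2n (K c) * b2n (S c x)) * g x)
    ∑-b2n-* K g S = begin
      ∑ (λ c → b2n (K c) * ∑ (λ x → b2n (S c x) * g x))
        ≡⟨ sum-cong-≗ (λ c → trans (sym (∑-*ˡ (b2n (K c)) (λ x → b2n (S c x) * g x)))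
             (sum-cong-≗ λ x → sym (ℕ.*-assoc (b2n (K c)) (b2n (S c x)) (g x)))) ⟩
      ∑ (λ c → ∑ (λ x → (b2n (K c) * b2n (S c x)) * g x))
        ≡⟨ ∑-comm (λ c x → (b2n (K c) * b2n (S c x)) * g x) ⟩
      ∑ (λ x → ∑ (λ c → (b2n (K c) * b2n (S c x)) * g x))
        ≡⟨ sum-cong-≗ (λ x → trans (sum-cong-≗ λ c → ℕ.*-comm (b2n (K c) * b2n (S c x)) (g x))
             (trans (∑-*ˡ (g x) (λ c → b2n (K c) * b2n (S c x))) (ℕ.*-comm (g x) _))) ⟩
      ∑ (λ x → ∑ (λ c → b2n (K c) * b2n (S c x)) * g x) ∎
      where open ≡-Reasoning

  -- Double counting: the branches at v selected by K cover exactly the set S.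
  ∑-branches : ∀ {v} (K S : Fin n → Bool) → (∀ c → K c ≡ true → v ~ c) →
    (∀ {c x} → K c ≡ true → x ∈ side T v c → S x ≡ true) →
    (∀ {x} → S x ≡ true → ∃[ c ] (K c ≡ true × x ∈ side T v c)) →
    (g : Fin n → ℕ) → ∑ (λ c → b2n (K c) * weight-of-side g v c) ≡ ∑ (λ x → b2n (S x) * g x)
  ∑-branches {v} K S K⊆N sound complete g =
    trans (∑-b2n-* K g (in-side v)) (sum-cong-≗ λ x → cong (_* g x) (inner x))
    where
    inner : ∀ x → ∑ (λ c → b2n (K c) * b2n (in-side v c x)) ≡ b2n (S x)
    inner x with S x in eq
    ... | true = let c , Kc , x∈ = complete eq in
      trans (∑-single c {λ c → b2n (K c) * b2n (in-side v c x)} λ d d≢c → zero-unless d λ Kd x∈d → d≢c (branch-unique (K⊆N d Kd) (K⊆N c Kc) x∈d x∈))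
            (cong₂ (λ a b → b2n a * b2n b) Kc (∈⇒lookup x∈))
      where
      zero-unless : ∀ d → (K d ≡ true → x ∈ side T v d → Empty) → b2n (K d) * b2n (in-side v d x) ≡ 0
      zero-unless d h with K d | in-side v d x in e
      ... | false | _     = refl
      ... | true  | false = refl
      ... | true  | true  = ⊥-elim (h refl (lookup⇒∈ e))
    ... | false = ∑-zero zero-term
      where
      zero-term : ∀ d → b2n (K d) * b2n (in-side v d x) ≡ 0
      zero-term d with K d in k | in-side v d x in e
      ... | false | _     = refl
      ... | true  | false = refl
      ... | true  | true  = contradiction (trans (sym (sound k (lookup⇒∈ e))) eq) λ ()

  weight-side : ∀ {p v} → p ~ v → (g : Fin n → ℕ) →
    weight-of-side g p v ≡ g v + ∑ (λ c → b2n ((adj v without p) c) * weight-of-side g v c)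
  weight-side {p} {v} pv g = trans
    (∑-without (in-side p v) g (∈⇒lookup side-self))
    (cong (g v +_) (sym (∑-branches (adj v without p) (in-side p v without v)
      (λ c Kc → lookup⇒∈ (proj₁ (without⁻ (adj v) Kc)))
      (λ {c} {x} Kc x∈ → let vc , c≢p = without⁻ (adj v) Kc in
        trans (without-≢ (in-side p v) λ { refl → bridge (lookup⇒∈ vc) x∈ })
              (∈⇒lookup (kid-side⊆ pv (lookup⇒∈ vc) c≢p x∈)))
      (λ {x} Sx → let x∈ , x≢v = without⁻ (in-side p v) Sx in case side-decompose pv (lookup⇒∈ x∈) of λ
        { (inj₁ x≡v) → contradiction x≡v x≢v
        ; (inj₂ (c , vc , c≢p , x∈c)) → c , trans (without-≢ (adj v) c≢p) (∈⇒lookup vc) , x∈c })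
      g)))

  weight-vertex : ∀ {v} → v ∈ V T → (g : Fin n → ℕ) →
    total g ≡ g v + ∑ (λ c → b2n (adj v c) * weight-of-side g v c)
  weight-vertex {v} v∈ g = trans
    (∑-without (lookup (V T)) g (∈⇒lookup v∈))
    (cong (g v +_) (sym (∑-branches (adj v) (lookup (V T) without v)
      (λ c → lookup⇒∈)
      (λ {c} {x} vc x∈ → trans (without-≢ (lookup (V T)) λ { refl → bridge (lookup⇒∈ vc) x∈ })
                               (∈⇒lookup (side⊆V (lookup⇒∈ vc) x∈)))
      (λ Sx → let x∈ , x≢v = without⁻ (lookup (V T)) Sx
                  c , vc , x∈c = branch v∈ (lookup⇒∈ x∈) x≢v in c , ∈⇒lookup vc , x∈c)
      g)))

  weight-edge : ∀ {u v} → u ~ v → (g : Fin n → ℕ) → total g ≡ weight-of-side g u v + weight-of-side g v u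
  weight-edge {u} {v} uv g = trans (sum-cong-≗ λ x → trans (cong (_* g x) (split x)) (ℕ.*-distribʳ-+ (g x) (b2n (in-side u v x)) _))
    (∑-distrib-+ (λ x → b2n (in-side u v x) * g x) (λ x → b2n (in-side v u x) * g x))
    where
    split : ∀ x → b2n (lookup (V T) x) ≡ b2n (in-side u v x) + b2n (in-side v u x)
    split x with lookup (V T) x in eV | in-side u v x in e | in-side v u x in e′
    ... | true  | true  | true  = contradiction (lookup⇒∈ e) (side-disjoint uv (lookup⇒∈ e′))
    ... | true  | true  | false = refl
    ... | true  | false | true  = refl
    ... | true  | false | false with side-cover uv (lookup⇒∈ eV)
    ...   | inj₁ s = contradiction s (lookup⇒∉ e)
    ...   | inj₂ s = contradiction s (lookup⇒∉ e′)
    split x | false | true  | _     = contradiction (side⊆V uv (lookup⇒∈ e)) (lookup⇒∉ eV)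
    split x | false | false | true  = contradiction (side⊆V (~-sym uv) (lookup⇒∈ e′)) (lookup⇒∉ eV)
    split x | false | false | false = refl

  side-size : Fin n → Fin n → ℕ
  side-size u v = count (in-side u v)

  -- The termination measure of the recursions over planted subtrees; the larger side gains at least
  -- v itself.
  kid-size< : ∀ {p v c} → p ~ v → v ~ c → c ≢ p → side-size v c < side-size p v
  kid-size< {p} {v} {c} pv vc c≢p = subst (side-size v c <_)
    (sym (count-without (in-side p v) {v} (∈⇒lookup side-self)))
    (s≤s (count-mono (in-side v c) (in-side p v without v) λ x x∈ → trans (without-≢ (in-side p v) λ { refl → bridge vc (lookup⇒∈ x∈) })
      (∈⇒lookup (kid-side⊆ pv vc c≢p (lookup⇒∈ x∈)))))

-- Labellings of a tree

-- If only one achievable count is known, then a neighbour in conflict with it is forced to use the other label.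

data Options (A : ℕ → Set) : Set where
  two : ∀ {i j} → i ≢ j → A i → A j → Options A
  one : ∀ {i} → A i → Options A

pinned : {A : ℕ → Set} → Options A → Maybe ℕ
pinned (two _ _ _)   = nothing
pinned (one {i = i} _) = just i

-- Labels are Booleans, and Conf v i c j says that adjacent vertices v and c may not be on i and j true edges.
module Labelling (T : Graph n) (tree : IsTree T)
  (Conf : Fin n → ℕ → Fin n → ℕ → Set)
  (Conf? : ∀ v i c j → Dec (Conf v i c j))
  (Conf-sym : ∀ {v i c j} → Conf v i c j → Conf c j v i)
  (Conf-functional : ∀ {v i c j j′} → Conf v i c j → Conf v i c j′ → j ≡ j′)
  where

  open IsTree tree
  open Tree T tree

  Sym : (Fin n → Fin n → Bool) → Set
  Sym ω = ∀ {x y} → T ⊢ x ~ y → ω x y ≡ ω y x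

  cnt : (Fin n → Fin n → Bool) → Fin n → ℕ
  cnt ω v = count λ y → adj v y ∧ ω v y

  record Solution : Set where
    field
      label      : Fin n → Fin n → Bool
      label-sym  : Sym label
      proper     : ∀ {x y} → T ⊢ x ~ y → ¬ Conf x (cnt label x) y (cnt label y)

  -- `label` is defined on the whole tree, so that partial labellings need no type of their own. The
  -- edge pv counts towards `cnt-v`, but a conflict between v and p is left to the stage at which
  -- the count at p is known.
  record Ach (p v : Fin n) (w : Bool) (i : ℕ) : Set where
    field
      label     : Fin n → Fin n → Bool
      label-sym : Sym label
      label-pv  : label v p ≡ w
      cnt-v     : cnt label v ≡ i
      proper    : ∀ {x y} → x ∈ side T p v → y ∈ side T p v → T ⊢ x ~ y →
                  ¬ Conf x (cnt label x) y (cnt label y)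

  cnt-cong : ∀ ω ω′ {v} → (∀ {y} → T ⊢ v ~ y → ω v y ≡ ω′ v y) → cnt ω v ≡ cnt ω′ v
  cnt-cong ω ω′ {v} eq = count-cong λ y → go y
    where
    go : ∀ y → adj v y ∧ ω v y ≡ adj v y ∧ ω′ v y
    go y with adj v y in e
    ... | true  = eq (lookup⇒∈ e)
    ... | false = refl

  -- Every edge not at v runs inside one branch at v, and the edge vc is assigned to the branch of
  -- c, so the labellings `W c` never compete for an edge.
  glue : ∀ {v} → v ∈ V T → (W : Fin n → Fin n → Fin n → Bool) → (∀ c → Sym (W c)) →
    ∃[ ω ] (Sym ω × (∀ {c} → T ⊢ v ~ c → ω v c ≡ W c v c) ×
      (∀ {c x y} → T ⊢ v ~ c → x ∈ side T v c → T ⊢ x ~ y → ω x y ≡ W c x y))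
  glue {v} v∈ W W-sym = ω , ω-sym , ω-v , ω-side
    where
    -- The default v occurs only outside all branches, never on behalf of an edge.
    toward : Fin n → Fin n
    toward x with Fin.any? (λ c → (T ⊢ v ~? c) ×-dec (x ∈? side T v c))
    ... | yes (c , _) = c
    ... | no _        = v

    toward-≡ : ∀ {c x} → T ⊢ v ~ c → x ∈ side T v c → toward x ≡ c
    toward-≡ {c} {x} vc x∈ with Fin.any? (λ c → (T ⊢ v ~? c) ×-dec (x ∈? side T v c))
    ... | yes (d , vd , x∈d) = branch-unique vd vc x∈d x∈
    ... | no none            = contradiction (c , vc , x∈) none

    ω : Fin n → Fin n → Bool
    ω x y with x Fin.≟ v
    ... | yes _ = W (toward y) x y
    ... | no _  = W (toward x) x y

    ω-sym : Sym ω
    ω-sym {x} {y} xy with x Fin.≟ v | y Fin.≟ v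
    ... | yes refl | yes refl = contradiction xy ~-irrefl
    ... | yes refl | no _     = W-sym _ xy
    ... | no _     | yes refl = W-sym _ xy
    ... | no x≢v   | no y≢v with branch v∈ (~⇒Vˡ xy) x≢v
    ... | c , vc , x∈ with side-closed vc x∈ xy
    ... | inj₂ (_ , y≡v) = contradiction y≡v y≢v
    ... | inj₁ y∈ rewrite toward-≡ vc x∈ | toward-≡ vc y∈ = W-sym c xy

    ω-v : ∀ {c} → T ⊢ v ~ c → ω v c ≡ W c v c
    ω-v {c} vc with v Fin.≟ v
    ... | yes _  = cong (λ d → W d v c) (toward-≡ vc side-self)
    ... | no v≢v = contradiction refl v≢v

    ω-side : ∀ {c x y} → T ⊢ v ~ c → x ∈ side T v c → T ⊢ x ~ y → ω x y ≡ W c x y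
    ω-side {c} {x} {y} vc x∈ xy with x Fin.≟ v
    ... | yes refl = contradiction x∈ (bridge vc)
    ... | no _     = cong (λ d → W d x y) (toward-≡ vc x∈)

  Compatible : Fin n → ℕ → Fin n → Bool → Set
  Compatible v i c w = ∃[ j ] (Ach v c w j × ¬ Conf v i c j)

  -- `P` selects the branches that are filled from an achievable count: all of them if v is the root
  -- of the tree, all but the one through p if v is planted at p. The remaining branches get a
  -- constant label.
  assemble : ∀ {v} → v ∈ V T → (P S : Fin n → Bool) → let i = count (λ c → adj v c ∧ S c) in
    (∀ {c} → T ⊢ v ~ c → P c ≡ true → Compatible v i c (S c)) →
    ∃[ ω ] (Sym ω × (∀ {c} → T ⊢ v ~ c → ω v c ≡ S c) × cnt ω v ≡ i ×
      (∀ {c} → T ⊢ v ~ c → P c ≡ true → ¬ Conf v (cnt ω v) c (cnt ω c)) ×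
      (∀ {c} → T ⊢ v ~ c → P c ≡ true → ∀ {x y} → x ∈ side T v c → y ∈ side T v c → T ⊢ x ~ y →
        ¬ Conf x (cnt ω x) y (cnt ω y)))
  assemble {v} v∈ P S kids = ω , ω-sym , ω-v , cnt-v , (λ {c} → at-v {c}) , (λ {c} → inside-c {c})
    where
    i : ℕ
    i = count (λ c → adj v c ∧ S c)

    kid-label : ∀ c → Dec (T ⊢ v ~ c) → (b : Bool) → P c ≡ b → Fin n → Fin n → Bool
    kid-label c (yes vc) true Pc = Ach.label (proj₁ (proj₂ (kids vc Pc)))
    kid-label c _        _    _  = λ _ _ → S c

    W : Fin n → Fin n → Fin n → Bool
    W c = kid-label c (T ⊢ v ~? c) (P c) refl

    kid-label-sym : ∀ c d b e → Sym (kid-label c d b e)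
    kid-label-sym c (yes vc) true  e = Ach.label-sym (proj₁ (proj₂ (kids vc e)))
    kid-label-sym c (yes vc) false e = λ _ → refl
    kid-label-sym c (no _)   _     e = λ _ → refl

    kid-label-v : ∀ c d b e → T ⊢ v ~ c → kid-label c d b e v c ≡ S c
    kid-label-v c (yes vc) true  e _ = let a = proj₁ (proj₂ (kids vc e)) in
      trans (Ach.label-sym a vc) (Ach.label-pv a)
    kid-label-v c (yes vc) false e _ = refl
    kid-label-v c (no _)   _     e _ = refl

    glued : _
    glued = glue v∈ W (λ c → kid-label-sym c (T ⊢ v ~? c) (P c) refl)

    ω : Fin n → Fin n → Bool
    ω = proj₁ glued

    ω-sym : Sym ω
    ω-sym = proj₁ (proj₂ glued)

    ω-v : ∀ {c} → T ⊢ v ~ c → ω v c ≡ S c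
    ω-v {c} vc = trans (proj₁ (proj₂ (proj₂ glued)) vc) (kid-label-v c (T ⊢ v ~? c) (P c) refl vc)

    cnt-v : cnt ω v ≡ i
    cnt-v = cnt-cong ω (λ _ → S) ω-v

    kid-ach : ∀ c d b (e : P c ≡ b) → T ⊢ v ~ c → b ≡ true →
      ∃[ j ] Σ (Ach v c (S c) j) λ a → ¬ Conf v i c j × kid-label c d b e ≡ Ach.label a
    kid-ach c (yes vc) true  e _ _ = let j , a , nc = kids vc e in j , a , nc , refl
    kid-ach c (no ¬vc) b     e vc _ = contradiction vc ¬vc

    cnt-side : ∀ {c} → T ⊢ v ~ c → ∀ {x} → x ∈ side T v c → cnt ω x ≡ cnt (W c) x
    cnt-side {c} vc x∈ = cnt-cong ω (W c) (proj₂ (proj₂ (proj₂ glued)) vc x∈)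

    at-v : ∀ {c} → T ⊢ v ~ c → P c ≡ true → ¬ Conf v (cnt ω v) c (cnt ω c)
    at-v {c} vc Pc conf with kid-ach c (T ⊢ v ~? c) (P c) refl vc Pc
    ... | j , a , nc , eq = nc (subst₂ (λ k l → Conf v k c l) cnt-v
      (trans (cnt-side vc side-self) (trans (cong (λ f → cnt f c) eq) (Ach.cnt-v a))) conf)

    inside-c : ∀ {c} → T ⊢ v ~ c → P c ≡ true → ∀ {x y} → x ∈ side T v c → y ∈ side T v c → T ⊢ x ~ y →
      ¬ Conf x (cnt ω x) y (cnt ω y)
    inside-c {c} vc Pc {x} {y} x∈ y∈ xy conf with kid-ach c (T ⊢ v ~? c) (P c) refl vc Pc
    ... | j , a , nc , eq = Ach.proper a x∈ y∈ xy (subst₂ (λ k l → Conf x k y l)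
      (trans (cnt-side vc x∈) (cong (λ f → cnt f x) eq)) (trans (cnt-side vc y∈) (cong (λ f → cnt f y) eq)) conf)

  solve-at : ∀ {v} → v ∈ V T → (S : Fin n → Bool) → let i = count (λ c → adj v c ∧ S c) in
    (∀ {c} → T ⊢ v ~ c → Compatible v i c (S c)) → Solution
  solve-at {v} v∈ S kids with assemble v∈ (λ _ → true) S (λ vc _ → kids vc)
  ... | ω , ω-sym , _ , _ , at-v , inside-c = record { label = ω ; label-sym = ω-sym ; proper = proper }
    where
    proper : ∀ {x y} → T ⊢ x ~ y → ¬ Conf x (cnt ω x) y (cnt ω y)
    proper {x} {y} xy conf with x Fin.≟ v | y Fin.≟ v
    ... | yes refl | _        = at-v xy refl conf
    ... | no _     | yes refl = at-v (~-sym xy) refl (Conf-sym conf)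
    ... | no x≢v   | no y≢v with branch v∈ (~⇒Vˡ xy) x≢v
    ... | c , vc , x∈ with side-closed vc x∈ xy
    ... | inj₁ y∈        = inside-c vc refl x∈ y∈ xy conf
    ... | inj₂ (_ , y≡v) = y≢v y≡v

  extend : ∀ {p v} → T ⊢ p ~ v → (S : Fin n → Bool) → let i = count (λ c → adj v c ∧ S c) in
    (∀ {c} → T ⊢ v ~ c → c ≢ p → Compatible v i c (S c)) → Ach p v (S p) i
  extend {p} {v} pv S kids with assemble (~⇒Vʳ pv) (λ c → not (does (c Fin.≟ p))) S
      (λ {c} vc Pc → kids vc λ c≡p → contradiction (trans (sym Pc) (cong not (dec-true (c Fin.≟ p) c≡p))) λ ())
  ... | ω , ω-sym , ω-v , cnt-v , at-v , inside-c = record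
    { label = ω ; label-sym = ω-sym ; label-pv = ω-v (~-sym pv) ; cnt-v = cnt-v ; proper = proper }
    where
    P-true : ∀ {c} → c ≢ p → not (does (c Fin.≟ p)) ≡ true
    P-true {c} c≢p = cong not (dec-false (c Fin.≟ p) c≢p)
    proper : ∀ {x y} → x ∈ side T p v → y ∈ side T p v → T ⊢ x ~ y → ¬ Conf x (cnt ω x) y (cnt ω y)
    proper {x} {y} x∈ y∈ xy conf with side-decompose pv x∈ | side-decompose pv y∈
    ... | inj₁ refl | inj₁ refl = ~-irrefl xy
    ... | inj₁ refl | inj₂ (c , _ , _ , _) =
      at-v xy (P-true {y} λ { refl → side-disjoint pv side-self y∈ }) conf
    ... | inj₂ _ | inj₁ refl =
      at-v (~-sym xy) (P-true {x} λ { refl → side-disjoint pv side-self x∈ }) (Conf-sym conf)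
    ... | inj₂ (c , vc , c≢p , x∈c) | inj₂ (d , vd , d≢p , y∈d) with side-closed vc x∈c xy
    ... | inj₁ y∈c        = inside-c vc (P-true c≢p) x∈c y∈c xy conf
    ... | inj₂ (_ , refl) = bridge vd y∈d

  two⇒compatible : ∀ {x u k w i j} → i ≢ j → Ach x u w i → Ach x u w j → Compatible x k u w
  two⇒compatible {x} {u} {k} {w} {i} {j} i≢j a b with Conf? x k u i
  ... | no nc    = i , a , nc
  ... | yes conf = j , b , λ conf′ → i≢j (Conf-functional conf conf′)

  -- Rooting the tree at a leaf leaves a single planted subtree, and the count at the root is just
  -- the label of its only edge.
  solve-at-leaf : ∀ {x u} → T ⊢ x ~ u → count (adj x) ≡ 1 → ∀ w → Compatible x (b2n w) u w → Solution
  solve-at-leaf {x} {u} xu d w compat = solve-at (~⇒Vˡ xu) (λ _ → w) λ xc →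
    subst₂ (λ k c → Compatible x k c w) (sym (count-w w)) (sym (count-1 (adj x) (∈⇒lookup xu) d (∈⇒lookup xc))) compat
    where
    count-w : ∀ w → count (λ c → adj x c ∧ w) ≡ b2n w
    count-w true  = trans (count-cong λ c → Bool.∧-identityʳ (adj x c)) d
    count-w false = count-false λ c → Bool.∧-zeroʳ (adj x c)

  edgeless-solution : (∀ {x y} → ¬ (T ⊢ x ~ y)) → Solution
  edgeless-solution none = record { label = λ _ _ → false ; label-sym = λ _ → refl ; proper = λ e _ → none e }

  -- Blocked kids and the pigeonhole at a vertex

  module AtVertex {p v : Fin n} (pv : T ⊢ p ~ v)
    (options : ∀ c → (adj v without p) c ≡ true → ∀ w → Options (Ach v c w)) where

    kid : Fin n → Bool
    kid = adj v without p

    kid⁻ : ∀ {c} → kid c ≡ true → T ⊢ v ~ c × c ≢ p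
    kid⁻ kc = let a , c≢p = without⁻ (adj v) kc in lookup⇒∈ a , c≢p

    kid⁺ : ∀ {c} → T ⊢ v ~ c → c ≢ p → kid c ≡ true
    kid⁺ vc c≢p = trans (without-≢ (adj v) c≢p) (∈⇒lookup vc)

    abstract
      pin : Bool → ∀ c b → kid c ≡ b → Maybe ℕ
      pin w c true  e = pinned (options c e w)
      pin w c false e = nothing

      blocked-by : ℕ → Fin n → Maybe ℕ → Bool
      blocked-by i c = maybe′ (λ j → does (Conf? v i c j)) false

      -- The kid refuses the label `w` when v has count `i`, as far as is known. A pinned kid may
      -- achieve further counts, so refusals are overestimated but never missed.
      blocked : Bool → ℕ → Fin n → Bool
      blocked w i c = blocked-by i c (pin w c (kid c) refl)

      blocked⁻ : ∀ {w i c} → blocked w i c ≡ true →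
        Σ (kid c ≡ true) λ kc → ∃[ j ] (pinned (options c kc w) ≡ just j × Conf v i c j)
      blocked⁻ {w} {i} {c} = go (kid c) refl
        where
        go : ∀ b (e : kid c ≡ b) → blocked-by i c (pin w c b e) ≡ true →
          Σ (kid c ≡ true) λ kc → ∃[ j ] (pinned (options c kc w) ≡ just j × Conf v i c j)
        go true e h with pinned (options c e w) in eq
        ... | just j with Conf? v i c j
        ... | yes conf = e , j , eq , conf

      unblocked : ∀ {w i c} → kid c ≡ true → blocked w i c ≡ false → Compatible v i c w
      unblocked {w} {i} {c} kc = go (kid c) refl kc
        where
        go : ∀ b (e : kid c ≡ b) → b ≡ true → blocked-by i c (pin w c b e) ≡ false → Compatible v i c w
        go true e _ h with options c e w
        ... | one {j} a with Conf? v i c j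
        ...   | no nc = j , a , nc
        go true e _ h | two {j} {k} j≢k a b with Conf? v i c j
        ...   | no nc    = j , a , nc
        ...   | yes conf = k , b , λ conf′ → j≢k (Conf-functional conf conf′)

    -- Kids blocked for false must get true, and kids blocked for true must get false. The
    -- inequalities place `i` between the number of edges forced to be true and the number of those
    -- that may be, with pv included in both if `w` is true.
    choose : ∀ {w i} → (∀ c → blocked false i c ≡ true → blocked true i c ≡ true → Empty) →
      count (blocked false i) + b2n w ≤ i → i + count (blocked true i) ≤ count kid + b2n w → Ach p v w i
    choose {w} {i} exclusive lo hi = subst₂ (Ach p v) Sp count-S
        (extend pv S λ {c} vc c≢p → compatible vc c≢p)
      where
      -- p is no kid, so neither bound contains it by itself. Adding `at-p` to both makes the
      -- selection contain p exactly when `w` is true.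
      at-p : Fin n → Bool
      at-p c = does (c Fin.≟ p) ∧ w
      at-p-self : at-p p ≡ w
      at-p-self = cong (_∧ w) (dec-true (p Fin.≟ p) refl)
      at-p-≢ : ∀ {c} → c ≢ p → at-p c ≡ false
      at-p-≢ {c} c≢p = cong (_∧ w) (dec-false (c Fin.≟ p) c≢p)

      count-at-p : (f : Fin n → Bool) → f p ≡ false → count (λ c → f c ∨ at-p c) ≡ b2n w + count f
      count-at-p f fp = trans (∑-split p {b2n ∘ (λ c → f c ∨ at-p c)} {b2n ∘ f} (cong b2n fp)
          λ x x≢p → cong b2n (trans (cong (f x ∨_) (at-p-≢ x≢p)) (Bool.∨-identityʳ (f x))))
        (cong (λ b → b2n b + count f) (trans (cong (_∨ at-p p) fp) at-p-self))

      ¬kid-p : kid p ≡ false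
      ¬kid-p = without-self (adj v) p
      ¬blocked-p : ∀ {b} → blocked b i p ≡ false
      ¬blocked-p {b} = Bool.¬-not λ h → contradiction (trans (sym (proj₁ (blocked⁻ {b} {i} {p} h))) ¬kid-p) λ ()

      lower upper free : Fin n → Bool
      lower c = blocked false i c ∨ at-p c
      free c  = kid c ∧ not (blocked true i c)
      upper c = free c ∨ at-p c

      lower⊆upper : ∀ c → lower c ≡ true → upper c ≡ true
      lower⊆upper c h with blocked false i c in bf
      ... | false = trans (cong (free c ∨_) h) (Bool.∨-zeroʳ (free c))
      ... | true with blocked true i c in bt
      ...   | true  = ⊥-elim (exclusive c bf bt)
      ...   | false = cong (_∨ at-p c) (trans (Bool.∧-identityʳ (kid c)) (proj₁ (blocked⁻ {false} {i} {c} bf)))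

      split-kid : count kid ≡ count free + count (blocked true i)
      split-kid = trans (sum-cong-≗ eq) (∑-distrib-+ (b2n ∘ free) (b2n ∘ blocked true i))
        where
        eq : ∀ c → b2n (kid c) ≡ b2n (free c) + b2n (blocked true i c)
        eq c with blocked true i c in bt
        ... | true = trans (cong b2n kc) (cong (_+ 1) (sym (cong b2n (Bool.∧-zeroʳ (kid c)))))
          where kc = proj₁ (blocked⁻ {true} {i} {c} bt)
        ... | false = sym (trans (ℕ.+-identityʳ _) (cong b2n (Bool.∧-identityʳ (kid c))))

      selection : _
      selection = count-between lower upper lower⊆upper i
        (subst (_≤ i) (trans (ℕ.+-comm _ (b2n w)) (sym (count-at-p (blocked false i) ¬blocked-p))) lo)
        (subst (i ≤_) (sym (count-at-p free (cong (_∧ not (blocked true i p)) ¬kid-p)))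
          (ℕ.+-cancelʳ-≤ (count (blocked true i)) i (b2n w + count free)
            (subst (i + count (blocked true i) ≤_)
              (trans (ℕ.+-comm (count kid) (b2n w)) (trans (cong (b2n w +_) split-kid) (sym (ℕ.+-assoc (b2n w) _ _)))) hi)))

      S : Fin n → Bool
      S = proj₁ selection
      lower⊆S : ∀ c → lower c ≡ true → S c ≡ true
      lower⊆S = proj₁ (proj₂ selection)
      S⊆upper : ∀ c → S c ≡ true → upper c ≡ true
      S⊆upper = proj₁ (proj₂ (proj₂ selection))

      S⊆adj : ∀ c → adj v c ∧ S c ≡ S c
      S⊆adj c with S c in Sc
      ... | false = Bool.∧-zeroʳ (adj v c)
      ... | true  = trans (Bool.∧-identityʳ (adj v c)) (go (S⊆upper c Sc))
        where
        go : upper c ≡ true → adj v c ≡ true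
        go h with ∨-true⁻ (free c) h
        ... | inj₁ fc = ∈⇒lookup (proj₁ (kid⁻ (proj₁ (∧-true⁻ (kid c) fc))))
        ... | inj₂ ac = subst (λ d → adj v d ≡ true) (sym (does-true (c Fin.≟ p) (proj₁ (∧-true⁻ (does (c Fin.≟ p)) ac))))
          (∈⇒lookup (~-sym pv))

      count-S : count (λ c → adj v c ∧ S c) ≡ i
      count-S = trans (count-cong S⊆adj) (proj₂ (proj₂ (proj₂ selection)))

      Sp : S p ≡ w
      Sp = go w at-p-self
        where
        go : ∀ b → at-p p ≡ b → S p ≡ b
        go true  e = lower⊆S p (trans (cong (blocked false i p ∨_) e) (Bool.∨-zeroʳ (blocked false i p)))
        go false e = Bool.¬-not λ Sp′ → contradiction
          (trans (sym (S⊆upper p Sp′)) (cong₂ _∨_ (cong (_∧ not (blocked true i p)) ¬kid-p) e)) λ ()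

      compatible : ∀ {c} → T ⊢ v ~ c → c ≢ p → Compatible v (count (λ c → adj v c ∧ S c)) c (S c)
      compatible {c} vc c≢p = subst (λ k → Compatible v k c (S c)) (sym count-S) (go (S c) refl)
        where
        go : ∀ b → S c ≡ b → Compatible v i c b
        go false Sc = unblocked {false} (kid⁺ vc c≢p) (Bool.¬-not λ bf →
          contradiction (trans (sym (lower⊆S c (cong (_∨ at-p c) bf))) Sc) λ ())
        go true  Sc = unblocked {true} (kid⁺ vc c≢p) (Bool.¬-not λ bt → contradiction
          (trans (sym (S⊆upper c Sc)) (cong₂ _∨_ (trans (cong (λ b → kid c ∧ not b) bt) (Bool.∧-zeroʳ (kid c))) (at-p-≢ c≢p))) λ ())

    kid-irrelevant : ∀ {c} (e e′ : kid c ≡ true) → e ≡ e′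
    kid-irrelevant = Decidable⇒UIP.≡-irrelevant Bool._≟_

    blocked⇒kid : ∀ {w i c} → blocked w i c ≡ true → kid c ≡ true
    blocked⇒kid {w} {i} {c} h = proj₁ (blocked⁻ {w} {i} {c} h)

    -- By functionality, read from the kid's end, its pin conflicts with a single count at v. For a
    -- fixed label the kids are thus shared out among the counts, which is the source of the
    -- pigeonhole.
    blocked-disjoint : ∀ {w i i′ c} → i ≢ i′ → blocked w i c ≡ true → blocked w i′ c ≡ true → Empty
    blocked-disjoint {w} {i} {i′} {c} i≢i′ h h′ with blocked⁻ {w} {i} {c} h | blocked⁻ {w} {i′} {c} h′
    ... | kc , j , eq , conf | kc′ , j′ , eq′ , conf′ rewrite kid-irrelevant kc′ kc with trans (sym eq) eq′
    ... | refl = i≢i′ (Conf-functional (Conf-sym conf) (Conf-sym conf′))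

    #blocked : Bool → ℕ → ℕ
    #blocked w i = count (blocked w i)

    #blocked-≤ : ∀ w i → #blocked w i ≤ count kid
    #blocked-≤ w i = count-mono (blocked w i) kid λ c → blocked⇒kid {w} {i} {c}

    #blocked₂ : ∀ w {i j} → i ≢ j → #blocked w i + #blocked w j ≤ count kid
    #blocked₂ w {i} {j} i≢j = count-disjoint (blocked w i) (blocked w j) kid
      (λ c → blocked⇒kid {w} {i} {c}) (λ c → blocked⇒kid {w} {j} {c})
      (λ c → blocked-disjoint {w} {i} {j} {c} i≢j)

    #blocked₃ : ∀ w {i j l} → i ≢ j → i ≢ l → j ≢ l → #blocked w i + #blocked w j + #blocked w l ≤ count kid
    #blocked₃ w {i} {j} {l} i≢j i≢l j≢l = ℕ.≤-trans
      (ℕ.≤-reflexive (cong (_+ #blocked w l) (sym count-∪)))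
      (count-disjoint both (blocked w l) kid
        (λ c h → [ blocked⇒kid {w} {i} {c} , blocked⇒kid {w} {j} {c} ]′ (∨-true⁻ (blocked w i c) h))
        (λ c → blocked⇒kid {w} {l} {c})
        (λ c h h′ → [ (λ b → blocked-disjoint {w} {i} {l} {c} i≢l b h′)
                    , (λ b → blocked-disjoint {w} {j} {l} {c} j≢l b h′) ]′ (∨-true⁻ (blocked w i c) h)))
      where
      both : Fin n → Bool
      both c = blocked w i c ∨ blocked w j c
      count-∪ : count both ≡ #blocked w i + #blocked w j
      count-∪ = trans (sum-cong-≗ eq) (∑-distrib-+ (b2n ∘ blocked w i) (b2n ∘ blocked w j))
        where
        eq : ∀ c → b2n (both c) ≡ b2n (blocked w i c) + b2n (blocked w j c)
        eq c with blocked w i c in e | blocked w j c in e′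
        ... | false | _     = refl
        ... | true  | false = refl
        ... | true  | true  = ⊥-elim (blocked-disjoint {w} {i} {j} {c} i≢j e e′)

    module Counting (exclusive : ∀ i c → blocked false i c ≡ true → blocked true i c ≡ true → Empty) where

      -- With s of the kid edges true and pv labelled w, the count at v is s + b2n w: Low says that more than s
      -- kid edges are forced to be true, High that too few may be true.
      Low High : Bool → ℕ → Set
      Low  w s = s < #blocked false (s + b2n w)
      High w s = count kid < s + #blocked true (s + b2n w)

      status : ∀ w s → Ach p v w (s + b2n w) ⊎ (Low w s ⊎ High w s)
      status w s with #blocked false (s + b2n w) ℕ.≤? s | s + #blocked true (s + b2n w) ℕ.≤? count kid
      ... | no lo  | _      = inj₂ (inj₁ (ℕ.≰⇒> lo))
      ... | yes _  | no hi  = inj₂ (inj₂ (ℕ.≰⇒> hi))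
      ... | yes lo | yes hi = inj₁ (choose (exclusive (s + b2n w)) (ℕ.+-monoˡ-≤ (b2n w) lo)
        (subst (_≤ count kid + b2n w)
          (swap s (#blocked true (s + b2n w)) (b2n w))
          (ℕ.+-monoˡ-≤ (b2n w) hi)))
        where
        swap : ∀ a b c → a + b + c ≡ a + c + b
        swap = solve-∀

      -- A failure of this kind at `s` takes at least `s + 1` kids, all pinned against one count;
      -- failures at `s` and `t` together take `s + t + 2` different kids.
      ¬Low-both : ∀ w {s t} → s ≢ t → count kid ≤ suc (s + t) → Low w s → Low w t → Empty
      ¬Low-both w {s} {t} s≢t k≤ Ls Lt = ℕ.<⇒≱
        (ℕ.≤-trans (ℕ.≤-reflexive (cong suc (sym (ℕ.+-suc s t)))) (ℕ.+-mono-≤ Ls Lt))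
        (ℕ.≤-trans (#blocked₂ false (s≢t ∘ ℕ.+-cancelʳ-≡ (b2n w) s t)) k≤)

      -- Dually, a failure at `s` takes at least `count kid + 1 − s` kids, and different counts use
      -- different kids.
      ¬High-both : ∀ w {s t} → s ≢ t → s + t ≤ suc (count kid) → High w s → High w t → Empty
      ¬High-both w {s} {t} s≢t st≤ Hs Ht = ℕ.<⇒≱
        (ℕ.≤-trans (ℕ.≤-reflexive (cong suc (sym (ℕ.+-suc k k)))) (ℕ.≤-trans (ℕ.+-mono-≤ Hs Ht)
          (ℕ.≤-reflexive (rearrange s _ t _))))
        (ℕ.≤-trans (ℕ.+-mono-≤ st≤ (#blocked₂ true (s≢t ∘ ℕ.+-cancelʳ-≡ (b2n w) s t))) ℕ.≤-refl)
        where
        k = count kid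
        rearrange : ∀ a b c d → a + b + (c + d) ≡ a + c + (b + d)
        rearrange = solve-∀

      Apart : Bool → ℕ → ℕ → Set
      Apart w s t = s ≢ t × (Low w s → Low w t → Empty) × (High w s → High w t → Empty)

      apart : ∀ w {s t} → s ≢ t → count kid ≤ suc (s + t) → s + t ≤ suc (count kid) → Apart w s t
      apart w s≢t lo hi = s≢t , ¬Low-both w s≢t lo , ¬High-both w s≢t hi

      -- There are two ways to fail, and each strikes at most one of a set of pairwise apart counts.
      -- So one of three counts is achieved, and two of four in `achieve₂`.
      achieve₁ : ∀ w {x y z} → Apart w x y → Apart w x z → Apart w y z →
        Ach p v w (x + b2n w) ⊎ Ach p v w (y + b2n w) ⊎ Ach p v w (z + b2n w)
      achieve₁ w {x} {y} {z} (_ , xyL , xyH) (_ , xzL , xzH) (_ , yzL , yzH) with status w x | status w y | status w z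
      ... | inj₁ a | _ | _ = inj₁ a
      ... | _ | inj₁ a | _ = inj₂ (inj₁ a)
      ... | _ | _ | inj₁ a = inj₂ (inj₂ a)
      ... | inj₂ (inj₁ l) | inj₂ (inj₁ l′) | _ = ⊥-elim (xyL l l′)
      ... | inj₂ (inj₂ h) | inj₂ (inj₂ h′) | _ = ⊥-elim (xyH h h′)
      ... | inj₂ (inj₁ l) | _ | inj₂ (inj₁ l′) = ⊥-elim (xzL l l′)
      ... | inj₂ (inj₂ h) | _ | inj₂ (inj₂ h′) = ⊥-elim (xzH h h′)
      ... | _ | inj₂ (inj₁ l) | inj₂ (inj₁ l′) = ⊥-elim (yzL l l′)
      ... | _ | inj₂ (inj₂ h) | inj₂ (inj₂ h′) = ⊥-elim (yzH h h′)

      Two : Bool → Set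
      Two w = ∃[ i ] ∃[ j ] (i ≢ j × Ach p v w i × Ach p v w j)

      pair : ∀ w {s t} → s ≢ t → Ach p v w (s + b2n w) → Ach p v w (t + b2n w) → Two w
      pair w {s} {t} s≢t a b = _ , _ , s≢t ∘ ℕ.+-cancelʳ-≡ (b2n w) s t , a , b

      achieve₂ : ∀ w {x y z u} → Apart w x y → Apart w x z → Apart w x u → Apart w y z → Apart w y u → Apart w z u → Two w
      achieve₂ w xy xz xu yz yu zu with achieve₁ w xy xz yz
      ... | inj₁ a with achieve₁ w yz yu zu
      ...   | inj₁ b        = pair w (proj₁ xy) a b
      ...   | inj₂ (inj₁ b) = pair w (proj₁ xz) a b
      ...   | inj₂ (inj₂ b) = pair w (proj₁ xu) a b
      achieve₂ w xy xz xu yz yu zu | inj₂ (inj₁ a) with achieve₁ w xz xu zu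
      ...   | inj₁ b        = pair w (proj₁ xy ∘ sym) a b
      ...   | inj₂ (inj₁ b) = pair w (proj₁ yz) a b
      ...   | inj₂ (inj₂ b) = pair w (proj₁ yu) a b
      achieve₂ w xy xz xu yz yu zu | inj₂ (inj₂ a) with achieve₁ w xy xu yu
      ...   | inj₁ b        = pair w (proj₁ xz ∘ sym) a b
      ...   | inj₂ (inj₁ b) = pair w (proj₁ yz ∘ sym) a b
      ...   | inj₂ (inj₂ b) = pair w (proj₁ zu) a b

      leaf-ach : count kid ≡ 0 → ∀ w → Ach p v w (0 + b2n w)
      leaf-ach k≡0 w with status w 0
      ... | inj₁ a        = a
      ... | inj₂ (inj₁ l) = contradiction (ℕ.<-≤-trans l (ℕ.≤-trans (#blocked-≤ false (b2n w)) (ℕ.≤-reflexive k≡0))) λ ()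
      ... | inj₂ (inj₂ h) = contradiction (#blocked-≤ true (b2n w)) (ℕ.<⇒≱ h)

-- Signed labellings: with labels ±1 and an offset lam, the value at v is lam v + 2 (#true) − deg v.

shift-≢ : ∀ {s t} q → s ≢ t → s + q ≢ t + q
shift-≢ {s} {t} q s≢t = s≢t ∘ ℕ.+-cancelʳ-≡ q s t

odd-4+ : ∀ a b c → odd (a + (b + b) + c) ≡ odd (a + c)
odd-4+ a b c = trans (cong odd (rearrange a b c))
  (trans (odd-+ (a + c) (b + b)) (trans (cong (odd (a + c) xor_) (odd-double b)) (Bool.xor-identityʳ _)))
  where
  rearrange : ∀ a b c → a + (b + b) + c ≡ a + c + (b + b)
  rearrange = solve-∀

≤-by : ∀ {a b} d → a + d ≡ b → a ≤ b
≤-by {a} d e = subst (a ≤_) e (ℕ.m≤m+n a d)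

module Signed (T : Graph n) (tree : IsTree T) (lam : Fin n → ℕ)
  (lam-parity : ∀ {x y} → T ⊢ x ~ y → odd (lam x) ≡ odd (lam y)) where

  open IsTree tree
  open Tree T tree

  deg : Fin n → ℕ
  deg v = count (adj v)

  -- Equality of the values at v and c, with both degrees moved across to stay within the natural
  -- numbers.
  Conf : Fin n → ℕ → Fin n → ℕ → Set
  Conf v i c j = lam v + (i + i) + deg c ≡ lam c + (j + j) + deg v

  double-injective : ∀ {i j} → i + i ≡ j + j → i ≡ j
  double-injective {zero}  {zero}  _ = refl
  double-injective {suc i} {suc j} e = cong suc (double-injective
    (ℕ.suc-injective (trans (sym (ℕ.+-suc i i)) (trans (ℕ.suc-injective e) (ℕ.+-suc j j)))))

  Conf-functional : ∀ {v i c j j′} → Conf v i c j → Conf v i c j′ → j ≡ j′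
  Conf-functional {v} {i} {c} {j} {j′} e e′ = double-injective (ℕ.+-cancelˡ-≡ (lam c) _ _
    (ℕ.+-cancelʳ-≡ (deg v) _ _ (trans (sym e) e′)))

  open Labelling T tree Conf (λ v i c j → lam v + (i + i) + deg c ℕ.≟ lam c + (j + j) + deg v) sym
    (λ {v} {i} {c} → Conf-functional {v} {i} {c}) public

  -- Shape p v b describes the side of v at pv in a member of 𝒞: b tells whether pv is in the matching.
  data Shape : Fin n → Fin n → Bool → Set where
    leaf  : ∀ {p v} → deg v ≡ 1 → Shape p v false
    outer : ∀ {p v a b} → deg v ≡ 3 → T ⊢ v ~ a → T ⊢ v ~ b → a ≢ p → b ≢ p → b ≢ a →
      lam a ≡ lam v → lam b ≡ lam v → Shape v a true → Shape v b false → Shape p v false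
    inner : ∀ {p v a b} → deg v ≡ 3 → T ⊢ v ~ a → T ⊢ v ~ b → a ≢ p → b ≢ p → b ≢ a →
      lam a ≡ lam v → lam b ≡ lam v → Shape v a false → Shape v b false → Shape p v true

  -- Relative to `lam v`, `rigid₁` pins v to the values -1 and 1, as a leaf does, and `rigid₃` to -3
  -- and 3, for the labels false and true. All outcomes with a pin entail odd degree, so that parity
  -- can exclude conflicts.
  data Outcome (p v : Fin n) : Set where
    free   : (∀ w → ∃[ i ] ∃[ j ] (i ≢ j × Ach p v w i × Ach p v w j)) → Outcome p v
    loose  : odd (deg v) ≡ true → (o : ∀ w → Options (Ach p v w)) → ∃[ w ] pinned (o w) ≡ nothing → Outcome p v
    rigid₁ : ∀ {i} → deg v ≡ suc (i + i) → Shape p v false → Ach p v false i → Ach p v true (suc i) → Outcome p v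
    rigid₃ : deg v ≡ 3 → Shape p v true → Ach p v false 0 → Ach p v true 3 → Outcome p v

  options-of : ∀ {p v} → Outcome p v → ∀ w → Options (Ach p v w)
  options-of (free f)         w     = let _ , _ , i≢j , a , b = f w in two i≢j a b
  options-of (loose _ o _)    w     = o w
  options-of (rigid₁ _ _ a b) false = one a
  options-of (rigid₁ _ _ a b) true  = one b
  options-of (rigid₃ _ _ a b) false = one a
  options-of (rigid₃ _ _ a b) true  = one b

  pinned⇒odd : ∀ {p v w j} (o : Outcome p v) → pinned (options-of o w) ≡ just j → odd (deg v) ≡ true
  pinned⇒odd (loose d _ _)             _ = d
  pinned⇒odd {v = v} (rigid₁ {i} d _ _ _) _ = trans (cong odd d) (cong not (odd-double i))
  pinned⇒odd {v = v} (rigid₃ d _ _ _)  _ = cong odd d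

  data Rigid (p v : Fin n) : ℕ → ℕ → Set where
    rigid₁ : ∀ {i} → deg v ≡ suc (i + i) → Shape p v false → Rigid p v i (suc i)
    rigid₃ : deg v ≡ 3 → Shape p v true → Rigid p v 0 3

  pinned⇒rigid : ∀ {p v i j} (o : Outcome p v) → pinned (options-of o false) ≡ just i → pinned (options-of o true) ≡ just j →
    Rigid p v i j
  pinned⇒rigid (loose _ o (false , e)) e′ _ = contradiction (trans (sym e) e′) λ ()
  pinned⇒rigid (loose _ o (true , e))  _ e′ = contradiction (trans (sym e) e′) λ ()
  pinned⇒rigid (rigid₁ d s _ _) refl refl = rigid₁ d s
  pinned⇒rigid (rigid₃ d s _ _) refl refl = rigid₃ d s

  module Kids {p v : Fin n} (pv : T ⊢ p ~ v)
    (outcome : ∀ c → (adj v without p) c ≡ true → Outcome v c) where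

    open AtVertex pv (λ c kc → options-of (outcome c kc)) public

    deg-v : deg v ≡ suc (count kid)
    deg-v = count-without (adj v) (∈⇒lookup (~-sym pv))

    blocked-both : ∀ {i i′ c} → blocked false i c ≡ true → blocked true i′ c ≡ true →
      Σ (T ⊢ v ~ c) λ _ → c ≢ p × ∃[ j ] ∃[ j′ ] (Rigid v c j j′ × Conf v i c j × Conf v i′ c j′)
    blocked-both {i} {i′} {c} h h′ with blocked⁻ {false} {i} {c} h | blocked⁻ {true} {i′} {c} h′
    ... | kc , j , eq , conf | kc′ , j′ , eq′ , conf′ rewrite kid-irrelevant kc′ kc =
      proj₁ (kid⁻ kc) , proj₂ (kid⁻ kc) , j , j′ , pinned⇒rigid (outcome c kc) eq eq′ , conf , conf′

    -- Blocking both labels at the same count takes a rigid kid whose two pins coincide, but they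
    -- differ by 1 or 3.
    exclusive : ∀ i c → blocked false i c ≡ true → blocked true i c ≡ true → Empty
    exclusive i c h h′ with blocked-both {i} {i} {c} h h′
    ... | _ , _ , j , j′ , r , conf , conf′ = distinct r (Conf-functional {v} {i} {c} {j} {j′} conf conf′)
      where
      distinct : ∀ {j j′} → Rigid v c j j′ → j ≢ j′
      distinct (rigid₁ {i = i} _ _) e = ℕ.<⇒≢ (ℕ.n<1+n i) e
      distinct (rigid₃ _ _) ()

    open Counting exclusive public

    -- Modulo 2, a conflict between v and c equates their degrees, because neighbouring offsets have
    -- the same parity; and a pinned kid has odd degree.
    blocked⇒odd : ∀ {w i c} → blocked w i c ≡ true → odd (deg v) ≡ true
    blocked⇒odd {w} {i} {c} h with blocked⁻ {w} {i} {c} h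
    ... | kc , j , eq , conf = trans (sym same-parity) (pinned⇒odd {w = w} (outcome c kc) eq)
      where
      xor-cancelˡ : ∀ a {b c} → a xor b ≡ a xor c → b ≡ c
      xor-cancelˡ true  e = Bool.not-injective e
      xor-cancelˡ false e = e
      same-parity : odd (deg c) ≡ odd (deg v)
      same-parity = xor-cancelˡ (odd (lam v)) (begin
        odd (lam v) xor odd (deg c)        ≡⟨ sym (odd-+ (lam v) (deg c)) ⟩
        odd (lam v + deg c)                ≡⟨ sym (odd-4+ (lam v) i (deg c)) ⟩
        odd (lam v + (i + i) + deg c)      ≡⟨ cong odd conf ⟩
        odd (lam c + (j + j) + deg v)      ≡⟨ odd-4+ (lam c) j (deg v) ⟩
        odd (lam c + deg v)                ≡⟨ odd-+ (lam c) (deg v) ⟩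
        odd (lam c) xor odd (deg v)        ≡⟨ cong (_xor odd (deg v)) (sym (lam-parity (proj₁ (kid⁻ kc)))) ⟩
        odd (lam v) xor odd (deg v)        ∎)
        where open ≡-Reasoning

    even-free : odd (deg v) ≡ false → Outcome p v
    even-free even = free λ w → pair w {0} {1} (λ ()) (at w 0 z≤n) (at w 1 (≥1 (count kid) (trans (cong odd (sym deg-v)) even)))
      where
      none : ∀ w i → #blocked w i ≡ 0
      none w i = count-false λ c → Bool.¬-not λ h → contradiction (trans (sym (blocked⇒odd {w} {i} {c} h)) even) λ ()
      ≥1 : ∀ k → odd (suc k) ≡ false → 1 ≤ k
      ≥1 (suc k) _ = s≤s z≤n
      at : ∀ w s → s ≤ count kid → Ach p v w (s + b2n w)
      at w s s≤ with status w s
      ... | inj₁ a        = a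
      ... | inj₂ (inj₁ l) = contradiction (subst (s <_) (none false (s + b2n w)) l) λ ()
      ... | inj₂ (inj₂ h) = contradiction
        (subst (λ z → count kid < s + z) (none true (s + b2n w)) h)
        (ℕ.≤⇒≯ (ℕ.≤-trans (ℕ.≤-reflexive (ℕ.+-identityʳ s)) s≤))

    -- With 2m kids the middle three counts cannot all fail.
    some-ach : ∀ {m} → count kid ≡ suc m + suc m → ∀ w → ∃[ i ] Ach p v w i
    some-ach {m} k≡ w = [ _,_ _ , [ _,_ _ , _,_ _ ]′ ]′ (achieve₁ w {m} {1 + m} {2 + m}
      (apart w (shift-≢ {0} {1} m λ ()) (k≤ 0 (e₁ m)) (≤k 2 (f₁ m)))
      (apart w (shift-≢ {0} {2} m λ ()) (k≤ 1 (e₂ m)) (≤k 1 (f₂ m)))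
      (apart w (shift-≢ {1} {2} m λ ()) (k≤ 2 (e₃ m)) (≤k 0 (f₃ m))))
      where
      k≤ : ∀ {x} d → suc m + suc m + d ≡ x → count kid ≤ x
      k≤ d e = subst (_≤ _) (sym k≡) (≤-by d e)
      ≤k : ∀ {x} d → x + d ≡ suc (suc m + suc m) → x ≤ suc (count kid)
      ≤k d e = subst (λ k → _ ≤ suc k) (sym k≡) (≤-by d e)
      e₁ : ∀ m → suc m + suc m + 0 ≡ suc (m + (1 + m))
      e₁ = solve-∀
      e₂ : ∀ m → suc m + suc m + 1 ≡ suc (m + (2 + m))
      e₂ = solve-∀
      e₃ : ∀ m → suc m + suc m + 2 ≡ suc (1 + m + (2 + m))
      e₃ = solve-∀
      f₁ : ∀ m → m + (1 + m) + 2 ≡ suc (suc m + suc m)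
      f₁ = solve-∀
      f₂ : ∀ m → m + (2 + m) + 1 ≡ suc (suc m + suc m)
      f₂ = solve-∀
      f₃ : ∀ m → 1 + m + (2 + m) + 0 ≡ suc (suc m + suc m)
      f₃ = solve-∀

    module Many (q : ℕ) (k≡ : count kid ≡ suc (suc q) + suc (suc q)) where

      private
        ≤k : ∀ {x} d → x + d ≡ suc (suc (suc q) + suc (suc q)) → x ≤ suc (count kid)
        ≤k d e = subst (λ k → _ ≤ suc k) (sym k≡) (≤-by d e)
        k≤ : ∀ {x} d → suc (suc q) + suc (suc q) + d ≡ x → count kid ≤ x
        k≤ d e = subst (_≤ _) (sym k≡) (≤-by d e)
        g₁ : ∀ q → 0 + q + (1 + q) + 4 ≡ suc (suc (suc q) + suc (suc q))
        g₁ = solve-∀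
        g₂ : ∀ q → 0 + q + (2 + q) + 3 ≡ suc (suc (suc q) + suc (suc q))
        g₂ = solve-∀
        g₃ : ∀ q → 0 + q + (3 + q) + 2 ≡ suc (suc (suc q) + suc (suc q))
        g₃ = solve-∀
        g₄ : ∀ q → 1 + q + (2 + q) + 2 ≡ suc (suc (suc q) + suc (suc q))
        g₄ = solve-∀
        g₅ : ∀ q → 1 + q + (3 + q) + 1 ≡ suc (suc (suc q) + suc (suc q))
        g₅ = solve-∀
        g₆ : ∀ q → 2 + q + (3 + q) + 0 ≡ suc (suc (suc q) + suc (suc q))
        g₆ = solve-∀
        h₃ : ∀ q → suc (suc q) + suc (suc q) + 0 ≡ suc (0 + q + (3 + q))
        h₃ = solve-∀
        h₄ : ∀ q → suc (suc q) + suc (suc q) + 0 ≡ suc (1 + q + (2 + q))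
        h₄ = solve-∀
        h₅ : ∀ q → suc (suc q) + suc (suc q) + 1 ≡ suc (1 + q + (3 + q))
        h₅ = solve-∀
        h₆ : ∀ q → suc (suc q) + suc (suc q) + 2 ≡ suc (2 + q + (3 + q))
        h₆ = solve-∀

      -- The candidates are the four counts from `q` to `q + 3` of the `2q + 4` kids. All pairs
      -- among them are apart by counting, except that `q` may fail low together with `q + 1` or
      -- with `q + 2`.
      two-unless : ∀ w → Two w ⊎ (Low w q × (Low w (1 + q) ⊎ Low w (2 + q)))
      two-unless w = go (Low? q) (Low? (1 + q)) (Low? (2 + q))
        where
        Low? : ∀ s → Dec (Low w s)
        Low? s = s ℕ.<? #blocked false (s + b2n w)
        from : (Low w q → Low w (1 + q) → Empty) → (Low w q → Low w (2 + q) → Empty) → Two w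
        from l₁ l₂ = achieve₂ w
          (shift-≢ {0} {1} q (λ ()) , l₁ , ¬High-both w (shift-≢ {0} {1} q λ ()) (≤k 4 (g₁ q)))
          (shift-≢ {0} {2} q (λ ()) , l₂ , ¬High-both w (shift-≢ {0} {2} q λ ()) (≤k 3 (g₂ q)))
          (apart w (shift-≢ {0} {3} q λ ()) (k≤ 0 (h₃ q)) (≤k 2 (g₃ q)))
          (apart w (shift-≢ {1} {2} q λ ()) (k≤ 0 (h₄ q)) (≤k 2 (g₄ q)))
          (apart w (shift-≢ {1} {3} q λ ()) (k≤ 1 (h₅ q)) (≤k 1 (g₅ q)))
          (apart w (shift-≢ {2} {3} q λ ()) (k≤ 2 (h₆ q)) (≤k 0 (g₆ q)))
        go : Dec (Low w q) → Dec (Low w (1 + q)) → Dec (Low w (2 + q)) → Two w ⊎ (Low w q × (Low w (1 + q) ⊎ Low w (2 + q)))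
        go (yes l) (yes l₁) _        = inj₂ (l , inj₁ l₁)
        go (yes l) (no _)   (yes l₂) = inj₂ (l , inj₂ l₂)
        go (yes l) (no ¬l₁) (no ¬l₂) = inj₁ (from (λ _ → ¬l₁) (λ _ → ¬l₂))
        go (no ¬l) _        _        = inj₁ (from (λ l → ⊥-elim (¬l l)) (λ l → ⊥-elim (¬l l)))

      -- Not both values of w can be obstructed, since this would take more than 2q + 4 pins of false.
      two-some : Two false ⊎ Two true
      two-some with two-unless false | two-unless true
      ... | inj₁ t | _      = inj₁ t
      ... | inj₂ _ | inj₁ t = inj₂ t
      ... | inj₂ (l₀ , l₁₂) | inj₂ (l₁′ , l₂₃) = ⊥-elim (clash l₁₂ l₂₃)
        where
        #f : ℕ → ℕ
        #f = #blocked false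
        n₀ : 1 + q ≤ #f q
        n₀ = subst (λ z → q < #f z) (ℕ.+-identityʳ q) l₀
        -- `Low true` is also about kids that block false; the true edge pv merely moves the count
        -- at v up by one.
        n₁ : 1 + q ≤ #f (1 + q)
        n₁ = subst (λ z → q < #f z) (ℕ.+-comm q 1) l₁′
        too-many : ∀ {x y z i j l} d → i ≢ j → i ≢ l → j ≢ l → x ≤ #f i → y ≤ #f j → z ≤ #f l →
          suc (suc (suc q) + suc (suc q)) + d ≡ x + y + z → Empty
        too-many d ij il jl a b c e = ℕ.<⇒≱ (≤-by d e)
          (ℕ.≤-trans (ℕ.+-mono-≤ (ℕ.+-mono-≤ a b) c) (ℕ.≤-trans (#blocked₃ false ij il jl) (ℕ.≤-reflexive k≡)))
        s₁ : ∀ q → suc (suc (suc q) + suc (suc q)) + q ≡ (1 + q) + (2 + q) + (2 + q)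
        s₁ = solve-∀
        s₂ : ∀ q → suc (suc (suc q) + suc (suc q)) + suc q ≡ (1 + q) + (2 + q) + (3 + q)
        s₂ = solve-∀
        s₃ : ∀ q → suc (suc (suc q) + suc (suc q)) + q ≡ (1 + q) + (1 + q) + (3 + q)
        s₃ = solve-∀
        clash : Low false (1 + q) ⊎ Low false (2 + q) → Low true (1 + q) ⊎ Low true (2 + q) → Empty
        clash (inj₁ l) (inj₁ r) = too-many q (shift-≢ {0} {1} q λ ()) (shift-≢ {0} {2} q λ ()) (shift-≢ {1} {2} q λ ())
          n₀ (subst (λ z → suc q < #f z) (ℕ.+-identityʳ (1 + q)) l) (subst (λ z → suc q < #f z) (ℕ.+-comm (1 + q) 1) r) (s₁ q)
        clash (inj₁ l) (inj₂ r) = too-many (suc q) (shift-≢ {0} {1} q λ ()) (shift-≢ {0} {3} q λ ()) (shift-≢ {1} {3} q λ ())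
          n₀ (subst (λ z → suc q < #f z) (ℕ.+-identityʳ (1 + q)) l) (subst (λ z → 2 + q < #f z) (ℕ.+-comm (2 + q) 1) r) (s₂ q)
        clash (inj₂ l) _ = too-many q (shift-≢ {0} {1} q λ ()) (shift-≢ {0} {2} q λ ()) (shift-≢ {1} {2} q λ ())
          n₀ n₁ (subst (λ z → 2 + q < #f z) (ℕ.+-identityʳ (2 + q)) l) (s₃ q)

    loose-from : odd (deg v) ≡ true → (∀ w → ∃[ i ] Ach p v w i) → Two false ⊎ Two true → Outcome p v
    loose-from d some (inj₁ (_ , _ , i≢j , a , b)) = loose d
      (λ { false → two i≢j a b ; true → one (proj₂ (some true)) }) (false , refl)
    loose-from d some (inj₂ (_ , _ , i≢j , a , b)) = loose d
      (λ { true → two i≢j a b ; false → one (proj₂ (some false)) }) (true , refl)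

    leaf-outcome : count kid ≡ 0 → Outcome p v
    leaf-outcome k≡0 = rigid₁ deg≡1 (leaf deg≡1) (leaf-ach k≡0 false) (leaf-ach k≡0 true)
      where
      deg≡1 : deg v ≡ 1
      deg≡1 = trans deg-v (cong suc k≡0)

-- The three relevant positions of a pin of false (0, 1, 2) or of true (1, 2, 3), or none of them (3, resp. 0).

hit : ℕ → Fin 4 → ℕ
hit i x = b2n (does (toℕ x ℕ.≟ i))

class-false class-true : Bool → Bool → Bool → Fin 4
class-false a b c = if a then # 0 else if b then # 1 else if c then # 2 else # 3
class-true  a b c = if a then # 1 else if b then # 2 else if c then # 3 else # 0

Disjoint : Bool → Bool → Set
Disjoint a b = a ≡ true → b ≡ true → Empty

class-false-hit : ∀ a b c → Disjoint a b → Disjoint a c → Disjoint b c → let x = class-false a b c in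
  b2n a ≡ hit 0 x × b2n b ≡ hit 1 x × b2n c ≡ hit 2 x
class-false-hit true  true  _     ab _  _  = ⊥-elim (ab refl refl)
class-false-hit true  false true  _  ac _  = ⊥-elim (ac refl refl)
class-false-hit true  false false _  _  _  = refl , refl , refl
class-false-hit false true  true  _  _  bc = ⊥-elim (bc refl refl)
class-false-hit false true  false _  _  _  = refl , refl , refl
class-false-hit false false true  _  _  _  = refl , refl , refl
class-false-hit false false false _  _  _  = refl , refl , refl

class-true-hit : ∀ a b c → Disjoint a b → Disjoint a c → Disjoint b c → let x = class-true a b c in
  b2n a ≡ hit 1 x × b2n b ≡ hit 2 x × b2n c ≡ hit 3 x
class-true-hit true  true  _     ab _  _  = ⊥-elim (ab refl refl)
class-true-hit true  false true  _  ac _  = ⊥-elim (ac refl refl)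
class-true-hit true  false false _  _  _  = refl , refl , refl
class-true-hit false true  true  _  _  bc = ⊥-elim (bc refl refl)
class-true-hit false true  false _  _  _  = refl , refl , refl
class-true-hit false false true  _  _  _  = refl , refl , refl
class-true-hit false false false _  _  _  = refl , refl , refl

-- For two kids the pigeonhole over the three available counts guarantees just one success, so the
-- pins are inspected individually: `x`, `y` are the positions for false and true at one kid, `x′`,
-- `y′` at the other.
module Analysis (x y x′ y′ : Fin 4) where

  hits-false hits-true : ℕ → ℕ
  hits-false i = hit i x + hit i x′
  hits-true  i = hit i y + hit i y′

  OK : ℕ → ℕ → Set
  OK w s = hits-false (s + w) ≤ s × s + hits-true (s + w) ≤ 2

  -- The counts at s = 0 and s = 2 are only constrained from one side.
  OK₀ OK₂ : ℕ → Set
  OK₀ w = hits-false w ≤ 0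
  OK₂ w = 2 + hits-true (2 + w) ≤ 2

  Pair : ℕ → Set
  Pair w = (OK₀ w × OK w 1) ⊎ (OK₀ w × OK₂ w) ⊎ (OK w 1 × OK₂ w)

  -- `Near` and `Far` are the positions of a kid of kind `rigid₁` and `rigid₃` whose offset equals
  -- that of v. `Stray` means two pins at a distance that occurs for no rigid kid.
  Near Far Stray : Fin 4 → Fin 4 → Set
  Near  s t = s ≡ # 1 × t ≡ # 2
  Far   s t = s ≡ # 0 × t ≡ # 3
  Stray s t = s ≢ # 3 × t ≢ # 0 × toℕ t ≢ suc (toℕ s) × ¬ Far s t

  Verdict : Set
  Verdict = Pair 0 ⊎ Pair 1 ⊎ (Near x y × Near x′ y′) ⊎ (Far x y × Near x′ y′) ⊎ (Near x y × Far x′ y′) ⊎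
    Stray x y ⊎ Stray x′ y′

  verdict? : Dec Verdict
  verdict? = pair? 0 ⊎-dec pair? 1 ⊎-dec (near? x y ×-dec near? x′ y′) ⊎-dec (far? x y ×-dec near? x′ y′)
    ⊎-dec (near? x y ×-dec far? x′ y′) ⊎-dec stray? x y ⊎-dec stray? x′ y′
    where
    ok? : ∀ w s → Dec (OK w s)
    ok? w s = (hits-false (s + w) ℕ.≤? s) ×-dec (s + hits-true (s + w) ℕ.≤? 2)
    pair? : ∀ w → Dec (Pair w)
    pair? w = ((hits-false w ℕ.≤? 0) ×-dec ok? w 1) ⊎-dec ((hits-false w ℕ.≤? 0) ×-dec (2 + hits-true (2 + w) ℕ.≤? 2))
      ⊎-dec (ok? w 1 ×-dec (2 + hits-true (2 + w) ℕ.≤? 2))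
    near? : ∀ s t → Dec (Near s t)
    near? s t = (s Fin.≟ # 1) ×-dec (t Fin.≟ # 2)
    far? : ∀ s t → Dec (Far s t)
    far? s t = (s Fin.≟ # 0) ×-dec (t Fin.≟ # 3)
    stray? : ∀ s t → Dec (Stray s t)
    stray? s t = ¬? (s Fin.≟ # 3) ×-dec ¬? (t Fin.≟ # 0) ×-dec ¬? (toℕ t ℕ.≟ suc (toℕ s)) ×-dec ¬? (far? s t)

-- All 256 configurations are checked by evaluation of the decision procedure.
verdict : ∀ x y x′ y′ → Analysis.Verdict x y x′ y′
verdict = toWitness {a? = Fin.all? λ x → Fin.all? λ y → Fin.all? λ x′ → Fin.all? λ y′ → Analysis.verdict? x y x′ y′} _

-- Signed labellings: the case of two kids and the recursion

module SignedStep (T : Graph n) (tree : IsTree T) (lam : Fin n → ℕ)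
  (lam-parity : ∀ {x y} → T ⊢ x ~ y → odd (lam x) ≡ odd (lam y)) where

  open IsTree tree
  open Tree T tree
  open Signed T tree lam lam-parity

  module TwoKids {p v : Fin n} (pv : T ⊢ p ~ v)
    (outcome : ∀ c → (adj v without p) c ≡ true → Outcome v c)
    (k≡2 : count (adj v without p) ≡ 2) where

    open Kids pv outcome

    deg≡3 : deg v ≡ 3
    deg≡3 = trans deg-v (cong suc k≡2)

    pin-false pin-true : Fin n → Fin 4
    pin-false c = class-false (blocked false 0 c) (blocked false 1 c) (blocked false 2 c)
    pin-true  c = class-true (blocked true 1 c) (blocked true 2 c) (blocked true 3 c)

    pin-false-hit : ∀ c → b2n (blocked false 0 c) ≡ hit 0 (pin-false c) ×
      b2n (blocked false 1 c) ≡ hit 1 (pin-false c) × b2n (blocked false 2 c) ≡ hit 2 (pin-false c)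
    pin-false-hit c = class-false-hit _ _ _ (blocked-disjoint {false} {0} {1} {c} λ ())
      (blocked-disjoint {false} {0} {2} {c} λ ()) (blocked-disjoint {false} {1} {2} {c} λ ())

    pin-true-hit : ∀ c → b2n (blocked true 1 c) ≡ hit 1 (pin-true c) ×
      b2n (blocked true 2 c) ≡ hit 2 (pin-true c) × b2n (blocked true 3 c) ≡ hit 3 (pin-true c)
    pin-true-hit c = class-true-hit _ _ _ (blocked-disjoint {true} {1} {2} {c} λ ())
      (blocked-disjoint {true} {1} {3} {c} λ ()) (blocked-disjoint {true} {2} {3} {c} λ ())

    blocked-at-false : ∀ {c} i {s} → pin-false c ≡ s → i ≡ toℕ s → i < 3 → blocked false i c ≡ true
    blocked-at-false {c} 0 eq e _ = b2n-injective (trans (proj₁ (pin-false-hit c)) (trans (cong (hit 0) eq) (cong b2n (dec-true (toℕ _ ℕ.≟ 0) (sym e)))))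
    blocked-at-false {c} 1 eq e _ = b2n-injective (trans (proj₁ (proj₂ (pin-false-hit c))) (trans (cong (hit 1) eq) (cong b2n (dec-true (toℕ _ ℕ.≟ 1) (sym e)))))
    blocked-at-false {c} 2 eq e _ = b2n-injective (trans (proj₂ (proj₂ (pin-false-hit c))) (trans (cong (hit 2) eq) (cong b2n (dec-true (toℕ _ ℕ.≟ 2) (sym e)))))
    blocked-at-false (suc (suc (suc _))) _ _ (s≤s (s≤s (s≤s ())))

    blocked-at-true : ∀ {c} i {s} → pin-true c ≡ s → suc i ≡ toℕ s → i < 3 → blocked true (suc i) c ≡ true
    blocked-at-true {c} 0 eq e _ = b2n-injective (trans (proj₁ (pin-true-hit c)) (trans (cong (hit 1) eq) (cong b2n (dec-true (toℕ _ ℕ.≟ 1) (sym e)))))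
    blocked-at-true {c} 1 eq e _ = b2n-injective (trans (proj₁ (proj₂ (pin-true-hit c))) (trans (cong (hit 2) eq) (cong b2n (dec-true (toℕ _ ℕ.≟ 2) (sym e)))))
    blocked-at-true {c} 2 eq e _ = b2n-injective (trans (proj₂ (proj₂ (pin-true-hit c))) (trans (cong (hit 3) eq) (cong b2n (dec-true (toℕ _ ℕ.≟ 3) (sym e)))))
    blocked-at-true (suc (suc (suc _))) _ _ (s≤s (s≤s (s≤s ())))

    -- The difference of the two conflicts carries the distance of the kid's pins, 1 or 3, over to
    -- the counts at v; the first conflict alone then relates the offsets.
    rigid-kid : ∀ {i i′ c} → blocked false i c ≡ true → blocked true i′ c ≡ true →
      (i′ ≡ suc i × lam v + (i + i) ≡ lam c + 2 × Shape v c false) ⊎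
      (i′ ≡ 3 + i × lam v + (i + i) ≡ lam c × Shape v c true)
    rigid-kid {i} {i′} {c} h h′ with blocked-both {i} {i′} {c} h h′
    ... | _ , _ , j , _ , rigid₁ d s , conf , conf′ = inj₁ (double-injective (ℕ.+-cancelˡ-≡ (lam v) _ _ gap) , base , s)
      where
      open ≡-Reasoning
      e : ∀ l k d → l + (suc k + suc k) + d ≡ l + (k + k) + d + 2
      e = solve-∀
      e′ : ∀ l k → l + (k + k) + 3 ≡ l + 2 + suc (k + k)
      e′ = solve-∀
      base : lam v + (i + i) ≡ lam c + 2
      base = ℕ.+-cancelʳ-≡ (deg c) _ _ (begin
        lam v + (i + i) + deg c          ≡⟨ conf ⟩
        lam c + (j + j) + deg v          ≡⟨ cong (lam c + (j + j) +_) deg≡3 ⟩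
        lam c + (j + j) + 3              ≡⟨ e′ (lam c) j ⟩
        lam c + 2 + suc (j + j)          ≡⟨ cong (lam c + 2 +_) (sym d) ⟩
        lam c + 2 + deg c                ∎)
      gap : lam v + (i′ + i′) ≡ lam v + (suc i + suc i)
      gap = ℕ.+-cancelʳ-≡ (deg c) _ _ (begin
        lam v + (i′ + i′) + deg c             ≡⟨ conf′ ⟩
        lam c + (suc j + suc j) + deg v       ≡⟨ e (lam c) j (deg v) ⟩
        lam c + (j + j) + deg v + 2           ≡⟨ cong (_+ 2) (sym conf) ⟩
        lam v + (i + i) + deg c + 2           ≡⟨ sym (e (lam v) i (deg c)) ⟩
        lam v + (suc i + suc i) + deg c       ∎)
    ... | _ , _ , _ , _ , rigid₃ d s , conf , conf′ = inj₂ (double-injective (ℕ.+-cancelˡ-≡ (lam v) _ _ gap) , base , s)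
      where
      open ≡-Reasoning
      e : ∀ l k d → l + (3 + k + (3 + k)) + d ≡ l + (k + k) + d + 6
      e = solve-∀
      base : lam v + (i + i) ≡ lam c
      base = ℕ.+-cancelʳ-≡ 3 _ _ (begin
        lam v + (i + i) + 3          ≡⟨ cong (lam v + (i + i) +_) (sym d) ⟩
        lam v + (i + i) + deg c      ≡⟨ conf ⟩
        lam c + 0 + deg v            ≡⟨ cong₂ _+_ (ℕ.+-identityʳ (lam c)) deg≡3 ⟩
        lam c + 3                    ∎)
      gap : lam v + (i′ + i′) ≡ lam v + (3 + i + (3 + i))
      gap = ℕ.+-cancelʳ-≡ (deg c) _ _ (begin
        lam v + (i′ + i′) + deg c            ≡⟨ conf′ ⟩
        lam c + (3 + 0 + (3 + 0)) + deg v    ≡⟨ e (lam c) 0 (deg v) ⟩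
        lam c + (0 + 0) + deg v + 6          ≡⟨ cong (_+ 6) (sym conf) ⟩
        lam v + (i + i) + deg c + 6          ≡⟨ sym (e (lam v) i (deg c)) ⟩
        lam v + (3 + i + (3 + i)) + deg c    ∎)

    near : ∀ {c} → pin-false c ≡ # 1 → pin-true c ≡ # 2 → lam c ≡ lam v × Shape v c false
    near {c} e e′ = go (rigid-kid {1} {2} {c} (blocked-at-false 1 e refl (s≤s (s≤s z≤n))) (blocked-at-true 1 e′ refl (s≤s (s≤s z≤n))))
      where
      go : (2 ≡ 2 × lam v + 2 ≡ lam c + 2 × Shape v c false) ⊎ (2 ≡ 4 × lam v + 2 ≡ lam c × Shape v c true) →
        lam c ≡ lam v × Shape v c false
      go (inj₁ (_ , eq , s)) = sym (ℕ.+-cancelʳ-≡ 2 _ _ eq) , s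
      go (inj₂ (() , _))

    far : ∀ {c} → pin-false c ≡ # 0 → pin-true c ≡ # 3 → lam c ≡ lam v × Shape v c true
    far {c} e e′ = go (rigid-kid {0} {3} {c} (blocked-at-false 0 e refl (s≤s z≤n)) (blocked-at-true 2 e′ refl (s≤s (s≤s (s≤s z≤n)))))
      where
      go : (3 ≡ 1 × lam v + 0 ≡ lam c + 2 × Shape v c false) ⊎ (3 ≡ 3 × lam v + 0 ≡ lam c × Shape v c true) →
        lam c ≡ lam v × Shape v c true
      go (inj₁ (() , _))
      go (inj₂ (_ , eq , s)) = trans (sym eq) (ℕ.+-identityʳ (lam v)) , s

    -- By `rigid-kid`, two pins of one kid lie 1 or 3 apart, and within the four positions a
    -- distance of 3 means 0 and 3.
    not-stray : ∀ c → ¬ Analysis.Stray (# 0) (# 0) (# 0) (# 0) (pin-false c) (pin-true c)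
    not-stray c (s≢3 , t≢0 , ¬succ , ¬far) = go (pin-false c) (pin-true c) refl refl
      where
      <3 : (s : Fin 4) → s ≢ # 3 → toℕ s < 3
      <3 zero _                   = s≤s z≤n
      <3 (suc zero) _             = s≤s (s≤s z≤n)
      <3 (suc (suc zero)) _       = s≤s (s≤s (s≤s z≤n))
      <3 (suc (suc (suc zero))) h = contradiction refl h
      go : ∀ s t → pin-false c ≡ s → pin-true c ≡ t → Empty
      go s zero    _ et = t≢0 et
      go s (suc t) es et with rigid-kid {toℕ s} {suc (toℕ t)} {c}
        (blocked-at-false (toℕ s) es refl (<3 s (λ e → s≢3 (trans es e))))
        (blocked-at-true (toℕ t) et refl (Fin.toℕ<n t))
      ... | inj₁ (e , _) = ¬succ (trans (cong toℕ et) (trans e (cong (suc ∘ toℕ) (sym es))))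
      go zero (suc t) es et | inj₂ (e , _) = ¬far (es , trans et (cong suc (Fin.toℕ-injective (ℕ.suc-injective e))))
      go (suc s) (suc t) es et | inj₂ (e , _) = ℕ.<⇒≢ (ℕ.<-≤-trans (Fin.toℕ<n t) (s≤s (s≤s (s≤s z≤n)))) (ℕ.suc-injective e)

    module _ {a b : Fin n} (ka : kid a ≡ true) (kb : kid b ≡ true) (b≢a : b ≢ a) where

      #blocked-ab : ∀ w i → #blocked w i ≡ b2n (blocked w i a) + b2n (blocked w i b)
      #blocked-ab w i = trans (sum-cong-≗ eq) (∑-without₂ kid (b2n ∘ blocked w i) ka kb b≢a k≡2)
        where
        eq : ∀ c → b2n (blocked w i c) ≡ b2n (kid c) * b2n (blocked w i c)
        eq c with blocked w i c in e
        ... | false = sym (ℕ.*-zeroʳ (b2n (kid c)))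
        ... | true  = cong (λ z → b2n z * 1) (sym (blocked⇒kid {w} {i} {c} e))

      open Analysis (pin-false a) (pin-true a) (pin-false b) (pin-true b)

      private
        va : T ⊢ v ~ a
        va = proj₁ (kid⁻ ka)
        vb : T ⊢ v ~ b
        vb = proj₁ (kid⁻ kb)
        a≢p : a ≢ p
        a≢p = proj₂ (kid⁻ ka)
        b≢p : b ≢ p
        b≢p = proj₂ (kid⁻ kb)

      bf : ∀ i → i < 3 → #blocked false i ≡ hits-false i
      bf 0 _ = trans (#blocked-ab false 0) (cong₂ _+_ (proj₁ (pin-false-hit a)) (proj₁ (pin-false-hit b)))
      bf 1 _ = trans (#blocked-ab false 1) (cong₂ _+_ (proj₁ (proj₂ (pin-false-hit a))) (proj₁ (proj₂ (pin-false-hit b))))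
      bf 2 _ = trans (#blocked-ab false 2) (cong₂ _+_ (proj₂ (proj₂ (pin-false-hit a))) (proj₂ (proj₂ (pin-false-hit b))))
      bf (suc (suc (suc _))) (s≤s (s≤s (s≤s ())))

      bt : ∀ i → i < 3 → #blocked true (suc i) ≡ hits-true (suc i)
      bt 0 _ = trans (#blocked-ab true 1) (cong₂ _+_ (proj₁ (pin-true-hit a)) (proj₁ (pin-true-hit b)))
      bt 1 _ = trans (#blocked-ab true 2) (cong₂ _+_ (proj₁ (proj₂ (pin-true-hit a))) (proj₁ (proj₂ (pin-true-hit b))))
      bt 2 _ = trans (#blocked-ab true 3) (cong₂ _+_ (proj₂ (proj₂ (pin-true-hit a))) (proj₂ (proj₂ (pin-true-hit b))))
      bt (suc (suc (suc _))) (s≤s (s≤s (s≤s ())))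

      at : ∀ w s → #blocked false (s + b2n w) ≤ s → s + #blocked true (s + b2n w) ≤ 2 → Ach p v w (s + b2n w)
      at w s lo hi with status w s
      ... | inj₁ r        = r
      ... | inj₂ (inj₁ l) = contradiction lo (ℕ.<⇒≱ l)
      ... | inj₂ (inj₂ h) = contradiction hi (ℕ.<⇒≱ (subst (_< s + #blocked true (s + b2n w)) k≡2 h))

      ≤2 : ∀ w i → #blocked w i ≤ 2
      ≤2 w i = subst (#blocked w i ≤_) k≡2 (#blocked-≤ w i)

      ok₀ : ∀ w → OK₀ (b2n w) → Ach p v w (0 + b2n w)
      ok₀ w h = at w 0 (subst (_≤ 0) (sym (bf (b2n w) (ℕ.≤-trans (s≤s (b2n-≤1 w)) (ℕ.n≤1+n 2)))) h) (≤2 true (b2n w))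

      ok₁ : ∀ w → OK (b2n w) 1 → Ach p v w (1 + b2n w)
      ok₁ w (lo , hi) = at w 1 (subst (_≤ 1) (sym (bf (1 + b2n w) (s≤s (s≤s (b2n-≤1 w))))) lo)
        (subst (λ z → suc z ≤ 2) (sym (bt (b2n w) (ℕ.≤-trans (s≤s (b2n-≤1 w)) (ℕ.n≤1+n 2)))) hi)

      ok₂ : ∀ w → OK₂ (b2n w) → Ach p v w (2 + b2n w)
      ok₂ w h = at w 2 (≤2 false (2 + b2n w)) (subst (λ z → 2 + z ≤ 2) (sym (bt (1 + b2n w) (s≤s (s≤s (b2n-≤1 w))))) h)

      two-of : ∀ w → Pair (b2n w) → Two w
      two-of w (inj₁ (x , y))        = pair w {0} {1} (λ ()) (ok₀ w x) (ok₁ w y)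
      two-of w (inj₂ (inj₁ (x , y))) = pair w {0} {2} (λ ()) (ok₀ w x) (ok₂ w y)
      two-of w (inj₂ (inj₂ (x , y))) = pair w {1} {2} (λ ()) (ok₁ w x) (ok₂ w y)

      private
        odd-deg : odd (deg v) ≡ true
        odd-deg = cong odd deg≡3

        hits≡ : ∀ i {x x′} s s′ → x ≡ s → x′ ≡ s′ → hit i x + hit i x′ ≡ hit i s + hit i s′
        hits≡ i s s′ refl refl = refl

      conclude : Verdict → Outcome p v
      conclude (inj₁ t)        = loose-from odd-deg (some-ach {0} k≡2) (inj₁ (two-of false t))
      conclude (inj₂ (inj₁ t)) = loose-from odd-deg (some-ach {0} k≡2) (inj₂ (two-of true t))
      -- Two kids that behave like leaves block the intermediate counts, which leaves 0 for false
      -- and 3 for true. So v has to be matched with p.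
      conclude (inj₂ (inj₂ (inj₁ ((xa , ya) , xb , yb)))) =
        let la , sa = near xa ya ; lb , sb = near xb yb in
        rigid₃ deg≡3 (inner deg≡3 va vb a≢p b≢p b≢a la lb sa sb)
          (ok₀ false (ℕ.≤-reflexive (hits≡ 0 (# 1) (# 1) xa xb)))
          (ok₂ true (ℕ.≤-reflexive (cong (2 +_) (hits≡ 3 (# 2) (# 2) ya yb))))
      -- One kid of each kind blocks the extreme counts, which leaves 1 for false and 2 for true: v
      -- is matched with the `Far` kid and looks like a leaf from p.
      conclude (inj₂ (inj₂ (inj₂ (inj₁ ((xa , ya) , xb , yb))))) =
        let la , sa = far xa ya ; lb , sb = near xb yb in
        rigid₁ deg≡3 (outer deg≡3 va vb a≢p b≢p b≢a la lb sa sb)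
          (ok₁ false (ℕ.≤-reflexive (hits≡ 1 (# 0) (# 1) xa xb) , ℕ.≤-trans (ℕ.≤-reflexive (cong suc (hits≡ 1 (# 3) (# 2) ya yb))) (s≤s z≤n)))
          (ok₁ true (ℕ.≤-trans (ℕ.≤-reflexive (hits≡ 2 (# 0) (# 1) xa xb)) z≤n , ℕ.≤-reflexive (cong suc (hits≡ 2 (# 3) (# 2) ya yb))))
      conclude (inj₂ (inj₂ (inj₂ (inj₂ (inj₁ ((xa , ya) , xb , yb)))))) =
        let la , sa = near xa ya ; lb , sb = far xb yb in
        rigid₁ deg≡3 (outer deg≡3 vb va b≢p a≢p (b≢a ∘ sym) lb la sb sa)
          (ok₁ false (ℕ.≤-reflexive (hits≡ 1 (# 1) (# 0) xa xb) , ℕ.≤-trans (ℕ.≤-reflexive (cong suc (hits≡ 1 (# 2) (# 3) ya yb))) (s≤s z≤n)))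
          (ok₁ true (ℕ.≤-trans (ℕ.≤-reflexive (hits≡ 2 (# 1) (# 0) xa xb)) z≤n , ℕ.≤-reflexive (cong suc (hits≡ 2 (# 2) (# 3) ya yb))))
      conclude (inj₂ (inj₂ (inj₂ (inj₂ (inj₂ (inj₁ st)))))) = ⊥-elim (not-stray a st)
      conclude (inj₂ (inj₂ (inj₂ (inj₂ (inj₂ (inj₂ st)))))) = ⊥-elim (not-stray b st)

    two-kids-outcome : Outcome p v
    two-kids-outcome with count-suc kid k≡2
    ... | a , ka , c≡1 with count-suc (kid without a) c≡1
    ... | b , kb , _ = let kb′ , b≢a = without⁻ kid kb in
      conclude ka kb′ b≢a (verdict (pin-false a) (pin-true a) (pin-false b) (pin-true b))

  outcome-of-kids : ∀ {p v} → T ⊢ p ~ v → (∀ c → (adj v without p) c ≡ true → Outcome v c) → Outcome p v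
  outcome-of-kids {p} {v} pv outcome = go (odd (deg v)) refl
    where
    open Kids pv outcome
    many : ∀ m → count kid ≡ m + m → odd (deg v) ≡ true → Outcome p v
    many 0             k≡ _ = leaf-outcome k≡
    many 1             k≡ _ = TwoKids.two-kids-outcome pv outcome k≡
    many (suc (suc q)) k≡ d = loose-from d (some-ach {suc q} k≡) (Many.two-some q k≡)
    go : ∀ b → odd (deg v) ≡ b → Outcome p v
    go false e = even-free e
    go true  e with halve (count kid) (Bool.not-injective (trans (cong odd (sym deg-v)) e))
    ... | m , k≡ = many m k≡ e

  resolve : ∀ {p v} → T ⊢ p ~ v → Outcome p v
  resolve {p} {v} pv = go pv (<-wellFounded _)
    where
    go : ∀ {p v} → T ⊢ p ~ v → Acc _<_ (side-size p v) → Outcome p v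
    go {p} {v} pv (acc rs) = outcome-of-kids pv λ c kc → let vc , c≢p = without⁻ (adj v) kc in
      go (lookup⇒∈ vc) (rs (kid-size< pv (lookup⇒∈ vc) c≢p))

-- Leaves

module Leaves (T : Graph n) (tree : IsTree T) where
  open IsTree tree
  open Tree T tree

  leaf-beyond : ∀ {p v} → T ⊢ p ~ v → ∃[ x ] ∃[ u ] (T ⊢ x ~ u × count (adj x) ≡ 1)
  leaf-beyond {p} {v} pv = go pv (<-wellFounded _)
    where
    go : ∀ {p v} → T ⊢ p ~ v → Acc _<_ (side-size p v) → ∃[ x ] ∃[ u ] (T ⊢ x ~ u × count (adj x) ≡ 1)
    go {p} {v} pv (acc rs) with count (adj v without p) in eq
    ... | 0     = v , p , ~-sym pv , trans (count-without (adj v) (∈⇒lookup (~-sym pv))) (cong suc eq)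
    ... | suc k with count-suc (adj v without p) eq
    ... | c , kc , _ with without⁻ (adj v) kc
    ... | vc , c≢p = go (lookup⇒∈ vc) (rs (kid-size< pv (lookup⇒∈ vc) c≢p))

  no-edge-or-leaf : (∀ {x y} → ¬ (T ⊢ x ~ y)) ⊎ (∃[ x ] ∃[ u ] (T ⊢ x ~ u × count (adj x) ≡ 1))
  no-edge-or-leaf with nonempty
  ... | r , r∈ with Fin.any? (λ v → T ⊢ r ~? v)
  ... | yes (v , rv) = inj₂ (leaf-beyond rv)
  ... | no none      = inj₁ λ xy → case connected r∈ (~⇒Vˡ xy) of λ
    { nil → none (_ , xy) ; (e ◅ _) → none (_ , e) }

  leaf-neighbour : ∀ {x u} → T ⊢ x ~ u → count (adj x) ≡ 1 → ∀ {c} → T ⊢ x ~ c → c ≡ u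
  leaf-neighbour {x} xu d xc = count-1 (adj x) (∈⇒lookup xu) d (∈⇒lookup xc)

  leaf-cover : ∀ {x u} → T ⊢ x ~ u → count (adj x) ≡ 1 → ∀ {y} → y ∈ V T → y ≡ x ⊎ y ∈ side T x u
  leaf-cover {x} {u} xu d y∈ with side-cover xu y∈
  ... | inj₁ y∈xu = inj₂ y∈xu
  ... | inj₂ y∈ux with side-decompose (~-sym xu) y∈ux
  ... | inj₁ y≡x                = inj₁ y≡x
  ... | inj₂ (c , xc , c≢u , _) = contradiction (leaf-neighbour xu d xc) c≢u

  module _ {v a b c d : Fin n} (deg≡3 : count (adj v) ≡ 3) (va : T ⊢ v ~ a) (vb : T ⊢ v ~ b) (vc : T ⊢ v ~ c)
    (b≢a : b ≢ a) (c≢a : c ≢ a) (c≢b : c ≢ b) where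

    private
      f′b : (adj v without a) b ≡ true
      f′b = trans (without-≢ (adj v) b≢a) (∈⇒lookup vb)
      f″c : ((adj v without a) without b) c ≡ true
      f″c = trans (without-≢ (adj v without a) c≢b) (trans (without-≢ (adj v) c≢a) (∈⇒lookup vc))
      one-left : count ((adj v without a) without b) ≡ 1
      one-left = ℕ.suc-injective (trans (sym (count-without (adj v without a) f′b))
        (ℕ.suc-injective (trans (sym (count-without (adj v) (∈⇒lookup va))) deg≡3)))

    three-neighbours : T ⊢ v ~ d → d ≡ a ⊎ d ≡ b ⊎ d ≡ c
    three-neighbours vd with d Fin.≟ a | d Fin.≟ b
    ... | yes d≡a | _       = inj₁ d≡a
    ... | _       | yes d≡b = inj₂ (inj₁ d≡b)
    ... | no d≢a  | no d≢b  = inj₂ (inj₂ (count-1 ((adj v without a) without b) f″c one-left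
      (trans (without-≢ (adj v without a) d≢b) (trans (without-≢ (adj v) d≢a) (∈⇒lookup vd)))))

-- Vertices of degree 3 and perfect matchings from involutions

module _ (T : Graph n) where

  D₃-vertex⁺ : ∀ {x} → x ∈ V T → degree T x ≡ 3 → x ∈ V (D₃ T)
  D₃-vertex⁺ x∈ d = x∈p∩q⁺ (x∈ , ∈⟪⟫⁺ (λ v → degree T v ℕ.≟ 3) d)

  D₃-vertex⁻ : ∀ {x} → x ∈ V (D₃ T) → x ∈ V T × degree T x ≡ 3
  D₃-vertex⁻ x∈ = let x∈V , x∈S = x∈p∩q⁻ _ _ x∈ in x∈V , ∈⟪⟫⁻ (λ v → degree T v ℕ.≟ 3) x∈S

  induced⁺ : ∀ {S x y} → T ⊢ x ~ y → x ∈ S → y ∈ S → induced T S ⊢ x ~ y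
  induced⁺ {S} {x} xy x∈ y∈ = ∈⟪⟫⁺ (λ v → (T ⊢ x ~? v) ×-dec (x ∈? S) ×-dec (v ∈? S)) (xy , x∈ , y∈)

  induced⁻ : ∀ {S x y} → induced T S ⊢ x ~ y → T ⊢ x ~ y × x ∈ S × y ∈ S
  induced⁻ {S} {x} = ∈⟪⟫⁻ (λ v → (T ⊢ x ~? v) ×-dec (x ∈? S) ×-dec (v ∈? S))

  D₃-edge⁺ : ∀ {x y} → T ⊢ x ~ y → degree T x ≡ 3 → degree T y ≡ 3 → D₃ T ⊢ x ~ y
  D₃-edge⁺ xy dx dy = induced⁺ xy (∈⟪⟫⁺ (λ v → degree T v ℕ.≟ 3) dx) (∈⟪⟫⁺ (λ v → degree T v ℕ.≟ 3) dy)

  D₃-edge⁻ : ∀ {x y} → D₃ T ⊢ x ~ y → T ⊢ x ~ y × degree T x ≡ 3 × degree T y ≡ 3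
  D₃-edge⁻ e = let xy , x∈ , y∈ = induced⁻ e in
    xy , ∈⟪⟫⁻ (λ v → degree T v ℕ.≟ 3) x∈ , ∈⟪⟫⁻ (λ v → degree T v ℕ.≟ 3) y∈

  degree≡count : ∀ x → degree T x ≡ count (lookup (N T x))
  degree≡count x = ∣∣≡count (N T x)

  -- The edges are the pairs that `f` exchanges; asking for both directions makes the relation
  -- symmetric even where `f` is arbitrary, off the vertices of degree 3.
  involution⇒matching : (f : Fin n → Fin n) →
    (∀ {x} → x ∈ V T → degree T x ≡ 3 → T ⊢ x ~ f x × degree T (f x) ≡ 3 × f (f x) ≡ x) → PerfectMatching (D₃ T)
  involution⇒matching f partner = record
    { M = M ; V-M = refl ; M⊆G = λ {u} e → proj₁ (M⁻ {u} e) ; saturated = λ {x} → saturated {x} }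
    where
    Mutual : Fin n → Fin n → Set
    Mutual x y = f x ≡ y × f y ≡ x
    mutual? : ∀ x y → Dec (Mutual x y)
    mutual? x y = (f x Fin.≟ y) ×-dec (f y Fin.≟ x)
    M : Graph n
    M = spanning (D₃ T) mutual? (λ (p , q) → q , p)
    M⁻ : ∀ {x y} → M ⊢ x ~ y → D₃ T ⊢ x ~ y × Mutual x y
    M⁻ {x} = ∈⟪⟫⁻ (λ y → (D₃ T ⊢ x ~? y) ×-dec mutual? x y)
    M⁺ : ∀ {x y} → D₃ T ⊢ x ~ y → Mutual x y → M ⊢ x ~ y
    M⁺ {x} e m = ∈⟪⟫⁺ (λ y → (D₃ T ⊢ x ~? y) ×-dec mutual? x y) (e , m)
    saturated : ∀ {x} → x ∈ V (D₃ T) → degree M x ≡ 1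
    saturated {x} x∈ = let x∈V , dx = D₃-vertex⁻ x∈ ; xfx , dfx , ffx = partner x∈V dx in
      trans (∣∣≡count (N M x)) (trans
        (∑-single (f x) {b2n ∘ lookup (N M x)} λ y y≢fx → cong b2n (∉⇒lookup λ e → y≢fx (sym (proj₁ (proj₂ (M⁻ {x} e))))))
        (cong b2n (∈⇒lookup (M⁺ (D₃-edge⁺ xfx dx dfx) (refl , ffx)))))

-- From shapes to members of 𝒞 with constant offset

module SignedTheorem (T : Graph n) (tree : IsTree T) (lam : Fin n → ℕ)
  (lam-parity : ∀ {x y} → T ⊢ x ~ y → odd (lam x) ≡ odd (lam y)) where

  open IsTree tree
  open Tree T tree
  open Signed T tree lam lam-parity
  open SignedStep T tree lam lam-parity
  open Leaves T tree

  fork-side : ∀ {p v a b} → T ⊢ p ~ v → deg v ≡ 3 → T ⊢ v ~ a → T ⊢ v ~ b → a ≢ p → b ≢ p → b ≢ a →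
    ∀ {x} → x ∈ side T p v → x ≡ v ⊎ x ∈ side T v a ⊎ x ∈ side T v b
  fork-side {p} {v} {a} {b} pv d va vb a≢p b≢p b≢a x∈ with side-decompose pv x∈
  ... | inj₁ x≡v = inj₁ x≡v
  ... | inj₂ (c , vc , c≢p , x∈c) with three-neighbours d (~-sym pv) va vb a≢p b≢p b≢a vc
  ... | inj₁ c≡p         = contradiction c≡p c≢p
  ... | inj₂ (inj₁ refl) = inj₂ (inj₁ x∈c)
  ... | inj₂ (inj₂ refl) = inj₂ (inj₂ x∈c)

  leaf-side : ∀ {p v} → T ⊢ p ~ v → deg v ≡ 1 → ∀ {x} → x ∈ side T p v → x ≡ v
  leaf-side pv d x∈ with side-decompose pv x∈
  ... | inj₁ x≡v                = x≡v
  ... | inj₂ (c , vc , c≢p , _) = contradiction (leaf-neighbour (~-sym pv) d vc) c≢p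

  Regular : Fin n → ℕ → Set
  Regular x k = (deg x ≡ 1 ⊎ deg x ≡ 3) × lam x ≡ k

  shape-regular : ∀ {p v b} → T ⊢ p ~ v → Shape p v b → ∀ {x} → x ∈ side T p v → Regular x (lam v)
  shape-regular-fork : ∀ {p v a b s t} → T ⊢ p ~ v → deg v ≡ 3 → T ⊢ v ~ a → T ⊢ v ~ b → a ≢ p → b ≢ p → b ≢ a →
    lam a ≡ lam v → lam b ≡ lam v → Shape v a s → Shape v b t → ∀ {x} → x ∈ side T p v → Regular x (lam v)
  shape-regular pv (leaf d) x∈ with leaf-side pv d x∈
  ... | refl = inj₁ d , refl
  shape-regular pv (outer d va vb a≢p b≢p b≢a la lb s t) = shape-regular-fork pv d va vb a≢p b≢p b≢a la lb s t
  shape-regular pv (inner d va vb a≢p b≢p b≢a la lb s t) = shape-regular-fork pv d va vb a≢p b≢p b≢a la lb s t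
  shape-regular-fork pv d va vb a≢p b≢p b≢a la lb s t x∈ with fork-side pv d va vb a≢p b≢p b≢a x∈
  ... | inj₁ refl       = inj₂ d , refl
  ... | inj₂ (inj₁ x∈a) = let r , e = shape-regular va s x∈a in r , trans e la
  ... | inj₂ (inj₂ x∈b) = let r , e = shape-regular vb t x∈b in r , trans e lb

  Matched : (Fin n → Fin n) → Fin n → Fin n → Fin n → Set
  Matched f p v x = f x ∈ side T p v × T ⊢ x ~ f x × deg (f x) ≡ 3 × f (f x) ≡ x

  -- A partner map on the side of v at pv; when pv is in the matching, v is matched with p outside its side.
  record Partner (p v : Fin n) (b : Bool) : Set where
    field
      f       : Fin n → Fin n
      top     : b ≡ true → f v ≡ p
      matched : ∀ {x} → x ∈ side T p v → deg x ≡ 3 → (b ≡ true × x ≡ v) ⊎ Matched f p v x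

  shape-deg : ∀ {p v} → Shape p v true → deg v ≡ 3
  shape-deg (inner d _ _ _ _ _ _ _ _ _) = d

  module Join {p v a b : Fin n} (pv : T ⊢ p ~ v) (va : T ⊢ v ~ a) (vb : T ⊢ v ~ b) (a≢p : a ≢ p) (b≢p : b ≢ p)
    (b≢a : b ≢ a) (w : Fin n) (g h : Fin n → Fin n) where

    f : Fin n → Fin n
    f x = if does (x Fin.≟ v) then w else if in-side v a x then g x else h x

    f-v : f v ≡ w
    f-v = cong (λ c → if c then w else if in-side v a v then g v else h v) (dec-true (v Fin.≟ v) refl)

    f-a : ∀ {x} → x ∈ side T v a → f x ≡ g x
    f-a {x} x∈ = trans
      (cong (λ c → if c then w else if in-side v a x then g x else h x) (dec-false (x Fin.≟ v) λ { refl → bridge va x∈ }))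
      (cong (λ c → if c then g x else h x) (∈⇒lookup x∈))

    f-b : ∀ {x} → x ∈ side T v b → f x ≡ h x
    f-b {x} x∈ = trans
      (cong (λ c → if c then w else if in-side v a x then g x else h x) (dec-false (x Fin.≟ v) λ { refl → bridge vb x∈ }))
      (cong (λ c → if c then g x else h x) (∉⇒lookup {S = side T v a} λ x∈a → b≢a (sym (branch-unique va vb x∈a x∈))))

    matched-a : ∀ {x} → x ∈ side T v a → Matched g v a x → Matched f p v x
    matched-a {x} x∈ (gx∈ , e , d , gg) =
      subst (_∈ side T p v) (sym (f-a x∈)) (kid-side⊆ pv va a≢p gx∈) , subst (T ⊢ x ~_) (sym (f-a x∈)) e ,
      trans (cong deg (f-a x∈)) d , trans (cong f (f-a x∈)) (trans (f-a gx∈) gg)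

    matched-b : ∀ {x} → x ∈ side T v b → Matched h v b x → Matched f p v x
    matched-b {x} x∈ (hx∈ , e , d , hh) =
      subst (_∈ side T p v) (sym (f-b x∈)) (kid-side⊆ pv vb b≢p hx∈) , subst (T ⊢ x ~_) (sym (f-b x∈)) e ,
      trans (cong deg (f-b x∈)) d , trans (cong f (f-b x∈)) (trans (f-b hx∈) hh)

  -- An outer vertex is matched with its kid `a`, which the partner map of the side of `a` reserves
  -- for its parent; an inner vertex is itself reserved for p.
  shape-partner : ∀ {p v b} → T ⊢ p ~ v → Shape p v b → Partner p v b
  shape-partner {p} {v} pv (leaf d) = record { f = λ x → x ; top = λ () ; matched = λ x∈ d′ → case leaf-side pv d x∈ of λ
    { refl → contradiction (trans (sym d) d′) λ () } }
  shape-partner {p} {v} pv (outer {a = a} {b = b} d va vb a≢p b≢p b≢a la lb s t) =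
    record { f = f ; top = λ () ; matched = ok }
    where
    module A = Partner (shape-partner va s)
    module B = Partner (shape-partner vb t)
    open Join pv va vb a≢p b≢p b≢a a A.f B.f
    f-a≡v : f a ≡ v
    f-a≡v = trans (f-a side-self) (A.top refl)
    ok : ∀ {x} → x ∈ side T p v → deg x ≡ 3 → (false ≡ true × x ≡ v) ⊎ Matched f p v x
    ok {x} x∈ dx with fork-side pv d va vb a≢p b≢p b≢a x∈
    ... | inj₁ refl = inj₂
      ( subst (_∈ side T p v) (sym f-v) (kid-side⊆ pv va a≢p side-self) , subst (T ⊢ v ~_) (sym f-v) va
      , trans (cong deg f-v) (shape-deg s) , trans (cong f f-v) f-a≡v)
    ... | inj₂ (inj₁ x∈a) with A.matched x∈a dx
    ...   | inj₂ m          = inj₂ (matched-a x∈a m)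
    ...   | inj₁ (_ , refl) = inj₂
      ( subst (_∈ side T p v) (sym f-a≡v) side-self , subst (T ⊢ x ~_) (sym f-a≡v) (~-sym va)
      , trans (cong deg f-a≡v) d , trans (cong f f-a≡v) f-v)
    ok {x} x∈ dx | inj₂ (inj₂ x∈b) with B.matched x∈b dx
    ...   | inj₂ m = inj₂ (matched-b x∈b m)
  shape-partner {p} {v} pv (inner {a = a} {b = b} d va vb a≢p b≢p b≢a la lb s t) =
    record { f = f ; top = λ _ → f-v ; matched = ok }
    where
    module A = Partner (shape-partner va s)
    module B = Partner (shape-partner vb t)
    open Join pv va vb a≢p b≢p b≢a p A.f B.f
    ok : ∀ {x} → x ∈ side T p v → deg x ≡ 3 → (true ≡ true × x ≡ v) ⊎ Matched f p v x
    ok {x} x∈ dx with fork-side pv d va vb a≢p b≢p b≢a x∈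
    ... | inj₁ refl = inj₁ (refl , refl)
    ... | inj₂ (inj₁ x∈a) with A.matched x∈a dx
    ...   | inj₂ m = inj₂ (matched-a x∈a m)
    ok {x} x∈ dx | inj₂ (inj₂ x∈b) with B.matched x∈b dx
    ...   | inj₂ m = inj₂ (matched-b x∈b m)

  Constant : Set
  Constant = ∀ {x y} → x ∈ V T → y ∈ V T → lam x ≡ lam y

  deg≡degree : ∀ x → degree T x ≡ deg x
  deg≡degree = degree≡count T

  shape⇒𝒞 : ∀ {x u} → T ⊢ x ~ u → deg x ≡ 1 → lam x ≡ lam u → Shape x u false → 𝒞 T × Constant
  shape⇒𝒞 {x} {u} xu d le s = record
      { isTree = tree
      ; degrees = λ {y} y∈ → [ (λ e → inj₁ (trans (deg≡degree y) e)) , (λ e → inj₂ (trans (deg≡degree y) e)) ]′ (proj₁ (regular y∈))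
      ; matching = involution⇒matching T f partner }
    , λ y∈ z∈ → trans (proj₂ (regular y∈)) (sym (proj₂ (regular z∈)))
    where
    open Partner (shape-partner xu s)
    regular : ∀ {y} → y ∈ V T → Regular y (lam u)
    regular y∈ with leaf-cover xu d y∈
    ... | inj₁ refl = inj₁ d , le
    ... | inj₂ y∈u  = shape-regular xu s y∈u
    partner : ∀ {y} → y ∈ V T → degree T y ≡ 3 → T ⊢ y ~ f y × degree T (f y) ≡ 3 × f (f y) ≡ y
    partner {y} y∈ dy with leaf-cover xu d y∈
    ... | inj₁ refl = contradiction (trans (sym d) (trans (sym (deg≡degree y)) dy)) λ ()
    ... | inj₂ y∈u with matched y∈u (trans (sym (deg≡degree y)) dy)
    ... | inj₂ (_ , e , d′ , ff) = e , trans (deg≡degree (f y)) d′ , ff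

  -- The tree is rooted at a leaf x, whose value is `lam x` ∓ 1. A neighbour of kind `rigid₁`
  -- conflicts with this exactly if the offsets agree, and then the whole tree is a member of 𝒞.
  signed-theorem : Solution ⊎ (𝒞 T × Constant)
  signed-theorem with no-edge-or-leaf
  ... | inj₁ none = inj₁ (edgeless-solution none)
  ... | inj₂ (x , u , xu , d) = go (resolve xu)
    where
    open ≡-Reasoning
    Conf? : ∀ k i → Dec (Conf x k u i)
    Conf? k i = lam x + (k + k) + deg u ℕ.≟ lam u + (i + i) + deg x
    e₁ : ∀ l i → l + 0 + suc (i + i) ≡ l + (i + i) + 1
    e₁ = solve-∀
    go : Outcome x u → Solution ⊎ (𝒞 T × Constant)
    go (free f) = let _ , _ , i≢j , a , b = f false in
      inj₁ (solve-at-leaf xu d false (two⇒compatible {k = 0} i≢j a b))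
    go (loose _ o (w , e)) with o w
    ... | two i≢j a b = inj₁ (solve-at-leaf xu d w (two⇒compatible {k = b2n w} i≢j a b))
    go (rigid₁ {i} d′ s a b) with Conf? 0 i
    ... | no nc    = inj₁ (solve-at-leaf xu d false (i , a , nc))
    ... | yes conf = inj₂ (shape⇒𝒞 xu d (ℕ.+-cancelʳ-≡ ((i + i) + 1) _ _ (begin
      lam x + ((i + i) + 1)      ≡⟨ sym (ℕ.+-assoc (lam x) (i + i) 1) ⟩
      lam x + (i + i) + 1        ≡⟨ sym (e₁ (lam x) i) ⟩
      lam x + 0 + suc (i + i)    ≡⟨ cong (lam x + 0 +_) (sym d′) ⟩
      lam x + 0 + deg u          ≡⟨ conf ⟩
      lam u + (i + i) + deg x    ≡⟨ cong (lam u + (i + i) +_) d ⟩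
      lam u + (i + i) + 1        ≡⟨ ℕ.+-assoc (lam u) (i + i) 1 ⟩
      lam u + ((i + i) + 1)      ∎)) s)
    go (rigid₃ d′ s a b) with Conf? 0 0 | Conf? 1 3
    ... | no nc    | _         = inj₁ (solve-at-leaf xu d false (0 , a , nc))
    ... | yes _    | no nc     = inj₁ (solve-at-leaf xu d true (3 , b , nc))
    -- The conflict for false puts `lam x` at `lam u − 2`, the one for true at `lam u + 2`.
    ... | yes conf | yes conf′ = contradiction (ℕ.+-cancelˡ-≡ (lam x) 5 9 (begin
      lam x + 5                    ≡⟨ sym (ℕ.+-assoc (lam x) 2 3) ⟩
      lam x + 2 + 3                ≡⟨ cong (lam x + 2 +_) (sym d′) ⟩
      lam x + 2 + deg u            ≡⟨ conf′ ⟩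
      lam u + 6 + deg x            ≡⟨ cong (lam u + 6 +_) d ⟩
      lam u + 6 + 1                ≡⟨ e₂ (lam u) ⟩
      lam u + 0 + 1 + 6            ≡⟨ cong (λ z → lam u + 0 + z + 6) (sym d) ⟩
      lam u + 0 + deg x + 6        ≡⟨ cong (_+ 6) (sym conf) ⟩
      lam x + 0 + deg u + 6        ≡⟨ cong (λ z → lam x + 0 + z + 6) d′ ⟩
      lam x + 0 + 3 + 6            ≡⟨ e₃ (lam x) ⟩
      lam x + 9                    ∎)) λ ()
      where
      e₂ : ∀ l → l + 6 + 1 ≡ l + 0 + 1 + 6
      e₂ = solve-∀
      e₃ : ∀ l → l + 0 + 3 + 6 ≡ l + 9
      e₃ = solve-∀

-- The obstruction given by members of 𝒞

module Obstruction (H : Graph n) (h : 𝒞 H) where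
  open 𝒞 h
  open IsTree isTree
  open Tree H isTree
  open Leaves H isTree
  open Signed H isTree (λ _ → 0) (λ _ → refl)
  open PerfectMatching matching

  private
    deg≡degree : ∀ x → degree H x ≡ deg x
    deg≡degree = degree≡count H

    M-deg : ∀ {x y} → M ⊢ x ~ y → H ⊢ x ~ y × deg x ≡ 3 × deg y ≡ 3
    M-deg {x} {y} e = let xy , dx , dy = D₃-edge⁻ H (M⊆G e) in
      xy , trans (sym (deg≡degree x)) dx , trans (sym (deg≡degree y)) dy

    M-count : ∀ {x} → x ∈ V H → deg x ≡ 3 → count (lookup (N M x)) ≡ 1
    M-count {x} x∈ d = trans (sym (∣∣≡count (N M x))) (saturated (D₃-vertex⁺ H x∈ (trans (deg≡degree x) d)))

    M-unique : ∀ {x y z} → M ⊢ x ~ y → M ⊢ x ~ z → z ≡ y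
    M-unique {x} e e′ = let xy , dx , _ = M-deg e in
      count-1 (lookup (N M x)) (∈⇒lookup e) (M-count (~⇒Vˡ xy) dx) (∈⇒lookup e′)

    M-partner : ∀ {x} → x ∈ V H → deg x ≡ 3 → ∃[ y ] M ⊢ x ~ y
    M-partner {x} x∈ d = let y , e = count-witness (lookup (N M x)) (ℕ.≤-reflexive (sym (M-count x∈ d))) in y , lookup⇒∈ e

    -- `k` is the count at a vertex whose edges to the parent and the two kids are labelled `w`,
    -- `a`, `b`. Unmatched kids look like leaves, and avoiding their values forces all three labels
    -- to agree.
    inner-value : ∀ w a b → let k = b2n w + (b2n a + b2n b) in k ≢ suc (b2n a) → k ≢ suc (b2n b) → k ≡ 3 * b2n w
    inner-value true  true  true  _ _ = refl
    inner-value true  true  false h _ = ⊥-elim (h refl)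
    inner-value true  false true  _ h = ⊥-elim (h refl)
    inner-value true  false false h _ = ⊥-elim (h refl)
    inner-value false true  true  h _ = ⊥-elim (h refl)
    inner-value false true  false _ h = ⊥-elim (h refl)
    inner-value false false true  h _ = ⊥-elim (h refl)
    inner-value false false false _ _ = refl

    outer-value : ∀ w a b → let k = b2n w + (b2n a + b2n b) in k ≢ 3 * b2n a → k ≢ suc (b2n b) → k ≡ suc (b2n w)
    outer-value true  true  true  h _ = ⊥-elim (h refl)
    outer-value true  true  false _ _ = refl
    outer-value true  false true  _ h = ⊥-elim (h refl)
    outer-value true  false false _ h = ⊥-elim (h refl)
    outer-value false true  true  _ h = ⊥-elim (h refl)
    outer-value false true  false _ h = ⊥-elim (h refl)
    outer-value false false true  _ _ = refl
    outer-value false false false h _ = ⊥-elim (h refl)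

  module _ (s : Solution) where
    open Solution s

    private
      F : Fin n → Fin n → Bool
      F = label

      val : Fin n → ℕ
      val = cnt F

    val-split : ∀ {v p} → H ⊢ v ~ p → val v ≡ b2n (F v p) + ∑ (λ y → b2n ((adj v without p) y) * b2n (F v y))
    val-split {v} vp = trans (sum-cong-≗ λ y → b2n-∧ (adj v y) (F v y)) (∑-without (adj v) (b2n ∘ F v) (∈⇒lookup vp))

    -- The invariant of every proper labelling: if v is matched with p, its three edges have one
    -- label; otherwise its signed value `2 val v − deg v` is 1 or -1 according to the label of vp.
    Planted : Fin n → Fin n → Set
    Planted p v = (M ⊢ v ~ p → val v ≡ 3 * b2n (F v p)) ×
      (¬ (M ⊢ v ~ p) → val v + val v + 1 ≡ deg v + (b2n (F v p) + b2n (F v p)))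

    unmatched-kid : ∀ {v c} → deg v ≡ 3 → H ⊢ v ~ c → Planted v c → ¬ (M ⊢ v ~ c) → val v ≢ suc (b2n (F v c))
    unmatched-kid {v} {c} d vc (_ , claim) ¬m e = proper vc (begin
      val v + val v + deg c                ≡⟨ cong (λ k → k + k + deg c) e ⟩
      suc f + suc f + deg c            ≡⟨ r₁ f (deg c) ⟩
      deg c + (f + f) + 2              ≡⟨ cong (λ b → deg c + (b2n b + b2n b) + 2) (label-sym vc) ⟩
      deg c + (f′ + f′) + 2            ≡⟨ cong (_+ 2) (sym (claim (¬m ∘ N-sym M))) ⟩
      val c + val c + 1 + 2                ≡⟨ ℕ.+-assoc (val c + val c) 1 2 ⟩
      val c + val c + 3                    ≡⟨ cong (val c + val c +_) (sym d) ⟩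
      val c + val c + deg v                ∎)
      where
      open ≡-Reasoning
      f f′ : ℕ
      f  = b2n (F v c)
      f′ = b2n (F c v)
      r₁ : ∀ x d → suc x + suc x + d ≡ d + (x + x) + 2
      r₁ = solve-∀

    matched-kid : ∀ {v c} → H ⊢ v ~ c → Planted v c → M ⊢ v ~ c → val v ≢ 3 * b2n (F v c)
    matched-kid {v} {c} vc (claim , _) m e = let _ , dv , dc = M-deg m in proper vc
      (cong₂ (λ k d → k + k + d) (trans e (trans (cong (λ b → 3 * b2n b) (label-sym vc)) (sym (claim (N-sym M m)))))
        (trans dc (sym dv)))

    planted : ∀ {p v} → H ⊢ p ~ v → Planted p v
    planted {p} {v} pv = go pv (<-wellFounded _)
      where
      go : ∀ {p v} → H ⊢ p ~ v → Acc _<_ (side-size p v) → Planted p v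
      go {p} {v} pv (acc rs) with degrees (~⇒Vʳ pv)
      ... | inj₁ d = (λ m → contradiction (trans (sym (trans (sym (deg≡degree v)) d)) (proj₁ (proj₂ (M-deg m)))) λ ())
        , λ _ → trans (cong (λ k → k + k + 1) valv) (trans (ℕ.+-comm (b2n (F v p) + b2n (F v p)) 1) (cong (_+ (b2n (F v p) + b2n (F v p))) (sym dv)))
        where
        dv : deg v ≡ 1
        dv = trans (sym (deg≡degree v)) d
        none : count (adj v without p) ≡ 0
        none = ℕ.suc-injective (trans (sym (count-without (adj v) (∈⇒lookup (~-sym pv)))) dv)
        valv : val v ≡ b2n (F v p)
        valv = trans (val-split (~-sym pv)) (trans (cong (b2n (F v p) +_)
          (∑-zero λ y → cong (λ b → b2n b * b2n (F v y)) (count-zero (adj v without p) none y))) (ℕ.+-identityʳ _))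
      ... | inj₂ d = matched-case , unmatched-case
        where
        K : Fin n → Bool
        K = adj v without p
        dv : deg v ≡ 3
        dv = trans (sym (deg≡degree v)) d
        two-kids : count K ≡ 2
        two-kids = ℕ.suc-injective (trans (sym (count-without (adj v) (∈⇒lookup (~-sym pv)))) dv)
        kid-planted : ∀ {c} → K c ≡ true → H ⊢ v ~ c × c ≢ p × Planted v c
        kid-planted kc = let vc , c≢p = without⁻ (adj v) kc in
          lookup⇒∈ vc , c≢p , go (lookup⇒∈ vc) (rs (kid-size< pv (lookup⇒∈ vc) c≢p))
        valv : ∀ {a b} → K a ≡ true → K b ≡ true → b ≢ a → val v ≡ b2n (F v p) + (b2n (F v a) + b2n (F v b))
        valv ka kb b≢a = trans (val-split (~-sym pv)) (cong (b2n (F v p) +_) (∑-without₂ K (b2n ∘ F v) ka kb b≢a two-kids))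
        other : ∀ {a} → K a ≡ true → ∃[ b ] (K b ≡ true × b ≢ a)
        other ka = let b , kb , _ = count-suc (K without _) (ℕ.suc-injective (trans (sym (count-without K ka)) two-kids))
                   in b , without⁻ K kb
        matched-case : M ⊢ v ~ p → val v ≡ 3 * b2n (F v p)
        matched-case m with count-suc K two-kids
        ... | a , ka , _ with other ka
        ... | b , kb , b≢a = let va , a≢p , pa = kid-planted ka ; vb , b≢p , pb = kid-planted kb ; e = valv ka kb b≢a in
          trans e (inner-value (F v p) (F v a) (F v b)
            (unmatched-kid dv va pa (λ m′ → a≢p (M-unique m m′)) ∘ trans e)
            (unmatched-kid dv vb pb (λ m′ → b≢p (M-unique m m′)) ∘ trans e))
        unmatched-case : ¬ (M ⊢ v ~ p) → val v + val v + 1 ≡ deg v + (b2n (F v p) + b2n (F v p))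
        unmatched-case ¬m with M-partner (~⇒Vʳ pv) dv
        ... | a , m = finish (other ka)
          where
          va : H ⊢ v ~ a
          va = proj₁ (M-deg m)
          ka : K a ≡ true
          ka = trans (without-≢ (adj v) λ { refl → ¬m m }) (∈⇒lookup va)
          r : ∀ x → suc x + suc x + 1 ≡ 3 + (x + x)
          r = solve-∀
          finish : ∃[ b ] (K b ≡ true × b ≢ a) → val v + val v + 1 ≡ deg v + (b2n (F v p) + b2n (F v p))
          finish (b , kb , b≢a) = let _ , _ , pa = kid-planted ka ; vb , _ , pb = kid-planted kb ; e = valv ka kb b≢a in
            trans (cong (λ k → k + k + 1) (trans e (outer-value (F v p) (F v a) (F v b)
              (matched-kid va pa m ∘ trans e) (unmatched-kid dv vb pb (λ m′ → b≢a (M-unique m m′)) ∘ trans e))))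
            (trans (r (b2n (F v p))) (cong (_+ (b2n (F v p) + b2n (F v p))) (sym dv)))

    -- At a leaf x with neighbour u, the edge xu is not in the matching, so x and u both have signed
    -- value ±1, with the sign given by the label of xu.
    no-solution : Empty
    no-solution with no-edge-or-leaf
    ... | inj₁ none = [ contradiction d≡0 ∘ absurd , contradiction d≡0 ∘ absurd ]′ (degrees (proj₂ nonempty))
      where
      d≡0 : degree H (proj₁ nonempty) ≡ 0
      d≡0 = trans (deg≡degree _) (count-false λ y → ∉⇒lookup {S = N H (proj₁ nonempty)} {y} none)
      absurd : ∀ {k j} → k ≡ suc j → k ≢ 0
      absurd refl ()
    ... | inj₂ (x , u , xu , d) = proper xu (begin
      val x + val x + deg u                ≡⟨ cong (λ k → k + k + deg u) valx ⟩
      f + f + deg u                    ≡⟨ ℕ.+-comm (f + f) (deg u) ⟩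
      deg u + (f + f)                  ≡⟨ cong (λ b → deg u + (b2n b + b2n b)) (label-sym xu) ⟩
      deg u + (b2n (F u x) + b2n (F u x)) ≡⟨ sym (proj₂ (planted xu) λ m → contradiction (trans (sym d) (proj₂ (proj₂ (M-deg m)))) λ ()) ⟩
      val u + val u + 1                    ≡⟨ cong (val u + val u +_) (sym d) ⟩
      val u + val u + deg x                ∎)
      where
      open ≡-Reasoning
      f : ℕ
      f = b2n (F x u)
      none : count (adj x without u) ≡ 0
      none = ℕ.suc-injective (trans (sym (count-without (adj x) (∈⇒lookup xu))) d)
      valx : val x ≡ f
      valx = trans (val-split xu) (trans (cong (f +_)
        (∑-zero λ y → cong (λ b → b2n b * b2n (F x y)) (count-zero (adj x without u) none y))) (ℕ.+-identityʳ _))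

-- Labellings whose only obstructions come from leaves

module Generic (E : ℕ → ℕ → ℕ → ℕ → Set) (E? : ∀ d i d′ j → Dec (E d i d′ j))
  (E-sym : ∀ {d i d′ j} → E d i d′ j → E d′ j d i)
  (E-functional : ∀ {d i d′ j j′} → E d i d′ j → E d i d′ j′ → j ≡ j′)
  -- A leaf kid has degree 1 and count 0 or 1. The two conditions exclude a conflict with such a kid
  -- if v has one or two kids, all of whose edges are false, respectively true.
  (no-low  : ∀ {k} w → k ≡ 1 ⊎ k ≡ 2 → ¬ E (suc k) (b2n w) 1 0)
  (no-high : ∀ {k} w → k ≡ 1 ⊎ k ≡ 2 → ¬ E (suc k) (k + b2n w) 1 1)
  (T : Graph n) (tree : IsTree T) where

  open IsTree tree
  open Tree T tree
  open Leaves T tree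

  deg : Fin n → ℕ
  deg v = count (adj v)

  open Labelling T tree (λ v i c j → E (deg v) i (deg c) j) (λ v i c j → E? (deg v) i (deg c) j) E-sym E-functional public

  data Outcome (p v : Fin n) : Set where
    leaf : deg v ≡ 1 → (∀ w → Ach p v w (b2n w)) → Outcome p v
    free : (∀ w → ∃[ i ] ∃[ j ] (i ≢ j × Ach p v w i × Ach p v w j)) → Outcome p v

  options-of : ∀ {p v} → Outcome p v → ∀ w → Options (Ach p v w)
  options-of (leaf _ a) w = one (a w)
  options-of (free f)   w = let _ , _ , i≢j , a , b = f w in two i≢j a b

  module Kids {p v : Fin n} (pv : T ⊢ p ~ v) (outcome : ∀ c → (adj v without p) c ≡ true → Outcome v c) where

    open AtVertex pv (λ c kc → options-of (outcome c kc))

    blocked⇒leaf : ∀ {w i c} → blocked w i c ≡ true → E (deg v) i 1 (b2n w)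
    blocked⇒leaf {w} {i} {c} h with blocked⁻ {w} {i} {c} h
    ... | kc , j , eq , conf with outcome c kc
    blocked⇒leaf {w} {i} {c} h | kc , _ , refl , conf | leaf d a = subst (λ k → E (deg v) i k (b2n w)) d conf

    open Counting (λ i c h h′ → contradiction
      (E-functional (blocked⇒leaf {false} {i} {c} h) (blocked⇒leaf {true} {i} {c} h′)) λ ())

    low⇒E : ∀ w s → Low w s → E (deg v) (s + b2n w) 1 0
    low⇒E w s l = let c , h = count-witness (blocked false (s + b2n w)) (ℕ.≤-trans (s≤s z≤n) l)
                  in blocked⇒leaf {false} {s + b2n w} {c} h

    high⇒E : ∀ w s → s ≤ count kid → High w s → E (deg v) (s + b2n w) 1 1
    high⇒E w s s≤k h = let c , h = count-witness (blocked true (s + b2n w)) (pos (#blocked true (s + b2n w)) h)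
                       in blocked⇒leaf {true} {s + b2n w} {c} h
      where
      pos : ∀ m → count kid < s + m → 1 ≤ m
      pos zero    h = contradiction (subst (count kid <_) (ℕ.+-identityʳ s) h) (ℕ.≤⇒≯ s≤k)
      pos (suc m) _ = s≤s z≤n

    deg-v : deg v ≡ suc (count kid)
    deg-v = count-without (adj v) (∈⇒lookup (~-sym pv))

    -- For a given label all pinned kids are leaves with the same count, and this conflicts with one
    -- count at v only. Hence no condition on `s + t` is required.
    leaf-apart : ∀ w {s t} → s ≢ t → s ≤ count kid → t ≤ count kid → Apart w s t
    leaf-apart w {s} {t} s≢t s≤ t≤ = s≢t
      , (λ l l′ → s≢t (ℕ.+-cancelʳ-≡ (b2n w) s t (E-functional (E-sym (low⇒E w s l)) (E-sym (low⇒E w t l′)))))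
      , (λ h h′ → s≢t (ℕ.+-cancelʳ-≡ (b2n w) s t (E-functional (E-sym (high⇒E w s s≤ h)) (E-sym (high⇒E w t t≤ h′)))))

    -- With all kid edges false only `Low` can occur, with all of them true only `High`; either
    -- would be a conflict with a leaf of the kind that is excluded by `no-low` and `no-high`.
    few : count kid ≡ 1 ⊎ count kid ≡ 2 → Outcome p v
    few k = free λ w → pair w {0} {count kid} (0≢k k) (first w) (last w)
      where
      0≢k : ∀ {k} → k ≡ 1 ⊎ k ≡ 2 → 0 ≢ k
      0≢k (inj₁ refl) ()
      0≢k (inj₂ refl) ()
      first : ∀ w → Ach p v w (0 + b2n w)
      first w with status w 0
      ... | inj₁ a        = a
      ... | inj₂ (inj₁ l) = contradiction (subst (λ d → E d (b2n w) 1 0) deg-v (low⇒E w 0 l)) (no-low w k)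
      ... | inj₂ (inj₂ h) = contradiction (#blocked-≤ true (b2n w)) (ℕ.<⇒≱ h)
      last : ∀ w → Ach p v w (count kid + b2n w)
      last w with status w (count kid)
      ... | inj₁ a        = a
      ... | inj₂ (inj₁ l) = contradiction (#blocked-≤ false (count kid + b2n w)) (ℕ.<⇒≱ l)
      ... | inj₂ (inj₂ h) = contradiction (subst (λ d → E d (count kid + b2n w) 1 1) deg-v (high⇒E w (count kid) ℕ.≤-refl h)) (no-high w k)

    many : 3 ≤ count kid → Outcome p v
    many 3≤k = free λ w → achieve₂ w {0} {1} {2} {3}
      (leaf-apart w (λ ()) z≤n 1≤k) (leaf-apart w (λ ()) z≤n 2≤k) (leaf-apart w (λ ()) z≤n 3≤k)
      (leaf-apart w (λ ()) 1≤k 2≤k) (leaf-apart w (λ ()) 1≤k 3≤k) (leaf-apart w (λ ()) 2≤k 3≤k)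
      where
      2≤k = ℕ.≤-trans (ℕ.n≤1+n 2) 3≤k
      1≤k = ℕ.≤-trans (ℕ.n≤1+n 1) 2≤k

    outcome-of-kids : Outcome p v
    outcome-of-kids = go (count kid) refl
      where
      go : ∀ k → count kid ≡ k → Outcome p v
      go 0                   e = leaf (trans deg-v (cong suc e)) (leaf-ach e)
      go 1                   e = few (inj₁ e)
      go 2                   e = few (inj₂ e)
      go (suc (suc (suc k))) e = many (subst (3 ≤_) (sym e) (s≤s (s≤s (s≤s z≤n))))

  resolve : ∀ {p v} → T ⊢ p ~ v → Outcome p v
  resolve pv = go pv (<-wellFounded _)
    where
    go : ∀ {p v} → T ⊢ p ~ v → Acc _<_ (side-size p v) → Outcome p v
    go {p} {v} pv (acc rs) = Kids.outcome-of-kids pv λ c kc → let vc , c≢p = without⁻ (adj v) kc in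
      go (lookup⇒∈ vc) (rs (kid-size< pv (lookup⇒∈ vc) c≢p))

  generic-theorem : Solution ⊎ (∃[ x ] ∃[ u ] (T ⊢ x ~ u × deg x ≡ 1 × deg u ≡ 1))
  generic-theorem with no-edge-or-leaf
  ... | inj₁ none = inj₁ (edgeless-solution none)
  ... | inj₂ (x , u , xu , d) with resolve xu
  ...   | leaf d′ _ = inj₂ (x , u , xu , d , d′)
  ...   | free f    = let _ , _ , i≢j , a , b = f false in inj₁ (solve-at-leaf xu d false (two⇒compatible i≢j a b))

-- Null sequences and rational linear relations between two reals


Null : (ℕ → ℚ) → Set
Null s = ∀ ε → 0ℚ ℚ.< ε → ∃[ K ] ∀ i → K ≤ i → ℚ.∣ s i ∣ ℚ.< ε

Null-cong : ∀ {s t} → (∀ i → s i ≡ t i) → Null s → Null t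
Null-cong eq ns ε 0<ε = let K , h = ns ε 0<ε in K , λ i K≤i → subst (λ z → ℚ.∣ z ∣ ℚ.< ε) (eq i) (h i K≤i)

Null-0 : Null λ _ → 0ℚ
Null-0 ε 0<ε = 0 , λ _ _ → 0<ε

Null-+ : ∀ {s t} → Null s → Null t → Null λ i → s i ℚ.+ t i
Null-+ {s} {t} ns nt ε 0<ε =
  let K , hs = ns (½ ℚ.* ε) (half-pos 0<ε)
      L , ht = nt (½ ℚ.* ε) (half-pos 0<ε)
  in K ⊔ L , λ i K≤i → ℚ.≤-<-trans (ℚ.∣p+q∣≤∣p∣+∣q∣ (s i) (t i))
       (subst (ℚ.∣ s i ∣ ℚ.+ ℚ.∣ t i ∣ ℚ.<_) (two-halves ε)
         (ℚ.+-mono-< (hs i (ℕ.≤-trans (ℕ.m≤m⊔n K L) K≤i)) (ht i (ℕ.≤-trans (ℕ.m≤n⊔m K L) K≤i))))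

½*-< : ∀ {ε} → 0ℚ ℚ.< ε → ½ ℚ.* ε ℚ.< ε
½*-< {ε} 0<ε = subst₂ ℚ._<_ (ℚ.+-identityʳ (½ ℚ.* ε)) (two-halves ε) (ℚ.+-monoʳ-< (½ ℚ.* ε) (half-pos 0<ε))

Null-* : ∀ {t s} → IsCauchy t → Null s → Null λ i → t i ℚ.* s i
Null-* {t} {s} ct ns ε 0<ε =
  let K , B , 0<B , hB = bounded {t} ct
      δ , 0<δ , Bδ = shrink B ε 0<B 0<ε
      L , hs = ns δ 0<δ
  in K ⊔ L , λ i K≤i → ℚ.<-trans
       (subst (ℚ.∣ t i ℚ.* s i ∣ ℚ.<_) Bδ (*-small B (t i) (s i) 0<B
         (hB i (ℕ.≤-trans (ℕ.m≤m⊔n K L) K≤i)) (hs i (ℕ.≤-trans (ℕ.m≤n⊔m K L) K≤i))))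
       (½*-< 0<ε)

const-cauchy : ∀ q → IsCauchy λ _ → q
const-cauchy q ε 0<ε = 0 , λ _ _ _ _ → subst (λ z → ℚ.∣ z ∣ ℚ.< ε) (sym (ℚ.+-inverseʳ q)) 0<ε

Null-scale : ∀ q {s} → Null s → Null λ i → q ℚ.* s i
Null-scale q {s} = Null-* {λ _ → q} {s} (const-cauchy q)

Away : (ℕ → ℚ) → Set
Away s = ∃[ ε ] (0ℚ ℚ.< ε × ∃[ K ] ∀ i → K ≤ i → ε ℚ.< ℚ.∣ s i ∣)

-- Beyond the index `K` the sequence varies by less than ε/4. A rational comparison of the single
-- term at `K` with ε/2 shows that it either stays below ε or stays beyond ε/4, contrary to the
-- hypothesis.
¬Away⇒Null : ∀ {s} → IsCauchy s → ¬ Away s → Null s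
¬Away⇒Null {s} cs ¬away ε 0<ε with cs η (half-pos (half-pos 0<ε))
  where η = ½ ℚ.* (½ ℚ.* ε)
... | K , h with ℚ.∣ s K ∣ ℚ.<? ½ ℚ.* ε
... | yes sK< = K , λ i K≤i → begin-strict
    ℚ.∣ s i ∣                                   ≡⟨ cong ℚ.∣_∣ (solve 2 (λ x y → x := (x :- y) :+ y) refl (s i) (s K)) ⟩
    ℚ.∣ (s i ℚ.- s K) ℚ.+ s K ∣                 ≤⟨ ℚ.∣p+q∣≤∣p∣+∣q∣ (s i ℚ.- s K) (s K) ⟩
    ℚ.∣ s i ℚ.- s K ∣ ℚ.+ ℚ.∣ s K ∣             <⟨ ℚ.+-mono-< (h i K K≤i ℕ.≤-refl) sK< ⟩
    ½ ℚ.* (½ ℚ.* ε) ℚ.+ ½ ℚ.* ε                 <⟨ ℚ.+-monoˡ-< (½ ℚ.* ε) (½*-< (half-pos 0<ε)) ⟩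
    ½ ℚ.* ε ℚ.+ ½ ℚ.* ε                         ≡⟨ two-halves ε ⟩
    ε                                           ∎
  where open ℚ.≤-Reasoning
... | no sK≮ = ⊥-elim (¬away (½ ℚ.* (½ ℚ.* ε) , half-pos (half-pos 0<ε) , K , away))
  where
  open ℚ.≤-Reasoning
  η : ℚ
  η = ½ ℚ.* (½ ℚ.* ε)
  away : ∀ i → K ≤ i → η ℚ.< ℚ.∣ s i ∣
  away i K≤i with η ℚ.<? ℚ.∣ s i ∣
  ... | yes lt = lt
  ... | no ≮   = ⊥-elim (sK≮ (begin-strict
    ℚ.∣ s K ∣                                   ≡⟨ cong ℚ.∣_∣ (solve 2 (λ x y → y := (y :- x) :+ x) refl (s i) (s K)) ⟩
    ℚ.∣ (s K ℚ.- s i) ℚ.+ s i ∣                 ≤⟨ ℚ.∣p+q∣≤∣p∣+∣q∣ (s K ℚ.- s i) (s i) ⟩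
    ℚ.∣ s K ℚ.- s i ∣ ℚ.+ ℚ.∣ s i ∣             <⟨ ℚ.+-mono-<-≤ (h K i ℕ.≤-refl K≤i) (ℚ.≮⇒≥ ≮) ⟩
    η ℚ.+ η                                     ≡⟨ two-halves (½ ℚ.* ε) ⟩
    ½ ℚ.* ε                                     ∎))

Null-cancel : ∀ {s t} → Away s → Null (λ i → s i ℚ.* t i) → Null t
Null-cancel {s} {t} (ε , 0<ε , K , h) nst δ 0<δ =
  let L , hst = nst (ε ℚ.* δ) (subst (ℚ._< ε ℚ.* δ) (ℚ.*-zeroʳ ε) (ℚ.*-monoʳ-<-pos ε {{ℚ.positive 0<ε}} 0<δ))
  in K ⊔ L , λ i K≤i → ℚ.*-cancelˡ-<-nonNeg ε {{ℚ.nonNegative (ℚ.<⇒≤ 0<ε)}} (begin-strict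
    ε ℚ.* ℚ.∣ t i ∣              ≤⟨ ℚ.*-monoʳ-≤-nonNeg ℚ.∣ t i ∣ {{ℚ.∣-∣-nonNeg (t i)}} (ℚ.<⇒≤ (h i (ℕ.≤-trans (ℕ.m≤m⊔n K L) K≤i))) ⟩
    ℚ.∣ s i ∣ ℚ.* ℚ.∣ t i ∣      ≡⟨ sym (ℚ.∣p*q∣≡∣p∣*∣q∣ (s i) (t i)) ⟩
    ℚ.∣ s i ℚ.* t i ∣            <⟨ hst i (ℕ.≤-trans (ℕ.m≤n⊔m K L) K≤i) ⟩
    ε ℚ.* δ                      ∎)
  where open ℚ.≤-Reasoning

-- Counts as rationals, and double negation over finite ranges

nq : ℕ → ℚ
nq zero    = 0ℚ
nq (suc k) = 1ℚ ℚ.+ nq k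

nq-+ : ∀ k l → nq (k + l) ≡ nq k ℚ.+ nq l
nq-+ zero    l = sym (ℚ.+-identityˡ (nq l))
nq-+ (suc k) l = trans (cong (1ℚ ℚ.+_) (nq-+ k l)) (sym (ℚ.+-assoc 1ℚ (nq k) (nq l)))

nq-nonneg : ∀ k → 0ℚ ℚ.≤ nq k
nq-nonneg zero    = ℚ.≤-refl
nq-nonneg (suc k) = ℚ.+-mono-≤ (ℚ.<⇒≤ (ℚ.positive⁻¹ 1ℚ)) (nq-nonneg k)

nq-suc≢0 : ∀ k → nq (suc k) ≢ 0ℚ
nq-suc≢0 k e = ℚ.<⇒≢ (ℚ.+-mono-<-≤ (ℚ.positive⁻¹ 1ℚ) (nq-nonneg k)) (sym e)

nq-injective : ∀ {k l} → nq k ≡ nq l → k ≡ l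
nq-injective {zero}  {zero}  _ = refl
nq-injective {zero}  {suc l} e = contradiction (sym e) (nq-suc≢0 l)
nq-injective {suc k} {zero}  e = contradiction e (nq-suc≢0 k)
nq-injective {suc k} {suc l} e = cong suc (nq-injective (trans (shift (nq k)) (trans (cong (ℚ._- 1ℚ) e) (sym (shift (nq l))))))
  where
  shift : ∀ x → x ≡ (1ℚ ℚ.+ x) ℚ.- 1ℚ
  shift x = solve 1 (λ x → x := (con 1ℚ :+ x) :- con 1ℚ) refl x

difference-0 : ∀ p q → p ℚ.- q ≡ 0ℚ → p ≡ q
difference-0 p q e = trans (solve 2 (λ p q → p := (p :- q) :+ q) refl p q) (trans (cong (ℚ._+ q) e) (ℚ.+-identityˡ q))

¬¬-em : (A : Set) → ¬ ¬ Dec A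
¬¬-em A k = k (no λ a → k (yes a))

-- Double negation passes through finite quantifiers constructively, so that finitely many real
-- equations may be taken as decided.
¬¬-∀-Fin : ∀ {m} {P : Fin m → Set} → (∀ i → ¬ ¬ P i) → ¬ ¬ (∀ i → P i)
¬¬-∀-Fin {zero}  h k = k λ ()
¬¬-∀-Fin {suc m} h k = h zero λ p → ¬¬-∀-Fin (h ∘ suc) λ ps → k λ { zero → p ; (suc i) → ps i }

module Linear (a b : ℝ) where

  private
    A B : ℕ → ℚ
    A = seq a
    B = seq b

  -- p a + q b = 0
  record Lin (p q : ℚ) : Set where
    constructor lin
    field
      null : Null λ i → p ℚ.* A i ℚ.+ q ℚ.* B i

  open Lin

  Lin-comb : ∀ {p q r s} x y → Lin p q → Lin r s → Lin (x ℚ.* p ℚ.+ y ℚ.* r) (x ℚ.* q ℚ.+ y ℚ.* s)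
  Lin-comb {p} {q} {r} {s} x y l m = lin (Null-cong (λ i →
      solve 8 (λ x y p q r s A B → x :* (p :* A :+ q :* B) :+ y :* (r :* A :+ s :* B)
        := (x :* p :+ y :* r) :* A :+ (x :* q :+ y :* s) :* B) refl x y p q r s (A i) (B i))
    (Null-+ (Null-scale x (null l)) (Null-scale y (null m))))

  Lin-0 : Lin 0ℚ 0ℚ
  Lin-0 = lin (Null-cong (λ i → solve 2 (λ A B → con 0ℚ := con 0ℚ :* A :+ con 0ℚ :* B) refl (A i) (B i)) Null-0)

  Lin-≡ : ∀ {p q r s} → p ≡ r → q ≡ s → Lin p q → Lin r s
  Lin-≡ refl refl l = l

  Lin-scale : ∀ {p q} x → Lin p q → Lin (x ℚ.* p) (x ℚ.* q)
  Lin-scale {p} {q} x l = Lin-≡ (drop x p) (drop x q) (Lin-comb x 0ℚ l l)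
    where
    drop : ∀ x p → x ℚ.* p ℚ.+ 0ℚ ℚ.* p ≡ x ℚ.* p
    drop = solve 2 (λ x p → x :* p :+ con 0ℚ :* p := x :* p) refl

  Lin-divide : ∀ {c r s} → c ≢ 0ℚ → Lin (c ℚ.* r) (c ℚ.* s) → Lin r s
  Lin-divide {c} {r} {s} c≢0 l = Lin-≡ (cancel r) (cancel s) (Lin-scale (ℚ.1/ c) l)
    where
    instance
      _ : ℚ.NonZero c
      _ = ℚ.≢-nonZero c≢0
    cancel : ∀ r → ℚ.1/ c ℚ.* (c ℚ.* r) ≡ r
    cancel r = trans (sym (ℚ.*-assoc (ℚ.1/ c) c r)) (trans (cong (ℚ._* r) (ℚ.*-inverseˡ c)) (ℚ.*-identityˡ r))

  -- The total weights of d edges, x of them of weight b, and of d′ edges, x′ of them of weight b, agree.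
  ValEq : ℕ → ℕ → ℕ → ℕ → Set
  ValEq d x d′ x′ = Lin ((nq d ℚ.- nq x) ℚ.- (nq d′ ℚ.- nq x′)) (nq x ℚ.- nq x′)

  a≈0⇒Lin : a ≈ 0ℝ → Lin 1ℚ 0ℚ
  a≈0⇒Lin z = lin (Null-cong (λ i → solve 2 (λ A B → A :- con 0ℚ := con 1ℚ :* A :+ con 0ℚ :* B) refl (A i) (B i)) z)

  Lin⇒a≈0 : Lin 1ℚ 0ℚ → a ≈ 0ℝ
  Lin⇒a≈0 l = Null-cong (λ i → solve 2 (λ A B → con 1ℚ :* A :+ con 0ℚ :* B := A :- con 0ℚ) refl (A i) (B i)) (null l)

  Lin⇒b≈0 : Lin 0ℚ 1ℚ → b ≈ 0ℝ
  Lin⇒b≈0 l = Null-cong (λ i → solve 2 (λ A B → con 0ℚ :* A :+ con 1ℚ :* B := B :- con 0ℚ) refl (A i) (B i)) (null l)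

  a+b≈0⇒Lin : a +ℝ b ≈ 0ℝ → Lin 1ℚ 1ℚ
  a+b≈0⇒Lin z = lin (Null-cong (λ i → solve 2 (λ A B → (A :+ B) :- con 0ℚ := con 1ℚ :* A :+ con 1ℚ :* B) refl (A i) (B i)) z)

  Lin⇒a+b≈0 : Lin 1ℚ 1ℚ → a +ℝ b ≈ 0ℝ
  Lin⇒a+b≈0 l = Null-cong (λ i → solve 2 (λ A B → con 1ℚ :* A :+ con 1ℚ :* B := (A :+ B) :- con 0ℚ) refl (A i) (B i)) (null l)

  Lin⇒a≈b : Lin 1ℚ (ℚ.- 1ℚ) → a ≈ b
  Lin⇒a≈b l = Null-cong (λ i → solve 2 (λ A B → con 1ℚ :* A :+ (:- con 1ℚ) :* B := A :- B) refl (A i) (B i)) (null l)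

  module _ (a≉b : a ≉ b) where

    -- The difference of the two equations is (j - j′)(a - b) = 0.
    ValEq-functional : ∀ {d x d′ j j′} → ValEq d x d′ j → ValEq d x d′ j′ → j ≡ j′
    ValEq-functional {d} {x} {d′} {j} {j′} e e′ with j ℕ.≟ j′
    ... | yes j≡j′ = j≡j′
    ... | no j≢j′  = ⊥-elim (a≉b (Lin⇒a≈b (Lin-divide {nq j ℚ.- nq j′} (j≢j′ ∘ nq-injective ∘ difference-0 _ _)
      (Lin-≡ (solve 5 (λ d x d′ j j′ → con 1ℚ :* ((d :- x) :- (d′ :- j)) :+ (:- con 1ℚ) :* ((d :- x) :- (d′ :- j′)) := (j :- j′) :* con 1ℚ)
               refl (nq d) (nq x) (nq d′) (nq j) (nq j′))
             (solve 3 (λ x j j′ → con 1ℚ :* (x :- j) :+ (:- con 1ℚ) :* (x :- j′) := (j :- j′) :* (:- con 1ℚ)) refl (nq x) (nq j) (nq j′))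
             (Lin-comb 1ℚ (ℚ.- 1ℚ) e e′)))))

  ValEq-sym : ∀ {d x d′ x′} → ValEq d x d′ x′ → ValEq d′ x′ d x
  ValEq-sym {d} {x} {d′} {x′} e = Lin-≡
    (solve 4 (λ d x d′ x′ → (:- con 1ℚ) :* ((d :- x) :- (d′ :- x′)) := (d′ :- x′) :- (d :- x)) refl (nq d) (nq x) (nq d′) (nq x′))
    (solve 2 (λ x x′ → (:- con 1ℚ) :* (x :- x′) := x′ :- x) refl (nq x) (nq x′))
    (Lin-scale (ℚ.- 1ℚ) e)

  module Opposite (a≉b : a ≉ b) (a+b≈0 : a +ℝ b ≈ 0ℝ) where

    private
      -- 2a - (a + b) = a - b.
      a≉0 : ¬ Lin 1ℚ 0ℚ
      a≉0 l = a≉b (Lin⇒a≈b (Lin-comb 2ℚ (ℚ.- 1ℚ) l (a+b≈0⇒Lin a+b≈0)))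
        where 2ℚ = 1ℚ ℚ.+ 1ℚ

    -- Subtracting `x − x′` times a + b = 0 eliminates b, and a ≠ 0 makes the remaining coefficient
    -- of a vanish.
    ValEq⇒≡ : ∀ {d x d′ x′} → ValEq d x d′ x′ → x + x + d′ ≡ x′ + x′ + d
    ValEq⇒≡ {d} {x} {d′} {x′} e with x + x + d′ ℕ.≟ x′ + x′ + d
    ... | yes eq = eq
    ... | no neq = ⊥-elim (a≉0 (Lin-divide {nq (x′ + x′ + d) ℚ.- nq (x + x + d′)} (neq ∘ sym ∘ nq-injective ∘ difference-0 _ _)
      (Lin-≡ (trans (solve 4 (λ d x d′ x′ → con 1ℚ :* ((d :- x) :- (d′ :- x′)) :+ (:- (x :- x′)) :* con 1ℚ
                  := ((x′ :+ x′ :+ d) :- (x :+ x :+ d′)) :* con 1ℚ) refl (nq d) (nq x) (nq d′) (nq x′))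
               (cong (ℚ._* 1ℚ) (sym (cong₂ ℚ._-_ (nq3 x′ d) (nq3 x d′)))))
             (solve 3 (λ x x′ c → con 1ℚ :* (x :- x′) :+ (:- (x :- x′)) :* con 1ℚ := c :* con 0ℚ) refl (nq x) (nq x′) (nq (x′ + x′ + d) ℚ.- nq (x + x + d′)))
             (Lin-comb 1ℚ (ℚ.- (nq x ℚ.- nq x′)) e (a+b≈0⇒Lin a+b≈0)))))
      where
      nq3 : ∀ x d → nq (x + x + d) ≡ nq x ℚ.+ nq x ℚ.+ nq d
      nq3 x d = trans (nq-+ (x + x) d) (cong (ℚ._+ nq d) (nq-+ x x))

    ≡⇒ValEq : ∀ {d x d′ x′} → x + x + d′ ≡ x′ + x′ + d → ValEq d x d′ x′
    ≡⇒ValEq {d} {x} {d′} {x′} e = Lin-≡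
      (trans (solve 4 (λ d x d′ x′ → (x :- x′) :* con 1ℚ := ((d :- x) :- (d′ :- x′)) :+ ((x :+ x :+ d′) :- (x′ :+ x′ :+ d)))
               refl (nq d) (nq x) (nq d′) (nq x′))
        (trans (cong (((nq d ℚ.- nq x) ℚ.- (nq d′ ℚ.- nq x′)) ℚ.+_) (trans
            (cong₂ ℚ._-_ (sym (nq3 x d′)) (sym (nq3 x′ d)))
            (trans (cong (λ k → nq k ℚ.- nq (x′ + x′ + d)) e) (ℚ.+-inverseʳ (nq (x′ + x′ + d))))))
          (ℚ.+-identityʳ _)))
      (ℚ.*-identityʳ (nq x ℚ.- nq x′))
      (Lin-scale (nq x ℚ.- nq x′) (a+b≈0⇒Lin a+b≈0))
      where
      nq3 : ∀ x d → nq (x + x + d) ≡ nq x ℚ.+ nq x ℚ.+ nq d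
      nq3 x d = trans (nq-+ (x + x) d) (cong (ℚ._+ nq d) (nq-+ x x))

  module Zero (a≉b : a ≉ b) (a≈0 : a ≈ 0ℝ) where

    private
      lin-a : Lin 1ℚ 0ℚ
      lin-a = a≈0⇒Lin a≈0

    -- Subtracting a multiple of a = 0 leaves (x - x′) b = 0, and b = 0 would give a = b.
    ValEq⇒≡ : ∀ {d x d′ x′} → ValEq d x d′ x′ → x ≡ x′
    ValEq⇒≡ {d} {x} {d′} {x′} e with x ℕ.≟ x′
    ... | yes eq = eq
    ... | no neq = ⊥-elim (a≉b (Lin⇒a≈b (Lin-comb 1ℚ (ℚ.- 1ℚ) lin-a (Lin-divide {nq x ℚ.- nq x′} {0ℚ} {1ℚ}
      (neq ∘ nq-injective ∘ difference-0 _ _)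
      (Lin-≡ (solve 2 (λ p c → con 1ℚ :* p :+ (:- p) :* con 1ℚ := c :* con 0ℚ) refl P Q)
             (solve 2 (λ p q → con 1ℚ :* q :+ (:- p) :* con 0ℚ := q :* con 1ℚ) refl P Q)
             (Lin-comb 1ℚ (ℚ.- P) e lin-a))))))
      where
      P Q : ℚ
      P = (nq d ℚ.- nq x) ℚ.- (nq d′ ℚ.- nq x′)
      Q = nq x ℚ.- nq x′

    ≡⇒ValEq : ∀ {d x d′ x′} → x ≡ x′ → ValEq d x d′ x′
    ≡⇒ValEq {d} {x} {d′} refl = Lin-≡ (ℚ.*-identityʳ _)
      (trans (ℚ.*-zeroʳ ((nq d ℚ.- nq x) ℚ.- (nq d′ ℚ.- nq x))) (sym (ℚ.+-inverseʳ (nq x))))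
      (Lin-scale ((nq d ℚ.- nq x) ℚ.- (nq d′ ℚ.- nq x)) lin-a)

-- Weightings and labellings

module Weighting (a b : ℝ) (T : Graph n) where
  open Linear a b

  nbr : Fin n → Fin n → Bool
  nbr v u = lookup (N T v) u

  nbr-count : (Fin n → Fin n → Bool) → Fin n → ℕ
  nbr-count F v = count λ u → nbr v u ∧ F v u

  pick : Bool → ℝ
  pick f = if f then b else a

  value : ℕ → ℕ → ℕ → ℚ
  value d x i = (nq d ℚ.- nq x) ℚ.* seq a i ℚ.+ nq x ℚ.* seq b i

  value-+ : ∀ d x d′ x′ i → value (d + d′) (x + x′) i ≡ value d x i ℚ.+ value d′ x′ i
  value-+ d x d′ x′ i = trans (cong₂ (λ k l → (k ℚ.- l) ℚ.* seq a i ℚ.+ l ℚ.* seq b i) (nq-+ d d′) (nq-+ x x′))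
    (solve 6 (λ d x d′ x′ A B → ((d :+ d′) :- (x :+ x′)) :* A :+ (x :+ x′) :* B
      := ((d :- x) :* A :+ x :* B) :+ ((d′ :- x′) :* A :+ x′ :* B)) refl (nq d) (nq x) (nq d′) (nq x′) (seq a i) (seq b i))

  Near : ℝ → ℕ → ℕ → Set
  Near r d x = Null λ i → seq r i ℚ.- value d x i

  near-0 : Near 0ℝ 0 0
  near-0 = Null-cong (λ i → solve 2 (λ A B → con 0ℚ := con 0ℚ :- ((con 0ℚ :- con 0ℚ) :* A :+ con 0ℚ :* B)) refl (seq a i) (seq b i)) Null-0

  near-+ : ∀ {r s d x d′ x′} → Near r d x → Near s d′ x′ → Near (r +ℝ s) (d + d′) (x + x′)
  near-+ {r} {s} {d} {x} {d′} {x′} nr ns = Null-cong (λ i → trans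
    (solve 4 (λ r s v w → (r :- v) :+ (s :- w) := (r :+ s) :- (v :+ w)) refl (seq r i) (seq s i) (value d x i) (value d′ x′ i))
    (cong (λ v → (seq r i ℚ.+ seq s i) ℚ.- v) (sym (value-+ d x d′ x′ i)))) (Null-+ nr ns)

  near-sum : ∀ {m} (f : Fin m → ℝ) (g h : Fin m → Bool) → (∀ u → Near (f u) (b2n (g u)) (b2n (h u))) →
    Near (sum f) (count g) (count h)
  near-sum {zero}  f g h hyp = near-0
  near-sum {suc m} f g h hyp = near-+ {f zero} {sum (f ∘ suc)} {b2n (g zero)} {b2n (h zero)} {count (g ∘ suc)} {count (h ∘ suc)}
    (hyp zero) (near-sum (f ∘ suc) (g ∘ suc) (h ∘ suc) (hyp ∘ suc))

  near-term : ∀ {r} k f → (k ≡ true → r ≈ pick f) → Near (if k then r else 0ℝ) (b2n k) (b2n (k ∧ f))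
  near-term false f _ = near-0
  -- `1ℚ ℚ.+ 0ℚ` is the unfolding of `nq 1`.
  near-term {r} true false h = Null-cong (λ i → cong (λ z → seq r i ℚ.- z)
    (solve 2 (λ A B → A := (con (1ℚ ℚ.+ 0ℚ) :- con 0ℚ) :* A :+ con 0ℚ :* B) refl (seq a i) (seq b i))) (h refl)
  near-term {r} true true  h = Null-cong (λ i → cong (λ z → seq r i ℚ.- z)
    (solve 2 (λ A B → B := (con (1ℚ ℚ.+ 0ℚ) :- con (1ℚ ℚ.+ 0ℚ)) :* A :+ con (1ℚ ℚ.+ 0ℚ) :* B) refl (seq a i) (seq b i))) (h refl)

  does-∈? : ∀ {m} (x : Fin m) (S : Subset m) → does (x ∈? S) ≡ lookup S x
  does-∈? x S with x ∈? S
  ... | yes x∈ = sym (∈⇒lookup x∈)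
  ... | no x∉  = sym (∉⇒lookup x∉)

  near-weightedDegree : ∀ {W} (ω : EdgeWeighting W T) (F : Fin n → Fin n → Bool) →
    (∀ {u v} → T ⊢ u ~ v → weight ω u v ≈ pick (F u v)) → ∀ v →
    Near (weightedDegree T ω v) (count (nbr v)) (nbr-count F v)
  near-weightedDegree ω F h v = near-sum _ (nbr v) (λ u → nbr v u ∧ F v u) λ u →
    subst (λ k → Near (if k then weight ω v u else 0ℝ) (b2n (nbr v u)) (b2n (nbr v u ∧ F v u))) (sym (does-∈? u (N T v)))
      (near-term {weight ω v u} (nbr v u) (F v u) λ e → h (lookup⇒∈ e))

  ValEq⇔≈ : ∀ r s d x d′ x′ → Near r d x → Near s d′ x′ → (ValEq d x d′ x′ → r ≈ s) × (r ≈ s → ValEq d x d′ x′)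
  ValEq⇔≈ r s d x d′ x′ nr ns = to , from
    where
    diff : ∀ i → value d x i ℚ.- value d′ x′ i ≡
      ((nq d ℚ.- nq x) ℚ.- (nq d′ ℚ.- nq x′)) ℚ.* seq a i ℚ.+ (nq x ℚ.- nq x′) ℚ.* seq b i
    diff i = solve 6 (λ d x d′ x′ A B → ((d :- x) :* A :+ x :* B) :- ((d′ :- x′) :* A :+ x′ :* B)
      := ((d :- x) :- (d′ :- x′)) :* A :+ (x :- x′) :* B) refl (nq d) (nq x) (nq d′) (nq x′) (seq a i) (seq b i)
    to : ValEq d x d′ x′ → r ≈ s
    to (lin l) = Null-cong (λ i → trans
        (cong (λ z → (seq r i ℚ.- value d x i) ℚ.+ (ℚ.- 1ℚ) ℚ.* (seq s i ℚ.- value d′ x′ i) ℚ.+ z) (sym (diff i)))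
        (solve 4 (λ r s v w → (r :- v) :+ (:- con 1ℚ) :* (s :- w) :+ (v :- w) := r :- s) refl (seq r i) (seq s i) (value d x i) (value d′ x′ i)))
      (Null-+ (Null-+ nr (Null-scale (ℚ.- 1ℚ) ns)) l)
    from : r ≈ s → ValEq d x d′ x′
    from r≈s = lin (Null-cong (λ i → trans
        (solve 4 (λ r s v w → (r :- s) :+ (:- con 1ℚ) :* (r :- v) :+ (s :- w) := v :- w) refl (seq r i) (seq s i) (value d x i) (value d′ x′ i))
        (diff i))
      (Null-+ (Null-+ r≈s (Null-scale (ℚ.- 1ℚ) nr)) ns))

  ≈-refl : ∀ r → r ≈ r
  ≈-refl r = Null-cong (λ i → sym (ℚ.+-inverseʳ (seq r i))) Null-0

  ≈-sym : ∀ r s → r ≈ s → s ≈ r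
  ≈-sym r s e = Null-cong (λ i → solve 2 (λ r s → (:- con 1ℚ) :* (r :- s) := s :- r) refl (seq r i) (seq s i)) (Null-scale (ℚ.- 1ℚ) e)

  ≈-trans : ∀ r s t → r ≈ s → s ≈ t → r ≈ t
  ≈-trans r s t e f = Null-cong (λ i → solve 3 (λ r s t → (r :- s) :+ (s :- t) := r :- t) refl (seq r i) (seq s i) (seq t i)) (Null-+ e f)

  vertex-ValEq⇔≈ : ∀ {W} (ω : EdgeWeighting W T) (F : Fin n → Fin n → Bool) →
    (∀ {u v} → T ⊢ u ~ v → weight ω u v ≈ pick (F u v)) → ∀ u v →
    let e = ValEq (count (nbr u)) (nbr-count F u) (count (nbr v)) (nbr-count F v)
        e′ = weightedDegree T ω u ≈ weightedDegree T ω v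
    in (e → e′) × (e′ → e)
  vertex-ValEq⇔≈ ω F h u v = ValEq⇔≈ (weightedDegree T ω u) (weightedDegree T ω v)
    (count (nbr u)) (nbr-count F u) (count (nbr v)) (nbr-count F v)
    (near-weightedDegree ω F (λ {x} {y} → h {x} {y}) u) (near-weightedDegree ω F (λ {x} {y} → h {x} {y}) v)

  SymmetricLabel : (Fin n → Fin n → Bool) → Set
  SymmetricLabel F = ∀ {x y} → T ⊢ x ~ y → F x y ≡ F y x

  ProperLabel : (Fin n → Fin n → Bool) → Set
  ProperLabel F = ∀ {x y} → T ⊢ x ~ y → ¬ ValEq (count (nbr x)) (nbr-count F x) (count (nbr y)) (nbr-count F y)

  label⇒weighting : ∀ F → SymmetricLabel F → ProperLabel F → AdmitsProper ｛ a , b ｝ T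
  label⇒weighting F F-sym F-proper = ω , λ {u} {v} e eq → F-proper e
      (proj₂ (vertex-ValEq⇔≈ ω F (λ {x} {y} _ → ≈-refl (pick (F x y))) u v) eq)
    where
    member : ∀ f → ｛ a , b ｝ (pick f)
    member false = inj₁ (≈-refl a)
    member true  = inj₂ (≈-refl b)
    ω : EdgeWeighting ｛ a , b ｝ T
    ω = record
      { weight = λ u v → pick (F u v)
      ; weight-sym = λ {u} {v} e → subst (λ f → pick (F u v) ≈ pick f) (F-sym e) (≈-refl (pick (F u v)))
      ; weight∈W = λ {u} {v} _ → member (F u v)
      }

  label-of : ∀ r → ｛ a , b ｝ r → ∃[ f ] r ≈ pick f
  label-of r (inj₁ e) = false , e
  label-of r (inj₂ e) = true , e

  -- The label of a pair is read off from a proof that its weight is a or b. The proofs for xy and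
  -- yx are unrelated, and it is a ≠ b that makes their labels agree.
  weighting⇒label : a ≉ b → AdmitsProper ｛ a , b ｝ T → ∃[ F ] (SymmetricLabel F × ProperLabel F)
  weighting⇒label a≉b (ω , proper) = F , F-sym , λ {x} {y} e eq → proper e
      (proj₁ (vertex-ValEq⇔≈ ω F (λ {x} {y} → spec {x} {y}) x y) eq)
    where
    F′ : ∀ x y → Dec (T ⊢ x ~ y) → Bool
    F′ x y (yes e) = proj₁ (label-of (weight ω x y) (weight∈W ω e))
    F′ x y (no _)  = false
    F : Fin n → Fin n → Bool
    F x y = F′ x y (T ⊢ x ~? y)
    spec : ∀ {x y} → T ⊢ x ~ y → weight ω x y ≈ pick (F x y)
    spec {x} {y} e = go (T ⊢ x ~? y)
      where
      go : ∀ d → weight ω x y ≈ pick (F′ x y d)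
      go (yes e′) = proj₂ (label-of (weight ω x y) (weight∈W ω e′))
      go (no ¬e)  = contradiction e ¬e
    pick-injective : ∀ f g → pick f ≈ pick g → f ≡ g
    pick-injective false false _ = refl
    pick-injective false true  e = contradiction e a≉b
    pick-injective true  false e = contradiction (≈-sym b a e) a≉b
    pick-injective true  true  _ = refl
    F-sym : SymmetricLabel F
    F-sym {x} {y} e = pick-injective (F x y) (F y x)
      (≈-trans (pick (F x y)) (weight ω x y) (pick (F y x))
        (≈-sym (weight ω x y) (pick (F x y)) (spec {x} {y} e))
        (≈-trans (weight ω x y) (weight ω y x) (pick (F y x)) (weight-sym ω e) (spec {y} {x} (N-sym T e))))

swap-weights : ∀ {a b} {T : Graph n} → AdmitsProper ｛ a , b ｝ T → AdmitsProper ｛ b , a ｝ T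
swap-weights (ω , proper) = record
  { weight = weight ω ; weight-sym = weight-sym ω ; weight∈W = λ e → [ inj₂ , inj₁ ]′ (weight∈W ω e) } , proper

-- Weights a and b with a + b = 0

module OppositeWeights (a b : ℝ) (a≉b : a ≉ b) (a+b≈0 : a +ℝ b ≈ 0ℝ) (T : Graph n) (tree : IsTree T) where
  open Weighting a b T
  open Linear.Opposite a b a≉b a+b≈0

  opposite-theorem : (¬ AdmitsProper ｛ a , b ｝ T) ⇔ 𝒞 T
  opposite-theorem = mk⇔ to from
    where
    to : ¬ AdmitsProper ｛ a , b ｝ T → 𝒞 T
    to none = go signed-theorem
      where
      open SignedTheorem T tree (λ _ → 0) (λ _ → refl)
      open Signed T tree (λ _ → 0) (λ _ → refl)
      go : Solution ⊎ (𝒞 T × Constant) → 𝒞 T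
      go (inj₂ (c , _)) = c
      go (inj₁ s) = ⊥-elim (none (label⇒weighting label label-sym λ {x} {y} e eq →
          proper e (ValEq⇒≡ {count (nbr x)} {nbr-count label x} {count (nbr y)} {nbr-count label y} eq)))
        where open Solution s
    from : 𝒞 T → ¬ AdmitsProper ｛ a , b ｝ T
    from c admits = let F , F-sym , F-proper = weighting⇒label a≉b admits in
      Obstruction.no-solution T c (record { label = F ; label-sym = F-sym ; proper = λ {x} {y} e eq →
        F-proper e (≡⇒ValEq {count (nbr x)} {nbr-count F x} {count (nbr y)} {nbr-count F y} eq) })

-- Weights a and b with ab(a + b) ≠ 0

two-vertices⇒≅K₂ : (T : Graph n) → ∀ {x u} → T ⊢ x ~ u → (∀ {y} → y ∈ V T → y ≡ x ⊎ y ≡ u) → T ≅ K₂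
two-vertices⇒≅K₂ {n} T {x} {u} xu cover = record
  { vertices = mk↔ₛ′ to from to-from from-to ; edges = λ (y , y∈) (z , z∈) → mk⇔ (edge⁺ y∈ z∈) (edge⁻ y∈ z∈) }
  where
  x∈ : x ∈ V T
  x∈ = N⊆V T (N-sym T xu)
  u∈ : u ∈ V T
  u∈ = N⊆V T xu
  x≢u : x ≢ u
  x≢u refl = N-irrefl T xu
  index : Fin n → Fin 2
  index y = if does (y Fin.≟ x) then zero else suc zero
  index-x : index x ≡ zero
  index-x = cong (if_then zero else suc zero) (dec-true (x Fin.≟ x) refl)
  index-u : index u ≡ suc zero
  index-u = cong (if_then zero else suc zero) (dec-false (u Fin.≟ x) (x≢u ∘ sym))
  in-K₂ : ∀ i → i ∈ V K₂
  in-K₂ zero       = here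
  in-K₂ (suc zero) = there here
  to : Vertex T → Vertex K₂
  to (y , _) = index y , in-K₂ (index y)
  from : Vertex K₂ → Vertex T
  from (zero , _)     = x , x∈
  from (suc zero , _) = u , u∈
  pair-≡ : ∀ {m} {G : Graph m} {v w : Vertex G} → proj₁ v ≡ proj₁ w → v ≡ w
  pair-≡ {G = G} {v , v∈} {.v , v∈′} refl = cong (v ,_) ([]=-irrelevant v∈ v∈′)
  to-from : ∀ i → to (from i) ≡ i
  to-from (zero , _)     = pair-≡ {G = K₂} index-x
  to-from (suc zero , _) = pair-≡ {G = K₂} index-u
  from-to : ∀ y → from (to y) ≡ y
  from-to (y , y∈) with cover y∈
  ... | inj₁ refl = pair-≡ {G = T} (trans (cong (λ i → proj₁ (from (i , in-K₂ i))) index-x) refl)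
  ... | inj₂ refl = pair-≡ {G = T} (trans (cong (λ i → proj₁ (from (i , in-K₂ i))) index-u) refl)
  K₂-edge : ∀ {i j} → i ≢ j → K₂ ⊢ i ~ j
  K₂-edge {zero}     {zero}     h = contradiction refl h
  K₂-edge {zero}     {suc zero} h = there here
  K₂-edge {suc zero} {zero}     h = here
  K₂-edge {suc zero} {suc zero} h = contradiction refl h
  edge⁺ : ∀ {y z} → y ∈ V T → z ∈ V T → T ⊢ y ~ z → K₂ ⊢ index y ~ index z
  edge⁺ {y} {z} y∈ z∈ e = K₂-edge (go (cover y∈) (cover z∈))
    where
    go : y ≡ x ⊎ y ≡ u → z ≡ x ⊎ z ≡ u → index y ≢ index z
    go (inj₁ refl) (inj₁ refl) = contradiction e (N-irrefl T)
    go (inj₁ refl) (inj₂ refl) h = contradiction (trans (sym index-x) (trans h index-u)) λ ()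
    go (inj₂ refl) (inj₁ refl) h = contradiction (trans (sym index-x) (trans (sym h) index-u)) λ ()
    go (inj₂ refl) (inj₂ refl) = contradiction e (N-irrefl T)
  edge⁻ : ∀ {y z} → y ∈ V T → z ∈ V T → K₂ ⊢ index y ~ index z → T ⊢ y ~ z
  edge⁻ {y} {z} y∈ z∈ e with cover y∈ | cover z∈
  ... | inj₁ refl | inj₁ refl = contradiction e (N-irrefl K₂)
  ... | inj₁ refl | inj₂ refl = xu
  ... | inj₂ refl | inj₁ refl = N-sym T xu
  ... | inj₂ refl | inj₂ refl = contradiction e (N-irrefl K₂)

≅K₂⇒two-vertices : (T : Graph n) → T ≅ K₂ → ∃[ x ] ∃[ u ] (T ⊢ x ~ u × (∀ {y} → y ∈ V T → y ≡ x ⊎ y ≡ u))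
≅K₂⇒two-vertices T iso = proj₁ (from v₀) , proj₁ (from v₁)
    , Equivalence.from (_≅_.edges iso (from v₀) (from v₁)) (subst₂ (λ p q → K₂ ⊢ proj₁ p ~ proj₁ q) (sym (strictlyInverseˡ v₀)) (sym (strictlyInverseˡ v₁)) (there here))
    , λ {y} y∈ → go (to (y , y∈)) refl
  where
  open Inverse (_≅_.vertices iso)
  v₀ v₁ : Vertex K₂
  v₀ = zero , here
  v₁ = suc zero , there here
  go : ∀ {v} i → to v ≡ i → proj₁ v ≡ proj₁ (from v₀) ⊎ proj₁ v ≡ proj₁ (from v₁)
  go {v} (zero , here)           e = inj₁ (cong proj₁ (trans (sym (strictlyInverseʳ v)) (cong from e)))
  go {v} (suc zero , there here) e = inj₂ (cong proj₁ (trans (sym (strictlyInverseʳ v)) (cong from e)))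

module GenericWeights (a b : ℝ) (a≉b : a ≉ b) (ab[a+b]≉0 : a *ℝ b *ℝ (a +ℝ b) ≉ 0ℝ) (T : Graph n) (tree : IsTree T) where
  open Weighting a b T
  open Linear a b
  open IsTree tree
  open Leaves T tree
  open Tree T tree

  private
    A B : ℕ → ℚ
    A = seq a
    B = seq b

    -- `s` is one of the factors a, b, a + b and `t` the product of the other two; as `t` is Cauchy,
    -- a null factor would make the whole product null.
    factor : ∀ (s : ℕ → ℚ) (t : ℝ) → (∀ i → seq t i ℚ.* s i ≡ A i ℚ.* B i ℚ.* (A i ℚ.+ B i) ℚ.- 0ℚ) → ¬ Null s
    factor s t eq ns = ab[a+b]≉0 (Null-cong eq (Null-* {seq t} {s} (cauchy t) ns))

    ¬Lin-a : ¬ Lin 1ℚ 0ℚ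
    ¬Lin-a l = factor A (b *ℝ (a +ℝ b))
      (λ i → solve 2 (λ A B → (B :* (A :+ B)) :* A := A :* B :* (A :+ B) :- con 0ℚ) refl (A i) (B i))
      (Null-cong (λ i → solve 1 (λ A → A :- con 0ℚ := A) refl (A i)) (Lin⇒a≈0 l))

    ¬Lin-b : ¬ Lin 0ℚ 1ℚ
    ¬Lin-b l = factor B (a *ℝ (a +ℝ b))
      (λ i → solve 2 (λ A B → (A :* (A :+ B)) :* B := A :* B :* (A :+ B) :- con 0ℚ) refl (A i) (B i))
      (Null-cong (λ i → solve 1 (λ A → A :- con 0ℚ := A) refl (B i)) (Lin⇒b≈0 l))

    ¬Lin-a+b : ¬ Lin 1ℚ 1ℚ
    ¬Lin-a+b l = factor (λ i → A i ℚ.+ B i) (a *ℝ b)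
      (λ i → solve 2 (λ A B → A :* B :* (A :+ B) := A :* B :* (A :+ B) :- con 0ℚ) refl (A i) (B i))
      (Null-cong (λ i → solve 2 (λ A B → (A :+ B) :- con 0ℚ := A :+ B) refl (A i) (B i)) (Lin⇒a+b≈0 l))

    2≢0 : nq 2 ≢ 0ℚ
    2≢0 = nq-suc≢0 1

  -- The total at v is k a plus the weight of pv, that of the leaf is a. The differences are a, b,
  -- 2a and a + b, hence the condition ab(a + b) ≠ 0; `no-high` exchanges a and b.
  no-low : ∀ {k} w → k ≡ 1 ⊎ k ≡ 2 → ¬ ValEq (suc k) (b2n w) 1 0
  no-low false (inj₁ refl) l = ¬Lin-a l
  no-low true  (inj₁ refl) l = ¬Lin-b l
  no-low false (inj₂ refl) l = ¬Lin-a (Lin-divide 2≢0 l)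
  no-low true  (inj₂ refl) l = ¬Lin-a+b l

  no-high : ∀ {k} w → k ≡ 1 ⊎ k ≡ 2 → ¬ ValEq (suc k) (k + b2n w) 1 1
  no-high false (inj₁ refl) l = ¬Lin-a l
  no-high true  (inj₁ refl) l = ¬Lin-b l
  no-high false (inj₂ refl) l = ¬Lin-a+b l
  no-high true  (inj₂ refl) l = ¬Lin-b (Lin-divide 2≢0 l)

  Decided : Set
  Decided = ∀ (d i d′ j : Fin (suc n)) → Dec (ValEq (toℕ d) (toℕ i) (toℕ d′) (toℕ j))

  ¬¬decided : ¬ ¬ Decided
  ¬¬decided = ¬¬-∀-Fin λ d → ¬¬-∀-Fin λ i → ¬¬-∀-Fin λ d′ → ¬¬-∀-Fin λ j → ¬¬-em _

  -- Degrees and counts in T are at most n, so the bounds lose no conflict of T and leave only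
  -- finitely many equations to decide.
  Equal : ℕ → ℕ → ℕ → ℕ → Set
  Equal d i d′ j = ((d ≤ n × i ≤ n) × (d′ ≤ n × j ≤ n)) × ValEq d i d′ j

  equal? : Decided → ∀ d i d′ j → Dec (Equal d i d′ j)
  equal? decided d i d′ j with ((d ℕ.≤? n) ×-dec (i ℕ.≤? n)) ×-dec ((d′ ℕ.≤? n) ×-dec (j ℕ.≤? n))
  ... | no ¬bounds = no (¬bounds ∘ proj₁)
  ... | yes bounds@((d≤ , i≤) , d′≤ , j≤) with decided (fromℕ< (s≤s d≤)) (fromℕ< (s≤s i≤)) (fromℕ< (s≤s d′≤)) (fromℕ< (s≤s j≤))
  ... | dec rewrite Fin.toℕ-fromℕ< (s≤s d≤) | Fin.toℕ-fromℕ< (s≤s i≤) | Fin.toℕ-fromℕ< (s≤s d′≤) | Fin.toℕ-fromℕ< (s≤s j≤)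
    with dec
  ... | yes e = yes (bounds , e)
  ... | no ¬e = no (¬e ∘ proj₂)

  LeafPair : Set
  LeafPair = ∃[ x ] ∃[ u ] (T ⊢ x ~ u × count (adj x) ≡ 1 × count (adj u) ≡ 1)

  leafPair? : Dec LeafPair
  leafPair? = Fin.any? λ x → Fin.any? λ u → (T ⊢ x ~? u) ×-dec (count (adj x) ℕ.≟ 1) ×-dec (count (adj u) ℕ.≟ 1)

  leafPair⇒≅K₂ : LeafPair → T ≅ K₂
  leafPair⇒≅K₂ (x , u , xu , dx , du) = two-vertices⇒≅K₂ T xu λ {y} y∈ → cover (leaf-cover xu dx y∈)
    where
    cover : ∀ {y} → y ≡ x ⊎ y ∈ side T x u → y ≡ x ⊎ y ≡ u
    cover (inj₁ e)  = inj₁ e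
    cover (inj₂ y∈) with side-decompose xu y∈
    ... | inj₁ e                  = inj₂ e
    ... | inj₂ (c , uc , c≢x , _) = contradiction (leaf-neighbour (~-sym xu) du uc) c≢x

  generic-weights-theorem : (¬ AdmitsProper ｛ a , b ｝ T) ⇔ T ≅ K₂
  generic-weights-theorem = mk⇔ to from
    where
    solve-or-pair : Decided → ¬ AdmitsProper ｛ a , b ｝ T → LeafPair
    solve-or-pair decided none = go generic-theorem
      where
      open Generic Equal (equal? decided)
        (λ {d} {i} {d′} {j} ((p , q) , e) → (q , p) , ValEq-sym {d} {i} {d′} {j} e)
        (λ {d} {i} {d′} {j} {j′} (_ , e) (_ , e′) → ValEq-functional a≉b {d} {i} {d′} {j} {j′} e e′)
        (λ w k (_ , e) → no-low w k e) (λ w k (_ , e) → no-high w k e) T tree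
      go : Solution ⊎ LeafPair → LeafPair
      go (inj₂ pair) = pair
      go (inj₁ s) = ⊥-elim (none (label⇒weighting label label-sym λ {x} {y} e eq → proper e
          (((count-≤n (adj x) , count-≤n (λ z → adj x z ∧ label x z)) , (count-≤n (adj y) , count-≤n (λ z → adj y z ∧ label y z))) , eq)))
        where open Solution s
    to : ¬ AdmitsProper ｛ a , b ｝ T → T ≅ K₂
    to none with leafPair?
    ... | yes pair = leafPair⇒≅K₂ pair
    -- The contradiction is sought under a double negation, so the equations of `Decided` may be
    -- assumed decided.
    ... | no ¬pair = ⊥-elim (¬¬decided λ decided → ¬pair (solve-or-pair decided none))
    from : T ≅ K₂ → ¬ AdmitsProper ｛ a , b ｝ T
    from iso admits = let x , u , xu , cover = ≅K₂⇒two-vertices T iso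
                          F , F-sym , F-proper = weighting⇒label a≉b admits
                      in no-label xu cover F F-sym F-proper
      where
      no-label : ∀ {x u} → T ⊢ x ~ u → (∀ {y} → y ∈ V T → y ≡ x ⊎ y ≡ u) → ∀ F → SymmetricLabel F → ¬ ProperLabel F
      no-label {x} {u} xu cover F F-sym F-proper = F-proper xu
       (Lin-≡ (sym (trans (cong₂ (λ k l → (nq (count (adj x)) ℚ.- nq (nbr-count F x)) ℚ.- (nq k ℚ.- nq l)) (sym same-degree) (sym same-count)) (ℚ.+-inverseʳ (nq (count (adj x)) ℚ.- nq (nbr-count F x)))))
             (sym (trans (cong (λ l → nq (nbr-count F x) ℚ.- nq l) (sym same-count)) (ℚ.+-inverseʳ (nq (nbr-count F x))))) Lin-0)
        where
        only : ∀ {p q} → T ⊢ p ~ q → (∀ {y} → y ∈ V T → y ≡ p ⊎ y ≡ q) → (f : Fin n → Bool) → count (λ y → adj p y ∧ f y) ≡ b2n (f q)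
        only {p} {q} pq cov f = trans (∑-single q {λ y → b2n (adj p y ∧ f y)} zero-off) (cong (λ b → b2n (b ∧ f q)) (∈⇒lookup pq))
          where
          zero-off : ∀ y → y ≢ q → b2n (adj p y ∧ f y) ≡ 0
          zero-off y y≢q with adj p y in e
          ... | false = refl
          ... | true with cov (~⇒Vʳ (lookup⇒∈ e))
          ...   | inj₁ refl = contradiction (lookup⇒∈ e) ~-irrefl
          ...   | inj₂ y≡q  = contradiction y≡q y≢q
        swapped : ∀ {y} → y ∈ V T → y ≡ u ⊎ y ≡ x
        swapped y∈ = [ inj₂ , inj₁ ]′ (cover y∈)
        same-count : nbr-count F x ≡ nbr-count F u
        same-count = trans (only xu cover (F x)) (trans (cong b2n (F-sym xu)) (sym (only (~-sym xu) swapped (F u))))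
        degree-1 : ∀ {p q} → T ⊢ p ~ q → (∀ {y} → y ∈ V T → y ≡ p ⊎ y ≡ q) → count (adj p) ≡ 1
        degree-1 {p} pq cov = trans (count-cong λ y → sym (Bool.∧-identityʳ (adj p y))) (only pq cov (λ _ → true))
        same-degree : count (adj x) ≡ count (adj u)
        same-degree = trans (degree-1 xu cover) (sym (degree-1 (~-sym xu) swapped))

-- Labellings with prescribed parities

module Parity (T : Graph n) (tree : IsTree T) where
  open IsTree tree
  open Tree T tree

  cnt : (Fin n → Fin n → Bool) → Fin n → ℕ
  cnt F v = count λ y → adj v y ∧ F v y

  Sym : (Fin n → Fin n → Bool) → Set
  Sym F = ∀ {x y} → T ⊢ x ~ y → F x y ≡ F y x

  root-once : ∀ {u v r} → T ⊢ u ~ v → r ∈ V T → in-side v u r ≡ not (in-side u v r)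
  root-once {u} {v} {r} uv r∈ with in-side u v r in e | in-side v u r in e′
  ... | true  | true  = contradiction (lookup⇒∈ {S = side T u v} e) (side-disjoint uv (lookup⇒∈ {S = side T v u} e′))
  ... | true  | false = refl
  ... | false | true  = refl
  ... | false | false = [ (λ s → contradiction s (lookup⇒∉ {S = side T u v} e)) , (λ s → contradiction s (lookup⇒∉ {S = side T v u} e′)) ]′ (side-cover uv r∈)

  -- The parity of g beyond the edge xy, seen from r.
  join : (Fin n → ℕ) → Fin n → Fin n → Fin n → Bool
  join g r x y = odd (if in-side x y r then weight-of-side g y x else weight-of-side g x y)

  join-away : ∀ g {r x y} → in-side x y r ≡ false → join g r x y ≡ odd (weight-of-side g x y)
  join-away g {r} {x} {y} e = cong (λ b → odd (if b then weight-of-side g y x else weight-of-side g x y)) e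

  join-sym : ∀ g {r} → r ∈ V T → Sym (join g r)
  join-sym g {r} r∈ {x} {y} xy with in-side x y r | in-side y x r | root-once xy r∈
  ... | true  | false | _ = refl
  ... | false | true  | _ = refl

  odd-cnt : ∀ (m : Fin n → ℕ) F v → (∀ {y} → T ⊢ v ~ y → F v y ≡ odd (m y)) →
    odd (cnt F v) ≡ odd (∑ λ y → b2n (adj v y) * m y)
  odd-cnt m F v h = odd-∑-cong λ y → go y
    where
    go : ∀ y → odd (b2n (adj v y ∧ F v y)) ≡ odd (b2n (adj v y) * m y)
    go y with adj v y in e
    ... | false = refl
    ... | true  = trans (odd-b2n (F v y)) (trans (h (lookup⇒∈ e)) (cong odd (sym (ℕ.+-identityʳ (m y)))))

  -- The edge towards r carries `g z` plus the sum `S` of what the other edges carry, so `S` occurs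
  -- twice at z and cancels modulo 2.
  odd-cnt-join : ∀ g {r z} → r ∈ V T → z ∈ V T → z ≢ r → odd (cnt (join g r) z) ≡ odd (g z)
  odd-cnt-join g {r} {z} r∈ z∈ z≢r with branch z∈ r∈ (z≢r ∘ sym)
  ... | p , zp , r∈zp = begin
      odd (cnt (join g r) z)                          ≡⟨ odd-cnt m (join g r) z (λ _ → refl) ⟩
      odd (∑ λ y → b2n (adj z y) * m y)               ≡⟨ cong odd (∑-without (adj z) m (∈⇒lookup zp)) ⟩
      odd (m p + ∑ (λ y → b2n ((adj z without p) y) * m y))
        ≡⟨ cong (λ k → odd k) (cong₂ _+_ m-p (sum-cong-≗ m-kid)) ⟩
      odd (weight-of-side g p z + S)                  ≡⟨ cong (λ k → odd (k + S)) (weight-side (~-sym zp) g) ⟩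
      odd (g z + S + S)                               ≡⟨ cong odd (ℕ.+-assoc (g z) S S) ⟩
      odd (g z + (S + S))                             ≡⟨ odd-+ (g z) (S + S) ⟩
      odd (g z) xor odd (S + S)                       ≡⟨ cong (odd (g z) xor_) (odd-double S) ⟩
      odd (g z) xor false                             ≡⟨ Bool.xor-identityʳ (odd (g z)) ⟩
      odd (g z)                                       ∎
      where
      open ≡-Reasoning
      m : Fin n → ℕ
      m y = if in-side z y r then weight-of-side g y z else weight-of-side g z y
      S : ℕ
      S = ∑ λ y → b2n ((adj z without p) y) * weight-of-side g z y
      m-p : m p ≡ weight-of-side g p z
      m-p = cong (λ b → if b then weight-of-side g p z else weight-of-side g z p) (∈⇒lookup r∈zp)
      m-kid : ∀ y → b2n ((adj z without p) y) * m y ≡ b2n ((adj z without p) y) * weight-of-side g z y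
      m-kid y = go ((adj z without p) y) refl
        where
        go : ∀ b → (adj z without p) y ≡ b → b2n b * m y ≡ b2n b * weight-of-side g z y
        go false _ = refl
        go true  e = let zy , y≢p = without⁻ (adj z) e in
          cong (λ b → 1 * (if b then weight-of-side g y z else weight-of-side g z y))
            (∉⇒lookup {S = side T z y} λ r∈zy → y≢p (branch-unique (lookup⇒∈ zy) zp r∈zy r∈zp))

  -- No edge at r leads towards r, so its edges carry everything except `g r`; an even total makes
  -- this the parity of `g r`.
  odd-cnt-join-root : ∀ g {r} → r ∈ V T → odd (total g) ≡ false → odd (cnt (join g r) r) ≡ odd (g r)
  odd-cnt-join-root g {r} r∈ even = trans
    (odd-cnt (weight-of-side g r) (join g r) r (λ ry → join-away g (∉⇒lookup {S = side T r _} (bridge ry))))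
    (xor-false (odd (g r)) _ (trans (sym (odd-+ (g r) _)) (trans (cong odd (sym (weight-vertex r∈ g))) even)))
    where
    xor-false : ∀ a b → a xor b ≡ false → b ≡ a
    xor-false true  true  _ = refl
    xor-false false false _ = refl

  Solution₀₁ : Set
  Solution₀₁ = ∃[ F ] (Sym F × (∀ {x y} → T ⊢ x ~ y → cnt F x ≢ cnt F y))

  alternating⇒solution : (ψ : Fin n → Bool) → (∀ {x y} → T ⊢ x ~ y → ψ x ≢ ψ y) →
    odd (total (b2n ∘ ψ)) ≡ false → Solution₀₁
  alternating⇒solution ψ alternating even = F , join-sym g r∈ , λ xy eq →
      alternating xy (trans (sym (parity (~⇒Vˡ xy))) (trans (cong odd eq) (parity (~⇒Vʳ xy))))
    where
    g : Fin n → ℕ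
    g = b2n ∘ ψ
    r : Fin n
    r = proj₁ nonempty
    r∈ : r ∈ V T
    r∈ = proj₂ nonempty
    F : Fin n → Fin n → Bool
    F = join g r
    parity : ∀ {x} → x ∈ V T → odd (cnt F x) ≡ ψ x
    parity {x} x∈ with x Fin.≟ r
    ... | yes refl = trans (odd-cnt-join-root g r∈ even) (odd-b2n (ψ x))
    ... | no x≢r   = trans (odd-cnt-join g r∈ x∈ x≢r) (odd-b2n (ψ x))

  -- The depth of v below r counts the edges with r and v on different sides.
  module Depth (r : Fin n) where

    beyond : Fin n → Fin n → Fin n → Bool
    beyond v p z = adj p z ∧ (not (in-side p z r) ∧ in-side p z v)

    depth : Fin n → ℕ
    depth v = ∑ λ p → ∑ λ z → b2n (beyond v p z)

    -- Only the edge uv separates u from v. In the direction (u , v) it is counted for v alone; in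
    -- the reverse direction it is never counted, since r lies on the side of u.
    depth-step : ∀ {u v} → T ⊢ u ~ v → r ∉ side T u v → r ∈ V T → depth v ≡ suc (depth u)
    depth-step {u} {v} uv r∉ r∈ = begin
      depth v                                                       ≡⟨ sum-cong-≗ (λ p → trans (sum-cong-≗ (term p)) (∑-distrib-+ (λ z → ≟-b2n p u * ≟-b2n z v) (λ z → b2n (beyond u p z)))) ⟩
      ∑ (λ p → ∑ (λ z → ≟-b2n p u * ≟-b2n z v) + ∑ (λ z → b2n (beyond u p z)))
                                                                    ≡⟨ ∑-distrib-+ (λ p → ∑ (λ z → ≟-b2n p u * ≟-b2n z v)) _ ⟩
      ∑ (λ p → ∑ (λ z → ≟-b2n p u * ≟-b2n z v)) + depth u           ≡⟨ cong (_+ depth u) once ⟩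
      suc (depth u)                                                 ∎
      where
      open ≡-Reasoning
      once : ∑ (λ p → ∑ (λ z → ≟-b2n p u * ≟-b2n z v)) ≡ 1
      once = trans (∑-single u {λ p → ∑ (λ z → ≟-b2n p u * ≟-b2n z v)} λ p p≢u → ∑-zero λ z → cong (_* ≟-b2n z v) (≟-b2n-≢ p≢u))
        (trans (∑-single v {λ z → ≟-b2n u u * ≟-b2n z v} λ z z≢v → trans (cong (≟-b2n u u *_) (≟-b2n-≢ z≢v)) (ℕ.*-zeroʳ (≟-b2n u u)))
          (cong₂ _*_ (≟-b2n-refl u) (≟-b2n-refl v)))
      same-side : ∀ {p z} → T ⊢ p ~ z → ¬ (p ≡ u × z ≡ v) → ¬ (p ≡ v × z ≡ u) → in-side p z v ≡ in-side p z u
      same-side {p} {z} pz ne₁ ne₂ with in-side p z v in e | in-side p z u in e′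
      ... | true  | true  = refl
      ... | false | false = refl
      ... | true  | false with side-closed pz (lookup⇒∈ {S = side T p z} e) (~-sym uv)
      ...   | inj₁ u∈            = contradiction u∈ (lookup⇒∉ {S = side T p z} e′)
      ...   | inj₂ (refl , refl) = ⊥-elim (ne₁ (refl , refl))
      same-side {p} {z} pz ne₁ ne₂ | false | true with side-closed pz (lookup⇒∈ {S = side T p z} e′) uv
      ...   | inj₁ v∈            = contradiction v∈ (lookup⇒∉ {S = side T p z} e)
      ...   | inj₂ (refl , refl) = ⊥-elim (ne₂ (refl , refl))
      r∈vu : r ∈ side T v u
      r∈vu = [ (λ r∈uv → contradiction r∈uv r∉) , (λ s → s) ]′ (side-cover uv r∈)
      term : ∀ p z → b2n (beyond v p z) ≡ ≟-b2n p u * ≟-b2n z v + b2n (beyond u p z)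
      term p z = go (p Fin.≟ u) (z Fin.≟ v) (p Fin.≟ v) (z Fin.≟ u)
        where
        here-uv : b2n (beyond v u v) ≡ ≟-b2n u u * ≟-b2n v v + b2n (beyond u u v)
        here-uv rewrite ∈⇒lookup uv | ∉⇒lookup r∉ | ∈⇒lookup {S = side T u v} (side-self {u} {v}) | ∉⇒lookup (bridge uv)
          | ≟-b2n-refl u | ≟-b2n-refl v = refl
        elsewhere : ¬ (p ≡ u × z ≡ v) → ≟-b2n p u * ≟-b2n z v ≡ 0 → b2n (beyond v p z) ≡ b2n (beyond u p z) →
          b2n (beyond v p z) ≡ ≟-b2n p u * ≟-b2n z v + b2n (beyond u p z)
        elsewhere _ e h = trans h (cong (_+ b2n (beyond u p z)) (sym e))
        off : ¬ (p ≡ u × z ≡ v) → ¬ (p ≡ v × z ≡ u) → b2n (beyond v p z) ≡ b2n (beyond u p z)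
        off ne₁ ne₂ with adj p z in e
        ... | false = refl
        ... | true  = cong (λ b → b2n (not (in-side p z r) ∧ b)) (same-side (lookup⇒∈ e) ne₁ ne₂)
        reversed : b2n (beyond v v u) ≡ b2n (beyond u v u)
        reversed rewrite ∈⇒lookup r∈vu = refl
        pu-zero : p ≢ u → ≟-b2n p u * ≟-b2n z v ≡ 0
        pu-zero p≢u = cong (_* ≟-b2n z v) (≟-b2n-≢ p≢u)
        go : Dec (p ≡ u) → Dec (z ≡ v) → Dec (p ≡ v) → Dec (z ≡ u) →
          b2n (beyond v p z) ≡ ≟-b2n p u * ≟-b2n z v + b2n (beyond u p z)
        go (yes refl) (yes refl) _ _ = here-uv
        go (yes refl) (no z≢v) _ _ = elsewhere (z≢v ∘ proj₂)
          (trans (cong (≟-b2n u u *_) (≟-b2n-≢ z≢v)) (ℕ.*-zeroʳ (≟-b2n u u)))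
          (off (z≢v ∘ proj₂) λ (u≡v , _) → ~⇒≢ uv u≡v)
        go (no p≢u) _ (yes refl) (yes refl) = elsewhere (p≢u ∘ proj₁) (pu-zero p≢u) reversed
        go (no p≢u) _ (yes _) (no z≢u) = elsewhere (p≢u ∘ proj₁) (pu-zero p≢u) (off (p≢u ∘ proj₁) (z≢u ∘ proj₂))
        go (no p≢u) _ (no p≢v) _ = elsewhere (p≢u ∘ proj₁) (pu-zero p≢u) (off (p≢u ∘ proj₁) (p≢v ∘ proj₁))

  bipartition : ∃[ X ] ∃[ Y ] IsBipartition T X Y
  bipartition = X , Y , record { cover = cover ; disjoint = disjoint ; crossing = crossing }
    where
    r : Fin n
    r = proj₁ nonempty
    open Depth r
    colour : Fin n → Bool
    colour v = odd (depth v)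
    class? : ∀ b v → Dec (v ∈ V T × colour v ≡ b)
    class? b v = (v ∈? V T) ×-dec (colour v Bool.≟ b)
    X Y : Subset n
    X = ⟪ class? true ⟫
    Y = ⟪ class? false ⟫
    cover : X ∪ Y ≡ V T
    cover = ⊆-antisym
      (λ x∈ → [ (λ x∈X → proj₁ (∈⟪⟫⁻ (class? true) x∈X)) , (λ x∈Y → proj₁ (∈⟪⟫⁻ (class? false) x∈Y)) ]′ (x∈p∪q⁻ X Y x∈))
      (λ {x} x∈ → x∈p∪q⁺ (go x x∈ (colour x) refl))
      where
      go : ∀ x → x ∈ V T → ∀ b → colour x ≡ b → x ∈ X ⊎ x ∈ Y
      go x x∈ true  e = inj₁ (∈⟪⟫⁺ (class? true) (x∈ , e))
      go x x∈ false e = inj₂ (∈⟪⟫⁺ (class? false) (x∈ , e))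
    disjoint : X ∩ Y ≡ ⊥
    disjoint = Empty-unique λ (x , x∈) → let x∈X , x∈Y = x∈p∩q⁻ X Y x∈ in
      contradiction (trans (sym (proj₂ (∈⟪⟫⁻ (class? true) x∈X))) (proj₂ (∈⟪⟫⁻ (class? false) x∈Y))) λ ()
    opposite : ∀ {u v} → T ⊢ u ~ v → colour v ≡ not (colour u)
    opposite {u} {v} uv with r ∈? side T u v
    ... | no r∉  = cong odd (depth-step uv r∉ (proj₂ nonempty))
    ... | yes r∈ = trans (sym (Bool.not-involutive (colour v)))
      (cong not (sym (cong odd (depth-step (~-sym uv) (λ r∈′ → side-disjoint uv r∈′ r∈) (proj₂ nonempty)))))
    crossing : ∀ {u v} → T ⊢ u ~ v → (u ∈ X × v ∈ Y) ⊎ (u ∈ Y × v ∈ X)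
    crossing {u} {v} uv = go (colour u) refl
      where
      go : ∀ b → colour u ≡ b → (u ∈ X × v ∈ Y) ⊎ (u ∈ Y × v ∈ X)
      go true  e = inj₁ (∈⟪⟫⁺ (class? true) (~⇒Vˡ uv , e) , ∈⟪⟫⁺ (class? false) (~⇒Vʳ uv , trans (opposite uv) (cong not e)))
      go false e = inj₂ (∈⟪⟫⁺ (class? false) (~⇒Vˡ uv , e) , ∈⟪⟫⁺ (class? true) (~⇒Vʳ uv , trans (opposite uv) (cong not e)))

-- The odd-cut skeleton

module Skeleton (T : Graph n) (tree : IsTree T) {X Y : Subset n} (bip : IsBipartition T X Y) where
  open IsTree tree
  open Tree T tree
  open Parity T tree
  open IsBipartition bip

  inX inY : Fin n → Bool
  inX = lookup X
  inY = lookup Y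

  V-split : ∀ x → b2n (lookup (V T) x) ≡ b2n (inX x) + b2n (inY x)
  V-split x with inX x in ex | inY x in ey
  ... | true  | true  = contradiction (subst (x ∈_) disjoint (x∈p∩q⁺ (lookup⇒∈ ex , lookup⇒∈ ey))) ∉⊥
  ... | true  | false = cong b2n (∈⇒lookup (subst (x ∈_) cover (x∈p∪q⁺ {p = X} {Y} (inj₁ (lookup⇒∈ ex)))))
  ... | false | true  = cong b2n (∈⇒lookup (subst (x ∈_) cover (x∈p∪q⁺ {p = X} {Y} (inj₂ (lookup⇒∈ ey)))))
  ... | false | false = cong b2n (∉⇒lookup λ x∈ → [ lookup⇒∉ ex , lookup⇒∉ ey ]′ (x∈p∪q⁻ X Y (subst (x ∈_) (sym cover) x∈)))

  not-both : ∀ {x} → x ∈ X → x ∈ Y → Empty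
  not-both x∈X x∈Y = ∉⊥ (subst (_ ∈_) disjoint (x∈p∩q⁺ (x∈X , x∈Y)))

  X-alternates : ∀ {x y} → T ⊢ x ~ y → inX x ≢ inX y
  X-alternates xy e with crossing xy
  ... | inj₁ (x∈X , y∈Y) = not-both (lookup⇒∈ (trans (sym e) (∈⇒lookup x∈X))) y∈Y
  ... | inj₂ (x∈Y , y∈X) = not-both (lookup⇒∈ (trans e (∈⇒lookup y∈X))) x∈Y

  Y-alternates : ∀ {x y} → T ⊢ x ~ y → inY x ≢ inY y
  Y-alternates xy e with crossing xy
  ... | inj₁ (x∈X , y∈Y) = not-both x∈X (lookup⇒∈ (trans e (∈⇒lookup y∈Y)))
  ... | inj₂ (x∈Y , y∈X) = not-both y∈X (lookup⇒∈ (trans (sym e) (∈⇒lookup x∈Y)))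

  restrict : (S : Fin n → Bool) (Z : Subset n) → ∑ (λ x → b2n (S x) * b2n (lookup Z x)) ≡ count λ x → S x ∧ lookup Z x
  restrict S Z = sum-cong-≗ λ x → sym (b2n-∧ (S x) (lookup Z x))

  total-of : (Z : Subset n) → (∀ {x} → x ∈ Z → x ∈ V T) → total (b2n ∘ lookup Z) ≡ ∣ Z ∣
  total-of Z Z⊆V = trans (restrict (lookup (V T)) Z) (trans (count-cong eq) (sym (∣∣≡count Z)))
    where
    eq : ∀ x → lookup (V T) x ∧ lookup Z x ≡ lookup Z x
    eq x with lookup Z x in e
    ... | false = Bool.∧-zeroʳ (lookup (V T) x)
    ... | true  = trans (Bool.∧-identityʳ (lookup (V T) x)) (∈⇒lookup (Z⊆V (lookup⇒∈ {S = Z} e)))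

  total-X : total (b2n ∘ inX) ≡ ∣ X ∣
  total-X = total-of X λ x∈ → subst (_ ∈_) cover (x∈p∪q⁺ {p = X} {Y} (inj₁ x∈))

  total-Y : total (b2n ∘ inY) ≡ ∣ Y ∣
  total-Y = total-of Y λ x∈ → subst (_ ∈_) cover (x∈p∪q⁺ {p = X} {Y} (inj₂ x∈))

  even-class⇒solution : odd ∣ X ∣ ≡ false ⊎ odd ∣ Y ∣ ≡ false → Solution₀₁
  even-class⇒solution (inj₁ e) = alternating⇒solution inX X-alternates (trans (cong odd total-X) e)
  even-class⇒solution (inj₂ e) = alternating⇒solution inY Y-alternates (trans (cong odd total-Y) e)

  xs ys : Fin n → Fin n → ℕ
  xs = weight-of-side (b2n ∘ inX)
  ys = weight-of-side (b2n ∘ inY)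

  ∣side∩∣ : ∀ u v (Z : Subset n) → ∣ side T u v ∩ Z ∣ ≡ weight-of-side (b2n ∘ lookup Z) u v
  ∣side∩∣ u v Z = trans (∣∣≡count (side T u v ∩ Z)) (trans (count-cong (lookup-∩ (side T u v) Z)) (sym (restrict (in-side u v) Z)))

  side-size-split : ∀ {u v} → T ⊢ u ~ v → side-size u v ≡ xs u v + ys u v
  side-size-split {u} {v} uv = trans (sum-cong-≗ λ x → eq x)
      (∑-distrib-+ (λ x → b2n (in-side u v x) * b2n (inX x)) (λ x → b2n (in-side u v x) * b2n (inY x)))
    where
    eq : ∀ x → b2n (in-side u v x) ≡ b2n (in-side u v x) * b2n (inX x) + b2n (in-side u v x) * b2n (inY x)
    eq x with in-side u v x in e
    ... | false = refl
    ... | true  = trans (trans (sym (cong b2n (∈⇒lookup (side⊆V uv (lookup⇒∈ e))))) (V-split x))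
      (sym (cong₂ _+_ (ℕ.+-identityʳ (b2n (inX x))) (ℕ.+-identityʳ (b2n (inY x)))))

  private
    oddCut? : ∀ u v → Dec (OddCut T u v)
    oddCut? u v = odd? ∣ side T u v ∣ ×-dec odd? ∣ side T v u ∣

  J⁻ : ∀ {u v} → J T ⊢ u ~ v → T ⊢ u ~ v × OddCut T u v
  J⁻ {u} = ∈⟪⟫⁻ (λ v → (T ⊢ u ~? v) ×-dec oddCut? u v)

  J⁺ : ∀ {u v} → T ⊢ u ~ v → OddCut T u v → J T ⊢ u ~ v
  J⁺ {u} uv o = ∈⟪⟫⁺ (λ v → (T ⊢ u ~? v) ×-dec oddCut? u v) (uv , o)

  side-walk : (G : Graph n) → ∀ {u v} → (∀ {x y} → G ⊢ x ~ y → T ⊢ x ~ y × ¬ SameEdge u v x y) →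
    ∀ {x y} → x ∈ side T u v → Walk G x y → y ∈ side T u v
  side-walk G avoid x∈ nil     = x∈
  side-walk G avoid x∈ (e ◅ w) = let e′ , ne = avoid e in side-walk G avoid (side-extend x∈ e′ ne) w

  J-avoids : ∀ {u v} → ¬ (J T ⊢ u ~ v) → ∀ {x y} → J T ⊢ x ~ y → T ⊢ x ~ y × ¬ SameEdge u v x y
  J-avoids ¬uv e = proj₁ (J⁻ e) , λ { (inj₁ (refl , refl)) → ¬uv e ; (inj₂ (refl , refl)) → ¬uv (N-sym (J T) e) }

  J-sides : ∀ {u v x} → ¬ (J T ⊢ u ~ v) → Walk (J T) v x → x ∈ side T u v
  J-sides ¬uv w = side-walk (J T) (J-avoids ¬uv) side-self w

  -- A walk can leave the side of y only by stepping from y to z, but y lies across vw and a walk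
  -- within the side of v never gets there.
  nested : ∀ {v w y z} → T ⊢ v ~ w → T ⊢ y ~ z → v ∈ side T z y → y ∈ side T v w → ∀ {x} → x ∈ side T w v → x ∈ side T z y
  nested {v} {w} {y} {z} vw yz v∈ y∈ x∈ = go side-self v∈ (side⁻ T x∈)
    where
    go : ∀ {p q} → p ∈ side T w v → p ∈ side T z y → Walk (T -[ w , v ]) p q → q ∈ side T z y
    go p∈ p∈′ nil     = p∈′
    go p∈ p∈′ (e ◅ k) with minus⁻ T e
    ... | e′ , ne with side-closed (~-sym yz) p∈′ e′
    ...   | inj₁ q∈         = go (side-extend p∈ e′ ne) q∈ k
    ...   | inj₂ (refl , _) = contradiction y∈ (side-disjoint vw p∈)

  comp : Fin n → Subset n
  comp r = component (J T) r

  comp⁺ : ∀ {r x} → Walk (J T) r x → x ∈ comp r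
  comp⁺ {r} = ∈⟪⟫⁺ (walk? (J T) r)

  comp⁻ : ∀ {r x} → x ∈ comp r → Walk (J T) r x
  comp⁻ {r} = ∈⟪⟫⁻ (walk? (J T) r)

  comp-closed : ∀ {r x y} → x ∈ comp r → J T ⊢ x ~ y → y ∈ comp r
  comp-closed x∈ e = comp⁺ (comp⁻ x∈ ◅◅ (e ◅ nil))

  module BothOdd (oddX : odd ∣ X ∣ ≡ true) (oddY : odd ∣ Y ∣ ≡ true) where

    xor-true : ∀ a b → a xor b ≡ true → b ≡ not a
    xor-true true  false _ = refl
    xor-true false true  _ = refl

    odd-xs : ∀ {u v} → T ⊢ u ~ v → odd (xs v u) ≡ not (odd (xs u v))
    odd-xs {u} {v} uv = xor-true (odd (xs u v)) _ (trans (sym (odd-+ (xs u v) (xs v u)))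
      (trans (cong odd (trans (sym (weight-edge uv (b2n ∘ inX))) total-X)) oddX))

    odd-ys : ∀ {u v} → T ⊢ u ~ v → odd (ys v u) ≡ not (odd (ys u v))
    odd-ys {u} {v} uv = xor-true (odd (ys u v)) _ (trans (sym (odd-+ (ys u v) (ys v u)))
      (trans (cong odd (trans (sym (weight-edge uv (b2n ∘ inY))) total-Y)) oddY))

    odd-side : ∀ {u v} → T ⊢ u ~ v → odd (side-size u v) ≡ odd (xs u v) xor odd (ys u v)
    odd-side {u} {v} uv = trans (cong odd (side-size-split uv)) (odd-+ (xs u v) (ys u v))

    odd-side-sym : ∀ {u v} → T ⊢ u ~ v → odd (side-size v u) ≡ odd (side-size u v)
    odd-side-sym {u} {v} uv = trans (odd-side (~-sym uv)) (trans (cong₂ _xor_ (odd-xs uv) (odd-ys uv))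
      (trans (not-not (odd (xs u v)) (odd (ys u v))) (sym (odd-side uv))))
      where
      not-not : ∀ a b → not a xor not b ≡ a xor b
      not-not true  b = refl
      not-not false b = Bool.not-involutive b

    odd-side⇒J : ∀ {u v} → T ⊢ u ~ v → odd (side-size u v) ≡ true → J T ⊢ u ~ v
    odd-side⇒J {u} {v} uv o = J⁺ uv
      ( odd⇒Odd (trans (cong odd (∣∣≡count (side T u v))) o)
      , odd⇒Odd (trans (cong odd (∣∣≡count (side T v u))) (trans (odd-side-sym uv) o)))

    J⇒odd-side : ∀ {u v} → J T ⊢ u ~ v → odd (side-size u v) ≡ true
    J⇒odd-side {u} {v} e = trans (sym (cong odd (∣∣≡count (side T u v)))) (Odd⇒odd (proj₁ (proj₂ (J⁻ e))))

    nonJ-parities : ∀ {u v} → T ⊢ u ~ v → ¬ (J T ⊢ u ~ v) → odd (xs u v) ≡ odd (ys u v)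
    nonJ-parities {u} {v} uv ¬e = xor-false _ _ (trans (sym (odd-side uv)) (Bool.¬-not (¬e ∘ odd-side⇒J uv)))
      where
      xor-false : ∀ a b → a xor b ≡ false → a ≡ b
      xor-false true  true  _ = refl
      xor-false false false _ = refl

    -- Both sides of a nonskeleton edge are even, so the parities in X and Y agree on each side, and
    -- the one in X determines the orientation.
    directed⇔ : ∀ {v w} → T ⊢ v ~ w → ¬ (J T ⊢ v ~ w) → does (directedAway? T X Y v w) ≡ odd (xs v w)
    directed⇔ {v} {w} vw ¬e = go (odd (xs v w)) refl
      where
      go : ∀ b → odd (xs v w) ≡ b → does (directedAway? T X Y v w) ≡ b
      go true  o = dec-true (directedAway? T X Y v w)
        (vw , ¬e , odd⇒Odd (trans (cong odd (∣side∩∣ v w X)) o)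
        , odd⇒Odd (trans (cong odd (∣side∩∣ v w Y)) (trans (sym (nonJ-parities vw ¬e)) o)))
      go false o = dec-false (directedAway? T X Y v w) λ (_ , _ , ox , _) →
        contradiction (trans (sym (Odd⇒odd ox)) (trans (cong odd (∣side∩∣ v w X)) o)) λ ()

    ℓ : Fin n → ℕ
    ℓ v = count λ w → does (directedAway? T X Y v w)

    outLoad≡ℓ : ∀ v → outLoad T X Y v ≡ ℓ v
    outLoad≡ℓ v = trans (∣∣≡count ⟪ directedAway? T X Y v ⟫) (count-cong (lookup∘tabulate (does ∘ directedAway? T X Y v)))

    load : Fin n → ℕ
    load = adjustedLoad T X Y

    -- The order of T is even, so the branches at v have odd total order, and the odd branches are
    -- those at skeleton edges. This makes every load odd, as required of an offset.
    odd-degree : ∀ {v} → v ∈ V T → odd (degree (J T) v) ≡ true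
    odd-degree {v} v∈ = begin
      odd (degree (J T) v)                                      ≡⟨ cong odd (degree≡count (J T) v) ⟩
      odd (count (lookup (N (J T) v)))                          ≡⟨ odd-∑-cong term ⟩
      odd (∑ λ y → b2n (adj v y) * weight-of-side unit v y)      ≡⟨ cong (odd ∘ (_∸ 1)) (sym (weight-vertex v∈ unit)) ⟩
      odd (total unit ∸ 1)                                       ≡⟨ pred-even (total unit) (trans (weight-vertex v∈ unit) refl) even ⟩
      true                                                      ∎
      where
      open ≡-Reasoning
      unit : Fin n → ℕ
      unit _ = 1
      size : ∀ u w → weight-of-side unit u w ≡ side-size u w
      size u w = sum-cong-≗ λ x → ℕ.*-identityʳ (b2n (in-side u w x))
      even : odd (total unit) ≡ false
      even = begin
        odd (total unit)                                         ≡⟨ cong odd (sum-cong-≗ λ x → trans (ℕ.*-identityʳ _) (trans (V-split x) (cong₂ _+_ (in-V inX total-X′ x) (in-V inY total-Y′ x)))) ⟩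
        odd (∑ λ x → b2n (lookup (V T) x) * b2n (inX x) + b2n (lookup (V T) x) * b2n (inY x))
          ≡⟨ cong odd (trans (∑-distrib-+ (λ x → b2n (lookup (V T) x) * b2n (inX x)) (λ x → b2n (lookup (V T) x) * b2n (inY x))) (cong₂ _+_ total-X total-Y)) ⟩
        odd (∣ X ∣ + ∣ Y ∣)                                      ≡⟨ odd-+ ∣ X ∣ ∣ Y ∣ ⟩
        odd ∣ X ∣ xor odd ∣ Y ∣                                  ≡⟨ cong₂ _xor_ oddX oddY ⟩
        false                                                   ∎
        where
        total-X′ : ∀ x → inX x ≡ true → lookup (V T) x ≡ true
        total-X′ x e = ∈⇒lookup (subst (x ∈_) cover (x∈p∪q⁺ {p = X} {Y} (inj₁ (lookup⇒∈ e))))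
        total-Y′ : ∀ x → inY x ≡ true → lookup (V T) x ≡ true
        total-Y′ x e = ∈⇒lookup (subst (x ∈_) cover (x∈p∪q⁺ {p = X} {Y} (inj₂ (lookup⇒∈ e))))
        in-V : (f : Fin n → Bool) → (∀ x → f x ≡ true → lookup (V T) x ≡ true) → ∀ x → b2n (f x) ≡ b2n (lookup (V T) x) * b2n (f x)
        in-V f h x with f x in e
        ... | false = sym (ℕ.*-zeroʳ (b2n (lookup (V T) x)))
        ... | true  = sym (cong (λ b → b2n b * 1) (h x e))
      pred-even : ∀ k {j} → k ≡ suc j → odd k ≡ false → odd (k ∸ 1) ≡ true
      pred-even (suc k) _ e = trans (sym (Bool.not-involutive (odd k))) (cong not e)
      term : ∀ y → odd (b2n (lookup (N (J T) v) y)) ≡ odd (b2n (adj v y) * weight-of-side unit v y)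
      term y with adj v y in e
      ... | false = cong (odd ∘ b2n) (∉⇒lookup {S = N (J T) v} λ j → lookup⇒∉ e (proj₁ (J⁻ j)))
      ... | true  = trans (odd-b2n _) (trans (go (lookup (N (J T) v) y) refl) (cong odd (sym (trans (ℕ.+-identityʳ _) (size v y)))))
        where
        go : ∀ b → lookup (N (J T) v) y ≡ b → b ≡ odd (side-size v y)
        go true  j = sym (J⇒odd-side (lookup⇒∈ j))
        go false j = sym (Bool.¬-not λ o → lookup⇒∉ j (odd-side⇒J (lookup⇒∈ e) o))

    load-odd : ∀ {v} → v ∈ V T → odd (load v) ≡ true
    load-odd {v} v∈ = trans (odd-+ (degree (J T) v) (2 * outLoad T X Y v))
      (trans (cong₂ _xor_ (odd-degree v∈) (odd-2* (outLoad T X Y v))) refl)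

    module Component (r : Fin n) (r∈ : r ∈ V T) where

      H : Graph n
      H = skeletonComponent T r

      H⁺ : ∀ {x y} → x ∈ comp r → J T ⊢ x ~ y → H ⊢ x ~ y
      H⁺ x∈ e = induced⁺ (J T) e x∈ (comp-closed x∈ e)

      H⁻ : ∀ {x y} → H ⊢ x ~ y → J T ⊢ x ~ y × x ∈ comp r × y ∈ comp r
      H⁻ = induced⁻ (J T)

      H⊆T : ∀ {x y} → H ⊢ x ~ y → T ⊢ x ~ y
      H⊆T e = proj₁ (J⁻ (proj₁ (H⁻ e)))

      comp⊆V : ∀ {x} → x ∈ comp r → x ∈ V T
      comp⊆V x∈ = go r∈ (comp⁻ x∈)
        where
        go : ∀ {p q} → p ∈ V T → Walk (J T) p q → q ∈ V T
        go p∈ nil     = p∈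
        go p∈ (e ◅ w) = go (~⇒Vʳ (proj₁ (J⁻ e))) w

      H-V⁺ : ∀ {x} → x ∈ comp r → x ∈ V H
      H-V⁺ x∈ = x∈p∩q⁺ (comp⊆V x∈ , x∈)

      H-V⁻ : ∀ {x} → x ∈ V H → x ∈ comp r
      H-V⁻ x∈ = proj₂ (x∈p∩q⁻ (V T) (comp r) x∈)

      r∈comp : r ∈ comp r
      r∈comp = comp⁺ nil

      J-walk : ∀ {x y} → x ∈ comp r → y ∈ comp r → Walk (J T) x y
      J-walk x∈ y∈ = reverse-walk (J T) (comp⁻ x∈) ◅◅ comp⁻ y∈

      H-tree : IsTree H
      H-tree = record
        { nonempty  = r , H-V⁺ r∈comp
        ; connected = λ x∈ y∈ → lift (H-V⁻ x∈) (J-walk (H-V⁻ x∈) (H-V⁻ y∈))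
        ; acyclic   = λ { [] () ; (v ∷ vs) (len , unique , linked) → acyclic (v ∷ vs) (len , unique , Linked.map H⊆T linked) }
        }
        where
        lift : ∀ {p q} → p ∈ comp r → Walk (J T) p q → Walk H p q
        lift p∈ nil     = nil
        lift p∈ (e ◅ w) = H⁺ p∈ e ◅ lift (comp-closed p∈ e) w

      adjH : Fin n → Fin n → Bool
      adjH v y = lookup (N H v) y

      degH : Fin n → ℕ
      degH v = count (adjH v)

      cntH : (Fin n → Fin n → Bool) → Fin n → ℕ
      cntH F v = count λ y → adjH v y ∧ F v y

      load-split : ∀ {v} → v ∈ comp r → load v ≡ degH v + (ℓ v + ℓ v)
      load-split {v} v∈ = cong₂ _+_ (trans (degree≡count (J T) v) (count-cong eq))
          (cong₂ _+_ (outLoad≡ℓ v) (trans (ℕ.+-identityʳ _) (outLoad≡ℓ v)))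
        where
        eq : ∀ y → lookup (N (J T) v) y ≡ adjH v y
        eq y = go (J T ⊢ v ~? y)
          where
          go : Dec (J T ⊢ v ~ y) → lookup (N (J T) v) y ≡ adjH v y
          go (yes j) = trans (∈⇒lookup j) (sym (∈⇒lookup (H⁺ v∈ j)))
          go (no ¬j) = trans (∉⇒lookup ¬j) (sym (∉⇒lookup {S = N H v} (¬j ∘ proj₁ ∘ H⁻)))

      cnt-split : ∀ F {v} → v ∈ comp r → (∀ {y} → T ⊢ v ~ y → ¬ (J T ⊢ v ~ y) → F v y ≡ odd (xs v y)) →
        cnt F v ≡ cntH F v + ℓ v
      cnt-split F {v} v∈ consistent = trans (sum-cong-≗ eq) (∑-distrib-+ (λ y → b2n (adjH v y ∧ F v y)) (λ y → b2n (does (directedAway? T X Y v y))))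
        where
        eq : ∀ y → b2n (adj v y ∧ F v y) ≡ b2n (adjH v y ∧ F v y) + b2n (does (directedAway? T X Y v y))
        eq y = go (T ⊢ v ~? y) (J T ⊢ v ~? y)
          where
          Goal : Set
          Goal = b2n (adj v y ∧ F v y) ≡ b2n (adjH v y ∧ F v y) + b2n (does (directedAway? T X Y v y))
          compute : ∀ {a h d} → adj v y ≡ a → adjH v y ≡ h → does (directedAway? T X Y v y) ≡ d →
            b2n (a ∧ F v y) ≡ b2n (h ∧ F v y) + b2n d → Goal
          compute refl refl refl e = e
          go : Dec (T ⊢ v ~ y) → Dec (J T ⊢ v ~ y) → Goal
          go (no ¬e) _ = compute (∉⇒lookup ¬e) (∉⇒lookup {S = N H v} (¬e ∘ H⊆T)) (dec-false (directedAway? T X Y v y) (¬e ∘ proj₁)) refl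
          go (yes e) (yes j) = compute (∈⇒lookup e) (∈⇒lookup (H⁺ v∈ j)) (dec-false (directedAway? T X Y v y) λ (_ , ¬j , _) → ¬j j)
            (sym (ℕ.+-identityʳ (b2n (F v y))))
          go (yes e) (no ¬j) = compute (∈⇒lookup e) (∉⇒lookup {S = N H v} (¬j ∘ proj₁ ∘ H⁻)) (directed⇔ e ¬j) (cong b2n (consistent e ¬j))

      -- The hypothesis on F says that twice the count at v is load v plus the signed value of v in H.
      blocked-component : 𝒞 H → (∀ {x y} → x ∈ comp r → y ∈ comp r → load x ≡ load y) →
        ∀ F → Sym F → (∀ {x y} → T ⊢ x ~ y → cnt F x ≢ cnt F y) →
        ¬ (∀ {v y} → v ∈ comp r → T ⊢ v ~ y → ¬ (J T ⊢ v ~ y) → F v y ≡ odd (xs v y))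
      blocked-component c const F F-sym F-proper consistent = Obstruction.no-solution H c (record
        { label = F ; label-sym = λ e → F-sym (H⊆T e) ; proper = proper })
        where
        proper : ∀ {x y} → H ⊢ x ~ y → ¬ (cntH F x + cntH F x + degH y ≡ cntH F y + cntH F y + degH x)
        proper {x} {y} e eq = let _ , x∈ , y∈ = H⁻ e in F-proper (H⊆T e) (begin
          cnt F x             ≡⟨ cnt-split F x∈ (consistent x∈) ⟩
          cntH F x + ℓ x      ≡⟨ cancel (cntH F x) (cntH F y) (ℓ x) (ℓ y) (degH x) (degH y) eq
                                   (trans (sym (load-split x∈)) (trans (const x∈ y∈) (load-split y∈))) ⟩
          cntH F y + ℓ y      ≡⟨ sym (cnt-split F y∈ (consistent y∈)) ⟩
          cnt F y             ∎)
          where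
          open ≡-Reasoning
          double-injective : ∀ {i j} → i + i ≡ j + j → i ≡ j
          double-injective {i} {j} = Signed.double-injective T tree (λ _ → 0) (λ _ → refl) {i} {j}
          shuffle : ∀ a l d e → (a + l) + (a + l) + (d + e) ≡ (a + a + e) + (d + (l + l))
          shuffle = solve-∀
          -- The sum of the two hypotheses is twice the claim, with `d + e` added on both sides.
          cancel : ∀ a b l m d e → a + a + e ≡ b + b + d → d + (l + l) ≡ e + (m + m) → a + l ≡ b + m
          cancel a b l m d e p q = double-injective (ℕ.+-cancelʳ-≡ (d + e) _ _ (trans (shuffle a l d e)
            (trans (cong₂ _+_ p q) (trans (sym (shuffle b m e d)) (cong ((b + m) + (b + m) +_) (ℕ.+-comm e d))))))

-- Weights 0 and 1: the skeleton condition and extension from a component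

module SkeletonTheorem (T : Graph n) (tree : IsTree T) {X Y : Subset n} (bip : IsBipartition T X Y)
  (oddX : odd ∣ X ∣ ≡ true) (oddY : odd ∣ Y ∣ ≡ true) where
  open IsTree tree
  open Tree T tree
  open Parity T tree
  open Skeleton T tree bip
  open BothOdd oddX oddY

  -- A nonskeleton edge is labelled consistently at exactly one of its ends, so moving from a component along an
  -- inconsistent edge never leads back, and ends in a component all of whose nonskeleton edges are consistent.
  condition⇒no-solution : SkeletonCondition T X Y → ¬ Solution₀₁
  condition⇒no-solution cond (F , F-sym , F-proper) = start
    where
    open SkeletonCondition cond

    Inconsistent : Fin n → Fin n → Fin n → Set
    Inconsistent r y z = y ∈ comp r × T ⊢ y ~ z × ¬ (J T ⊢ y ~ z) × F y z ≢ odd (xs y z)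

    inconsistent? : ∀ r → Dec (∃[ y ] ∃[ z ] Inconsistent r y z)
    inconsistent? r = Fin.any? λ y → Fin.any? λ z →
      (y ∈? comp r) ×-dec (T ⊢ y ~? z) ×-dec ¬? (J T ⊢ y ~? z) ×-dec ¬? (F y z Bool.≟ odd (xs y z))

    exit : ∀ {r} → r ∈ V T → ∃[ y ] ∃[ z ] Inconsistent r y z
    exit {r} r∈ = go (inconsistent? r)
      where
      open Component r r∈
      go : Dec (∃[ y ] ∃[ z ] Inconsistent r y z) → ∃[ y ] ∃[ z ] Inconsistent r y z
      go (yes found) = found
      go (no none)   = ⊥-elim (blocked-component (inClass r∈) (λ x∈ y∈ → constant r∈ (H-V⁺ x∈) (H-V⁺ y∈)) F F-sym F-proper consistent)
        where
        consistent : ∀ {v y} → v ∈ comp r → T ⊢ v ~ y → ¬ (J T ⊢ v ~ y) → F v y ≡ odd (xs v y)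
        consistent {v} {y} v∈ e ¬j with F v y Bool.≟ odd (xs v y)
        ... | yes eq = eq
        ... | no neq = contradiction (v , y , v∈ , e , ¬j , neq) none

    other-end : ∀ {y z} → T ⊢ y ~ z → F y z ≢ odd (xs y z) → F z y ≡ odd (xs z y)
    other-end yz neq = trans (sym (F-sym yz)) (trans (Bool.¬-not neq) (sym (odd-xs yz)))

    descend : ∀ {v w} → T ⊢ v ~ w → ¬ (J T ⊢ v ~ w) → F w v ≡ odd (xs w v) → Acc _<_ (side-size v w) → Empty
    descend {v} {w} vw ¬vw cons (acc rs) = next (exit (~⇒Vʳ vw))
      where
      module _ {y z} (y∈ : y ∈ comp w) (yz : T ⊢ y ~ z) (¬yz : ¬ (J T ⊢ y ~ z)) (incons : F y z ≢ odd (xs y z)) where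
        y∈vw : y ∈ side T v w
        y∈vw = J-sides ¬vw (comp⁻ y∈)
        w∈zy : w ∈ side T z y
        w∈zy = J-sides (¬yz ∘ N-sym (J T)) (reverse-walk (J T) (comp⁻ y∈))
        v∈zy : v ∈ side T z y
        -- The walk cannot turn back: the edge vw is consistent at its end w, so it is not the
        -- inconsistent edge yz.
        v∈zy = [ (λ v∈ → v∈) , (λ { (refl , refl) → contradiction cons incons }) ]′ (side-closed (~-sym yz) w∈zy (~-sym vw))
        yz⊆vw : ∀ {x} → x ∈ side T y z → x ∈ side T v w
        yz⊆vw x∈ = [ (λ x∈′ → x∈′) , (λ x∈′ → contradiction x∈ (side-disjoint yz (nested vw yz v∈zy y∈vw x∈′))) ]′
          (side-cover vw (side⊆V yz x∈))
        smaller : side-size y z < side-size v w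
        smaller = subst (side-size y z <_) (sym (count-without (in-side v w) (∈⇒lookup y∈vw)))
          (s≤s (count-mono (in-side y z) (in-side v w without y) λ x x∈ →
            trans (without-≢ (in-side v w) λ { refl → bridge yz (lookup⇒∈ x∈) }) (∈⇒lookup (yz⊆vw (lookup⇒∈ x∈)))))
      next : ∃[ y ] ∃[ z ] Inconsistent w y z → Empty
      next (y , z , y∈ , yz , ¬yz , incons) = descend yz ¬yz (other-end yz incons) (rs (smaller y∈ yz ¬yz incons))

    start : Empty
    start = let y , z , _ , yz , ¬yz , incons = exit (proj₂ nonempty) in
      descend yz ¬yz (other-end yz incons) (<-wellFounded _)

  module Extend (r : Fin n) (r∈ : r ∈ V T) where
    open Component r r∈

    module _ (FH : Fin n → Fin n → Bool) (FH-sym : ∀ {x y} → H ⊢ x ~ y → FH x y ≡ FH y x)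
      (FH-proper : ∀ {x y} → H ⊢ x ~ y → cntH FH x + ℓ x ≢ cntH FH y + ℓ y) where

      -- Every vertex is joined in T′ to exactly one vertex of H, its gate.
      private
        outside? : ∀ x y → Dec (¬ (H ⊢ x ~ y))
        outside? x y = ¬? (H ⊢ x ~? y)

      T′ : Graph n
      T′ = spanning T outside? (λ {x} {y} → _∘ N-sym H)

      T′⁺ : ∀ {x y} → T ⊢ x ~ y → ¬ (H ⊢ x ~ y) → T′ ⊢ x ~ y
      T′⁺ {x} e ¬h = ∈⟪⟫⁺ (λ y → (T ⊢ x ~? y) ×-dec outside? x y) (e , ¬h)

      T′⁻ : ∀ {x y} → T′ ⊢ x ~ y → T ⊢ x ~ y × ¬ (H ⊢ x ~ y)
      T′⁻ {x} = ∈⟪⟫⁻ (λ y → (T ⊢ x ~? y) ×-dec outside? x y)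

      T′-avoids : ∀ {g c} → H ⊢ g ~ c → ∀ {x y} → T′ ⊢ x ~ y → T ⊢ x ~ y × ¬ SameEdge c g x y
      T′-avoids h e = proj₁ (T′⁻ e) , λ
        { (inj₁ (refl , refl)) → proj₂ (T′⁻ e) (N-sym H h) ; (inj₂ (refl , refl)) → proj₂ (T′⁻ e) h }

      -- Consider the first edge gc on the way from g to g′. If it is in the skeleton, the walk in
      -- `T′` avoids it; if not, a skeleton walk inside the component does. Either way g′ would lie
      -- on the near side.
      gate-unique : ∀ {g g′} → g ∈ comp r → g′ ∈ comp r → Walk T′ g g′ → g ≡ g′
      gate-unique {g} {g′} g∈ g′∈ w = go (g Fin.≟ g′)
        where
        behind : ∀ {c} → Dec (J T ⊢ g ~ c) → g′ ∈ side T c g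
        behind (no ¬j) = J-sides (¬j ∘ N-sym (J T)) (J-walk g∈ g′∈)
        behind (yes j) = side-walk T′ (T′-avoids (H⁺ g∈ j)) side-self w
        go : Dec (g ≡ g′) → g ≡ g′
        go (yes eq)   = eq
        go (no g≢g′) = let c , gc , g′∈gc = branch (comp⊆V g∈) (comp⊆V g′∈) (g≢g′ ∘ sym) in
          contradiction g′∈gc (side-disjoint gc (behind (J T ⊢ g ~? c)))

      Gate : Fin n → Fin n → Set
      Gate z g = g ∈ comp r × Walk T′ g z

      gate-step : ∀ {x y} → T ⊢ x ~ y → ∃[ g ] Gate x g → ∃[ g ] Gate y g
      gate-step {x} {y} e (g , g∈ , w) = go (H ⊢ x ~? y)
        where
        go : Dec (H ⊢ x ~ y) → ∃[ g ] Gate y g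
        go (yes h) = y , proj₂ (proj₂ (H⁻ h)) , nil
        go (no ¬h) = g , g∈ , w ◅◅ (T′⁺ e ¬h ◅ nil)

      gate-exists : ∀ {z} → z ∈ V T → ∃[ g ] Gate z g
      gate-exists z∈ = go (connected r∈ z∈) (r , r∈comp , nil)
        where
        go : ∀ {p q} → Walk T p q → ∃[ g ] Gate p g → ∃[ g ] Gate q g
        go nil     s = s
        go (e ◅ w) s = go w (gate-step e s)

      gate′ : ∀ z → Dec (∃[ g ] Gate z g) → Fin n
      gate′ z (yes (g , _)) = g
      gate′ z (no _)        = r

      gate : Fin n → Fin n
      gate z = gate′ z (Fin.any? λ g → (g ∈? comp r) ×-dec walk? T′ g z)

      gate-spec : ∀ {z} → z ∈ V T → Gate z (gate z)
      gate-spec {z} z∈ = go (Fin.any? λ g → (g ∈? comp r) ×-dec walk? T′ g z)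
        where
        go : ∀ d → Gate z (gate′ z d)
        go (yes (_ , p)) = p
        go (no none)     = contradiction (gate-exists z∈) none

      gate-self : ∀ {g} → g ∈ comp r → gate g ≡ g
      gate-self g∈ = let h∈ , w = gate-spec (comp⊆V g∈) in gate-unique h∈ g∈ w

      gate-edge : ∀ {x y} → T ⊢ x ~ y → ¬ (H ⊢ x ~ y) → gate x ≡ gate y
      gate-edge e ¬h = let g∈ , w = gate-spec (~⇒Vˡ e) ; g′∈ , w′ = gate-spec (~⇒Vʳ e) in
        gate-unique g∈ g′∈ (w ◅◅ (T′⁺ e ¬h ◅ reverse-walk T′ w′))

      outer-side : ∀ {v y} → v ∈ comp r → T ⊢ v ~ y → ¬ (J T ⊢ v ~ y) → ∀ {x} → x ∈ comp r → x ∉ side T v y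
      outer-side v∈ vy ¬j x∈ = side-disjoint vy (J-sides (¬j ∘ N-sym (J T)) (J-walk v∈ x∈))

      gate-side : ∀ {v y} → v ∈ comp r → T ⊢ v ~ y → ¬ (J T ⊢ v ~ y) → ∀ {x} → x ∈ side T v y → gate x ≡ v
      gate-side {v} {y} v∈ vy ¬j x∈ = go side-self
          (trans (sym (gate-edge vy (¬j ∘ proj₁ ∘ H⁻))) (gate-self v∈)) (side⁻ T x∈)
        where
        go : ∀ {p q} → p ∈ side T v y → gate p ≡ v → Walk (T -[ v , y ]) p q → gate q ≡ v
        go p∈ e nil     = e
        go p∈ e (f ◅ w) = let f′ , ne = minus⁻ T f in
          go (side-extend p∈ f′ ne) (trans (sym (gate-edge f′ λ h → outer-side v∈ vy ¬j (proj₁ (proj₂ (H⁻ h))) p∈)) e) w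

      -- On H, `target` is the parity of the count that `FH` prescribes. Off H it follows X or its
      -- complement, whichever fits at the gate, so it alternates along every edge outside H.
      parity shift target : Fin n → Bool
      parity v = odd (cntH FH v + ℓ v)
      shift v  = inX v xor parity v
      target z = inX z xor shift (gate z)

      g : Fin n → ℕ
      g = b2n ∘ target

      F : Fin n → Fin n → Bool
      F x y = if does (H ⊢ x ~? y) then FH x y else join g r x y

      F-inside : ∀ {x y} → H ⊢ x ~ y → F x y ≡ FH x y
      F-inside {x} {y} h = cong (if_then FH x y else join g r x y) (dec-true (H ⊢ x ~? y) h)

      F-outside : ∀ {x y} → ¬ (H ⊢ x ~ y) → F x y ≡ join g r x y
      F-outside {x} {y} ¬h = cong (if_then FH x y else join g r x y) (dec-false (H ⊢ x ~? y) ¬h)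

      F-sym : Sym F
      F-sym {x} {y} e = go (H ⊢ x ~? y)
        where
        go : Dec (H ⊢ x ~ y) → F x y ≡ F y x
        go (yes h) = trans (F-inside h) (trans (FH-sym h) (sym (F-inside (N-sym H h))))
        go (no ¬h) = trans (F-outside ¬h) (trans (join-sym g r∈ e) (sym (F-outside (¬h ∘ N-sym H))))

      -- Complementing X within a side changes the parity there by the order of the side.
      xor-parity : ∀ u v c → odd (∑ λ x → b2n (in-side u v x) * b2n (inX x xor c)) ≡ odd (xs u v) xor (c ∧ odd (side-size u v))
      xor-parity u v false = trans (cong odd (sum-cong-≗ λ x → cong (λ b → b2n (in-side u v x) * b2n b) (Bool.xor-identityʳ (inX x))))
        (sym (Bool.xor-identityʳ (odd (xs u v))))
      xor-parity u v true = flip (odd (xs u v)) _ _ (trans (sym (odd-+ (xs u v) _)) (cong odd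
          (trans (sym (∑-distrib-+ (λ x → b2n (in-side u v x) * b2n (inX x)) (λ x → b2n (in-side u v x) * b2n (inX x xor true))))
            (sum-cong-≗ λ x → complement (in-side u v x) (inX x)))))
        where
        complement : ∀ s b → b2n s * b2n b + b2n s * b2n (b xor true) ≡ b2n s
        complement false b     = refl
        complement true  true  = refl
        complement true  false = refl
        flip : ∀ a b c → a xor b ≡ c → b ≡ a xor c
        flip true  true  c refl = refl
        flip true  false c refl = refl
        flip false b     c e    = e

      -- The branch beyond a nonskeleton edge has even order, so X and its complement have the same
      -- parity there: whichever pattern the gate imposes, the edge gets the label prescribed by its
      -- orientation.
      F-consistent : ∀ {v y} → v ∈ comp r → T ⊢ v ~ y → ¬ (J T ⊢ v ~ y) → F v y ≡ odd (xs v y)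
      F-consistent {v} {y} v∈ vy ¬j = begin
        F v y                                ≡⟨ F-outside (¬j ∘ proj₁ ∘ H⁻) ⟩
        join g r v y                         ≡⟨ join-away g (∉⇒lookup (outer-side v∈ vy ¬j r∈comp)) ⟩
        odd (weight-of-side g v y)           ≡⟨ cong odd (sum-cong-≗ term) ⟩
        odd (∑ λ x → b2n (in-side v y x) * b2n (inX x xor shift v)) ≡⟨ xor-parity v y (shift v) ⟩
        odd (xs v y) xor (shift v ∧ odd (side-size v y))
          ≡⟨ cong (λ b → odd (xs v y) xor (shift v ∧ b)) (Bool.¬-not (¬j ∘ odd-side⇒J vy)) ⟩
        odd (xs v y) xor (shift v ∧ false)   ≡⟨ cong (odd (xs v y) xor_) (Bool.∧-zeroʳ (shift v)) ⟩
        odd (xs v y) xor false               ≡⟨ Bool.xor-identityʳ (odd (xs v y)) ⟩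
        odd (xs v y)                         ∎
        where
        open ≡-Reasoning
        term : ∀ x → b2n (in-side v y x) * g x ≡ b2n (in-side v y x) * b2n (inX x xor shift v)
        term x = go (in-side v y x) refl
          where
          go : ∀ b → in-side v y x ≡ b → b2n b * g x ≡ b2n b * b2n (inX x xor shift v)
          go false _ = refl
          go true  e = cong (λ w → 1 * b2n (inX x xor shift w)) (gate-side v∈ vy ¬j (lookup⇒∈ e))

      cnt-inside : ∀ {v} → v ∈ comp r → cnt F v ≡ cntH FH v + ℓ v
      cnt-inside {v} v∈ = trans (cnt-split F v∈ (F-consistent v∈)) (cong (_+ ℓ v) (count-cong λ y → eq y (adjH v y) refl))
        where
        eq : ∀ y b → adjH v y ≡ b → b ∧ F v y ≡ b ∧ FH v y
        eq y false _ = refl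
        eq y true  e = F-inside (lookup⇒∈ e)

      odd-cnt-target : ∀ {z} → z ∈ V T → odd (cnt F z) ≡ target z
      odd-cnt-target {z} z∈ = go (z ∈? comp r)
        where
        open ≡-Reasoning
        xor-cancel : ∀ a b → a xor (a xor b) ≡ b
        xor-cancel true  b = Bool.not-involutive b
        xor-cancel false b = refl
        go : Dec (z ∈ comp r) → odd (cnt F z) ≡ target z
        go (yes z∈H) = begin
          odd (cnt F z)               ≡⟨ cong odd (cnt-inside z∈H) ⟩
          parity z                    ≡⟨ sym (xor-cancel (inX z) (parity z)) ⟩
          inX z xor shift z           ≡⟨ cong (λ w → inX z xor shift w) (sym (gate-self z∈H)) ⟩
          target z                    ∎
        go (no z∉H) = begin
          odd (cnt F z)               ≡⟨ cong odd (count-cong λ y → cong (adj z y ∧_) (F-outside (z∉H ∘ proj₁ ∘ proj₂ ∘ H⁻))) ⟩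
          -- `join` is rooted in H, so a parity defect of `g` can only sit at r, where the labels
          -- `FH` take over.
          odd (cnt (join g r) z)      ≡⟨ odd-cnt-join g r∈ z∈ (λ { refl → z∉H r∈comp }) ⟩
          odd (g z)                   ≡⟨ odd-b2n (target z) ⟩
          target z                    ∎

      extended : Solution₀₁
      extended = F , F-sym , λ {x} {y} e → proper e (H ⊢ x ~? y)
        where
        xor-cancelʳ : ∀ c {a b} → a xor c ≡ b xor c → a ≡ b
        xor-cancelʳ c {true}  {true}  _ = refl
        xor-cancelʳ c {false} {false} _ = refl
        xor-cancelʳ true  {true} {false} ()
        xor-cancelʳ false {true} {false} ()
        xor-cancelʳ true  {false} {true} ()
        xor-cancelʳ false {false} {true} ()
        proper : ∀ {x y} → T ⊢ x ~ y → Dec (H ⊢ x ~ y) → cnt F x ≢ cnt F y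
        proper e (yes h) eq = let _ , x∈ , y∈ = H⁻ h in
          FH-proper h (trans (sym (cnt-inside x∈)) (trans eq (cnt-inside y∈)))
        proper {x} {y} e (no ¬h) eq = X-alternates e (xor-cancelʳ (shift (gate x))
          (trans (sym (odd-cnt-target (~⇒Vˡ e))) (trans (cong odd eq)
            (trans (odd-cnt-target (~⇒Vʳ e)) (cong (λ w → inX y xor shift w) (sym (gate-edge e ¬h)))))))

    private
      parity-H : ∀ {x y} → H ⊢ x ~ y → odd (load x) ≡ odd (load y)
      parity-H h = trans (load-odd (~⇒Vˡ (H⊆T h))) (sym (load-odd (~⇒Vʳ (H⊆T h))))

    component-theorem : Solution₀₁ ⊎ (𝒞 H × (∀ {x y} → x ∈ V H → y ∈ V H → load x ≡ load y))
    component-theorem = go (SignedTheorem.signed-theorem H H-tree load parity-H)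
      where
      open Signed H H-tree load parity-H using (Solution)
      go : Solution ⊎ (𝒞 H × (∀ {x y} → x ∈ V H → y ∈ V H → load x ≡ load y)) →
        Solution₀₁ ⊎ (𝒞 H × (∀ {x y} → x ∈ V H → y ∈ V H → load x ≡ load y))
      go (inj₂ c) = inj₂ c
      go (inj₁ s) = inj₁ (extended label label-sym λ {x} {y} h eq → proper h (conflict h eq))
        where
        open Solution s
        open ≡-Reasoning
        shuffle : ∀ d l a e → d + (l + l) + (a + a) + e ≡ (d + e) + ((a + l) + (a + l))
        shuffle = solve-∀
        conflict : ∀ {x y} → H ⊢ x ~ y → cntH label x + ℓ x ≡ cntH label y + ℓ y →
          load x + (cntH label x + cntH label x) + degH y ≡ load y + (cntH label y + cntH label y) + degH x
        conflict {x} {y} h eq = let _ , x∈ , y∈ = H⁻ h ; a = cntH label x ; b = cntH label y in begin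
          load x + (a + a) + degH y                               ≡⟨ cong (λ k → k + (a + a) + degH y) (load-split x∈) ⟩
          degH x + (ℓ x + ℓ x) + (a + a) + degH y                 ≡⟨ shuffle (degH x) (ℓ x) a (degH y) ⟩
          (degH x + degH y) + ((a + ℓ x) + (a + ℓ x))             ≡⟨ cong₂ _+_ (ℕ.+-comm (degH x) (degH y)) (cong₂ _+_ eq eq) ⟩
          (degH y + degH x) + ((b + ℓ y) + (b + ℓ y))             ≡⟨ sym (shuffle (degH y) (ℓ y) b (degH x)) ⟩
          degH y + (ℓ y + ℓ y) + (b + b) + degH x                 ≡⟨ cong (λ k → k + (b + b) + degH x) (sym (load-split y∈)) ⟩
          load y + (b + b) + degH x                               ∎

  no-solution⇒condition : ¬ Solution₀₁ → SkeletonCondition T X Y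
  no-solution⇒condition none = record
    { inClass  = λ {r} r∈ → proj₁ (at-component r r∈)
    ; constant = λ {r} r∈ → proj₂ (at-component r r∈)
    }
    where
    at-component : ∀ r → r ∈ V T → 𝒞 (skeletonComponent T r) ×
      (∀ {x y} → x ∈ V (skeletonComponent T r) → y ∈ V (skeletonComponent T r) → load x ≡ load y)
    at-component r r∈ = [ (λ s → contradiction s none) , (λ c → c) ]′ (Extend.component-theorem r r∈)

module BinaryTheorem (T : Graph n) (tree : IsTree T) where
  open Parity T tree

  binary-theorem : (¬ Solution₀₁) ⇔ (∃[ X ] ∃[ Y ] (IsBipartition T X Y × Odd ∣ X ∣ × Odd ∣ Y ∣ × SkeletonCondition T X Y))
  binary-theorem = mk⇔ to from
    where
    to : ¬ Solution₀₁ → ∃[ X ] ∃[ Y ] (IsBipartition T X Y × Odd ∣ X ∣ × Odd ∣ Y ∣ × SkeletonCondition T X Y)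
    to none = let X , Y , bip = bipartition
                  oddX = Bool.¬-not (none ∘ Skeleton.even-class⇒solution T tree bip ∘ inj₁)
                  oddY = Bool.¬-not (none ∘ Skeleton.even-class⇒solution T tree bip ∘ inj₂)
              in X , Y , bip , odd⇒Odd oddX , odd⇒Odd oddY , SkeletonTheorem.no-solution⇒condition T tree bip oddX oddY none
    from : ∃[ X ] ∃[ Y ] (IsBipartition T X Y × Odd ∣ X ∣ × Odd ∣ Y ∣ × SkeletonCondition T X Y) → ¬ Solution₀₁
    from (X , Y , bip , oddX , oddY , cond) = SkeletonTheorem.condition⇒no-solution T tree bip (Odd⇒odd oddX) (Odd⇒odd oddY) cond

-- Weights a and b with ab = 0

-- If a is away from zero it can be cancelled, and otherwise it is null. Which of the two holds
-- cannot be decided, hence the double negation; this suffices because it is only used to refute.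
product-zero : ∀ (a b : ℝ) → a *ℝ b ≈ 0ℝ → ¬ ¬ (a ≈ 0ℝ ⊎ b ≈ 0ℝ)
product-zero a b ab≈0 neither = neither (inj₁ (minus-0 (seq a) (¬Away⇒Null {seq a} (cauchy a) λ away →
    neither (inj₂ (minus-0 (seq b) (Null-cancel {seq a} {seq b} away
      (Null-cong (λ i → solve 1 (λ x → x :- con 0ℚ := x) refl (seq a i ℚ.* seq b i)) ab≈0)))))))
  where
  minus-0 : ∀ s → Null s → Null λ i → s i ℚ.- 0ℚ
  minus-0 s = Null-cong λ i → solve 1 (λ x → x := x :- con 0ℚ) refl (s i)

module ZeroWeight (a b : ℝ) (a≉b : a ≉ b) (a≈0 : a ≈ 0ℝ) (T : Graph n) (tree : IsTree T) where
  open Weighting a b T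
  open Linear.Zero a b a≉b a≈0
  open Parity T tree using (Solution₀₁)

  solution⇒weighting : Solution₀₁ → AdmitsProper ｛ a , b ｝ T
  solution⇒weighting (F , F-sym , F-proper) = label⇒weighting F F-sym λ {x} {y} e eq →
    F-proper e (ValEq⇒≡ {count (nbr x)} {nbr-count F x} {count (nbr y)} {nbr-count F y} eq)

  weighting⇒solution : AdmitsProper ｛ a , b ｝ T → Solution₀₁
  weighting⇒solution admits = let F , F-sym , F-proper = weighting⇒label a≉b admits in
    F , F-sym , λ {x} {y} e eq → F-proper e (≡⇒ValEq {count (nbr x)} {nbr-count F x} {count (nbr y)} {nbr-count F y} eq)

module ZeroProduct (a b : ℝ) (a≉b : a ≉ b) (ab≈0 : a *ℝ b ≈ 0ℝ) (T : Graph n) (tree : IsTree T) where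
  open Parity T tree using (Solution₀₁)

  private
    b≉a : b ≉ a
    b≉a = a≉b ∘ Weighting.≈-sym a b T b a

  admits⇔solution : (¬ AdmitsProper ｛ a , b ｝ T → ¬ Solution₀₁) × (¬ Solution₀₁ → ¬ AdmitsProper ｛ a , b ｝ T)
  admits⇔solution = (λ none s → product-zero a b ab≈0 (none ∘ weighting s)) , (λ none admits → product-zero a b ab≈0 (none ∘ solution admits))
    where
    weighting : Solution₀₁ → a ≈ 0ℝ ⊎ b ≈ 0ℝ → AdmitsProper ｛ a , b ｝ T
    weighting s (inj₁ a≈0) = ZeroWeight.solution⇒weighting a b a≉b a≈0 T tree s
    weighting s (inj₂ b≈0) = swap-weights {a = b} {a} (ZeroWeight.solution⇒weighting b a b≉a b≈0 T tree s)
    solution : AdmitsProper ｛ a , b ｝ T → a ≈ 0ℝ ⊎ b ≈ 0ℝ → Solution₀₁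
    solution m (inj₁ a≈0) = ZeroWeight.weighting⇒solution a b a≉b a≈0 T tree m
    solution m (inj₂ b≈0) = ZeroWeight.weighting⇒solution b a b≉a b≈0 T tree (swap-weights {a = a} {b} m)

  zero-product-theorem : (¬ AdmitsProper ｛ a , b ｝ T) ⇔
    (∃[ X ] ∃[ Y ] (IsBipartition T X Y × Odd ∣ X ∣ × Odd ∣ Y ∣ × SkeletonCondition T X Y))
  zero-product-theorem = mk⇔ (Equivalence.to binary-theorem ∘ proj₁ admits⇔solution) (proj₂ admits⇔solution ∘ Equivalence.from binary-theorem)
    where open BinaryTheorem T tree

theorem1 : ∀ (a b : ℝ) → a ≉ b → ∀ {n : ℕ} (T : Graph n) → IsTree T →
    (a *ℝ b *ℝ (a +ℝ b) ≉ 0ℝ → ((¬ AdmitsProper ｛ a , b ｝ T) ⇔ T ≅ K₂)) ×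
    (a +ℝ b ≈ 0ℝ → ((¬ AdmitsProper ｛ a , b ｝ T) ⇔ 𝒞 T)) ×
    (a *ℝ b ≈ 0ℝ → ((¬ AdmitsProper ｛ a , b ｝ T) ⇔
    (∃[ X ] ∃[ Y ] (IsBipartition T X Y × Odd ∣ X ∣ × Odd ∣ Y ∣ × SkeletonCondition T X Y))))
theorem1 a b a≉b T tree =
    (λ h → GenericWeights.generic-weights-theorem a b a≉b h T tree)
  , (λ h → OppositeWeights.opposite-theorem a b a≉b h T tree)
  , (λ h → ZeroProduct.zero-product-theorem a b a≉b h T tree)
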